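{- The \textsc{Paw-free Edge Deletion} problem, parameterized by $k$, admits a kernel of size $\mathcal{O}(k^3)$: there is a polynomial-time algorithm that, given an instance $(G,k)$, outputs an equivalent instance $(G',k')$ of the same problem with $k'\le k$ and $G'$ having $\mathcal{O}(k^3)$ vertices.
   Context: The paw is the graph on four vertices $x_1,x_2,x_3,x_4$ with edges $x_1x_2,x_2x_3,x_1x_3,x_3x_4$. A graph is paw-free if it has no induced subgraph isomorphic to the paw. \textsc{Paw-free Edge Deletion}: given a graph $G$ and an integer $k$, decide whether there is a set $A\subseteq E(G)$ with $|A|\le k$ such that $G-A$ is paw-free. A kernel is a polynomial-time algorithm mapping an instance to an equivalent instance whose size is bounded by a function of $k$ only. -}

module Defs where

open import Data.Bool.Base using (Bool; true; false; T; not; _∧_)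
import Data.Bool.Properties as Bool
open import Data.Fin.Base using (Fin; zero; _<_)
open import Data.Fin.Patterns using (0F; 1F; 2F; 3F)
open import Data.Fin.Properties using (all?; _<?_)
open import Data.List.Base as List using (List; []; _∷_; allFin; cartesianProduct; filter; foldr; length)
open import Data.Nat.Base as ℕ using (ℕ; suc; _+_; _*_; _^_; _≤_)
open import Data.Nat.Binary.Base as ℕᵇ using (ℕᵇ; 2[1+_]; 1+[2_])
open import Data.Product.Base using (_×_; _,_; ∃; ∃-syntax; Σ-syntax)
open import Data.Vec.Base as Vec using (Vec; _∷_; lookup; _[_]≔_)
open import Function.Base using (_∘_)
open import Function.Definitions using (Injective)
open import Relation.Binary.PropositionalEquality using (_≡_; cong; cong₂)
open import Relation.Nullary.Decidable using (from-yes; _×-dec_)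
open import Relation.Nullary.Negation using (¬_)

------------------------------------------------------------------------
-- Finite simple graphs

record Graph (n : ℕ) : Set where
  field
    adj        : Fin n → Fin n → Bool
    adj-sym    : ∀ i j → adj i j ≡ adj j i
    adj-irrefl : ∀ i → adj i i ≡ false

open Graph public

Edge : ∀ {n} → Graph n → Fin n → Fin n → Set
Edge G i j = T (adj G i j)

-- Each undirected edge is listed once, as the pair (i , j) with i < j.
edges : ∀ {n} → Graph n → List (Fin n × Fin n)
edges {n} G =
  filter (λ (i , j) → (i <? j) ×-dec Bool.T? (adj G i j))
         (cartesianProduct (allFin n) (allFin n))

∣E_∣ : ∀ {n} → Graph n → ℕ
∣E G ∣ = length (edges G)

-- A set of edges on the vertex set Fin n is the same thing as a simple
-- graph on Fin n, so sets A ⊆ E(G) are represented by graphs A with A ⊆ᴱ G.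
_⊆ᴱ_ : ∀ {n} → Graph n → Graph n → Set
A ⊆ᴱ G = ∀ i j → Edge A i j → Edge G i j

_─_ : ∀ {n} → Graph n → Graph n → Graph n
adj        (G ─ A) i j = adj G i j ∧ not (adj A i j)
adj-sym    (G ─ A) i j = cong₂ (λ g a → g ∧ not a) (adj-sym G i j) (adj-sym A i j)
adj-irrefl (G ─ A) i   = cong (_∧ not (adj A i i)) (adj-irrefl G i)

-- An isomorphism from H onto the subgraph of G induced by the image of f.
IsInducedEmbedding : ∀ {m n} → Graph m → Graph n → (Fin m → Fin n) → Set
IsInducedEmbedding H G f =
  Injective _≡_ _≡_ f × (∀ i j → adj G (f i) (f j) ≡ adj H i j)

HasInduced : ∀ {m n} → Graph m → Graph n → Set
HasInduced H G = ∃ (IsInducedEmbedding H G)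

pawAdj : Fin 4 → Fin 4 → Bool
pawAdj 0F 1F = true
pawAdj 1F 0F = true
pawAdj 1F 2F = true
pawAdj 2F 1F = true
pawAdj 0F 2F = true
pawAdj 2F 0F = true
pawAdj 2F 3F = true
pawAdj 3F 2F = true
pawAdj _  _  = false

paw : Graph 4
adj        paw = pawAdj
adj-sym    paw = from-yes (all? λ i → all? λ j → pawAdj i j Bool.≟ pawAdj j i)
adj-irrefl paw = from-yes (all? λ i → pawAdj i i Bool.≟ false)

PawFree : ∀ {n} → Graph n → Set
PawFree G = ¬ HasInduced paw G

------------------------------------------------------------------------
-- Paw-free Edge Deletion

record Instance : Set where
  constructor instance[_,_]
  field
    {order}   : ℕ
    graph     : Graph order
    parameter : ℕ

open Instance public

YesInstance : Instance → Set
YesInstance I =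
  Σ[ A ∈ Graph (order I) ]
    A ⊆ᴱ graph I × ∣E A ∣ ≤ parameter I × PawFree (graph I ─ A)

------------------------------------------------------------------------
-- Polynomial time
--
-- The machine model is the WHILE language of N. D. Jones ("Computability
-- and Complexity from a Programming Perspective", MIT Press, 1997), with
-- binary trees as its only data type.  Expressions are charged one unit per
-- node and commands one unit per assignment and per test.  Every unit is
-- O(1) pointer operations, since trees are immutable and can be shared.

infixr 5 _∙_

data Tree : Set where
  nil : Tree
  _∙_ : Tree → Tree → Tree

size : Tree → ℕ
size nil     = 1
size (s ∙ t) = suc (size s + size t)

data Expr (m : ℕ) : Set where
  var   : Fin m → Expr m
  nil   : Expr m
  cons  : Expr m → Expr m → Expr m
  hd tl : Expr m → Expr m

infix  7 _≔_
infixr 6 _⨾_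

data Cmd (m : ℕ) : Set where
  _≔_           : Fin m → Expr m → Cmd m
  _⨾_           : Cmd m → Cmd m → Cmd m
  if_then_else_ : Expr m → Cmd m → Cmd m → Cmd m
  while_loop_   : Expr m → Cmd m → Cmd m

Store : ℕ → Set
Store m = Vec Tree m

head tail : Tree → Tree
head nil     = nil
head (s ∙ _) = s
tail nil     = nil
tail (_ ∙ t) = t

eval : ∀ {m} → Expr m → Store m → Tree
eval (var x)    σ = lookup σ x
eval nil        σ = nil
eval (cons e f) σ = eval e σ ∙ eval f σ
eval (hd e)     σ = head (eval e σ)
eval (tl e)     σ = tail (eval e σ)

cost : ∀ {m} → Expr m → ℕ
cost (var x)    = 1
cost nil        = 1
cost (cons e f) = suc (cost e + cost f)
cost (hd e)     = suc (cost e)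
cost (tl e)     = suc (cost e)

-- c ⊢ σ ⇓ τ in-time t : started in store σ, the command c halts in store τ
-- after exactly t units of time.  In tests, nil is false and every other
-- tree is true.
infix 4 _⊢_⇓_in-time_

data _⊢_⇓_in-time_ {m : ℕ} : Cmd m → Store m → Store m → ℕ → Set where

  assign : ∀ {x e σ} →
    x ≔ e ⊢ σ ⇓ σ [ x ]≔ eval e σ in-time suc (cost e)

  seq : ∀ {c d σ τ υ t u} →
    c ⊢ σ ⇓ τ in-time t →
    d ⊢ τ ⇓ υ in-time u →
    c ⨾ d ⊢ σ ⇓ υ in-time t + u

  if-true : ∀ {e c d σ τ t l r} →
    eval e σ ≡ l ∙ r →
    c ⊢ σ ⇓ τ in-time t →
    if e then c else d ⊢ σ ⇓ τ in-time suc (cost e) + t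

  if-false : ∀ {e c d σ τ t} →
    eval e σ ≡ nil →
    d ⊢ σ ⇓ τ in-time t →
    if e then c else d ⊢ σ ⇓ τ in-time suc (cost e) + t

  while-true : ∀ {e c σ τ υ t u l r} →
    eval e σ ≡ l ∙ r →
    c ⊢ σ ⇓ τ in-time t →
    while e loop c ⊢ τ ⇓ υ in-time u →
    while e loop c ⊢ σ ⇓ υ in-time suc (cost e) + (t + u)

  while-false : ∀ {e c σ} →
    eval e σ ≡ nil →
    while e loop c ⊢ σ ⇓ σ in-time suc (cost e)

-- Variable zero holds the input at the start and the output at the end; the
-- other variables are initially nil.
record Program : Set where
  constructor program
  field
    {aux} : ℕ
    body  : Cmd (suc aux)

open Program public

_⟦_⟧↦_in-time_ : Program → Tree → Tree → ℕ → Set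
P ⟦ input ⟧↦ output in-time t =
  ∃[ τ ] (body P ⊢ input ∷ Vec.replicate (aux P) nil ⇓ τ in-time t)
         × lookup τ zero ≡ output

PolyTimeComputable : {X Y : Set} → (X → Tree) → (Y → Tree) → (X → Y) → Set
PolyTimeComputable {X} encX encY f =
  Σ[ P ∈ Program ] ∃[ c ] ∃[ d ] ((x : X) →
    ∃[ t ] P ⟦ encX x ⟧↦ encY (f x) in-time t
         × t ≤ c * size (encX x) ^ d)

encodeBool : Bool → Tree
encodeBool false = nil
encodeBool true  = nil ∙ nil

encodeList : {X : Set} → (X → Tree) → List X → Tree
encodeList enc = foldr (λ x t → enc x ∙ t) nil

-- Numbers are encoded in (bijective) binary, so that the encoding of k has
-- size Θ(log k) and running times are measured accordingly.
encodeℕᵇ : ℕᵇ → Tree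
encodeℕᵇ ℕᵇ.zero  = nil
encodeℕᵇ 2[1+ b ] = encodeBool false ∙ encodeℕᵇ b
encodeℕᵇ 1+[2 b ] = encodeBool true  ∙ encodeℕᵇ b

encodeℕ : ℕ → Tree
encodeℕ = encodeℕᵇ ∘ ℕᵇ.fromℕ

-- The n × n adjacency matrix, as a list of rows.
encodeGraph : ∀ {n} → Graph n → Tree
encodeGraph {n} G =
  encodeList (encodeList encodeBool)
             (List.tabulate {n = n} λ i → List.tabulate {n = n} λ j → adj G i j)

encodeInstance : Instance → Tree
encodeInstance I = encodeGraph (graph I) ∙ encodeℕ (parameter I)

------------------------------------------------------------------------
-- Asymptotic bounds

_∈O_ : (ℕ → ℕ) → (ℕ → ℕ) → Set
f ∈O g = ∃[ c ] ∃[ k₀ ] (∀ k → k₀ ≤ k → f k ≤ c * g k)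

{-# OPTIONS --safe #-}

-- Put θ = 2k + 3.  If more than θ paws pairwise share no edge other than ab,
-- every solution contains ab (and there is none if ab is not an edge).
-- Otherwise take a maximal packing of edge-disjoint paws, with vertex set X,
-- and for every pair on a common paw of it a maximal packing of paws through
-- that pair; together they span a set Y of O(k²) vertices, and every paw has
-- two edges inside Y.  Hence a vertex outside Y is never the centre of a paw,
-- and no paw has both an end of its triangle and its pendant vertex outside Y.
-- It follows that two nonadjacent vertices outside Y that lie in triangles and
-- have a common neighbour are twins, so that the triangle vertices outside Y
-- fall into twin classes, all but O(k²) of which can be charged to X and are
-- parts of complete multipartite blocks.  A vertex may be deleted if
--   * it lies in no triangle and each of its neighbours in a triangle has many
--     neighbours in no triangle, for these keep that neighbour out of triangles;
--   * it has many twins, since one of them is untouched by a solution;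
--   * it lies in a complete multipartite block with many parts, since a solution
--     must leave the block complete multipartite and isolated; or
--   * its component is complete multipartite.
-- When no rule applies, O(k³) non-isolated vertices remain.  Deleted vertices
-- are merely isolated until the end, so that the vertex set stays fixed.
--
-- For the running time, all tests are formulas with a counting quantifier, and
-- PT i o says that some program turns i a into o a in polynomial time on top of
-- an arbitrary stack; this relation is closed under composition, pairing,
-- branching and folds whose intermediate results stay polynomially bounded.

module Submission where

open import Defs
open import Data.Bool.Base using (Bool; true; false; T; not; _∧_; _∨_) renaming (if_then_else_ to ifᵇ_then_else_)
import Data.Bool.Properties as Bool
open import Data.Empty using (⊥; ⊥-elim)
open import Data.Fin.Base using (Fin; zero; suc; toℕ)
open import Data.Fin.Patterns using (0F; 1F; 2F; 3F; 4F; 5F; 6F; 7F; 8F; 9F)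
import Data.Fin.Properties as Fin
open import Data.List.Base as List using (List; []; _∷_; _++_; foldr; length; map; allFin; tabulate; reverse; _ʳ++_; filter; concatMap; cartesianProduct; cartesianProductWith; replicate; take)
import Data.List.Properties as List
open import Data.List.Membership.Propositional using (_∈_; _∉_)
open import Data.List.Membership.Propositional.Properties using (∈-allFin; ∈-lookup; ∈-cartesianProductWith⁺; ∈-++⁺ˡ; ∈-++⁺ʳ; ∈-++⁻; ∈-map⁺; ∈-map⁻; ∈-filter⁺; ∈-filter⁻; ∈-cartesianProduct⁺; ∈-∃++)
open import Data.List.Relation.Unary.All as All using (All; []; _∷_)
import Data.List.Relation.Unary.All.Properties as All
open import Data.List.Relation.Unary.AllPairs as AllPairs using (AllPairs; []; _∷_)
import Data.List.Relation.Unary.AllPairs.Properties as AllPairs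
open import Data.List.Relation.Unary.Any using (here; there; index)
open import Data.List.Relation.Unary.Any.Properties using (lookup-index)
open import Data.List.Relation.Unary.Unique.Propositional using (Unique)
import Data.List.Relation.Unary.Unique.Propositional.Properties as Unique
open import Data.Nat.Base using (ℕ; zero; suc; _+_; _*_; _∸_; _^_; _⊓_; _≤_; _<_; _<ᵇ_; z≤n; s≤s; pred; >-nonZero)
import Data.Nat.Binary.Base as ℕᵇ
import Data.Nat.Binary.Properties as ℕᵇ
open import Data.Nat.Properties
open import Data.Nat.Tactic.RingSolver using (solve-∀)
open import Data.Product.Base using (_×_; _,_; -,_; proj₁; proj₂; ∃; ∃-syntax; Σ; Σ-syntax; swap; uncurry)
open import Data.Sum.Base using (_⊎_; inj₁; inj₂; [_,_]′)
open import Data.Unit.Base using (⊤; tt)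
open import Data.Vec.Base as Vec using (Vec; []; _∷_; lookup)
open import Function.Base using (_∘_; id; case_of_; _$_)
open import Function.Bundles using (_⇔_; mk⇔)
open import Function.Construct.Composition using (_⇔-∘_)
open import Function.Construct.Identity using (⇔-id)
open import Relation.Binary.Definitions using (tri<; tri≈; tri>)
open import Relation.Binary.PropositionalEquality
open import Relation.Nullary using (¬_; Dec; yes; no; contradiction; does; proof; _because_; Reflects; ofʸ; ofⁿ; T-reflects; ¬-reflects; _×-reflects_; _⊎-reflects_; _→-reflects_; ¬?; _×-dec_; _⊎-dec_; _→-dec_; decidable-stable)
open import Relation.Unary using (Decidable)

-- One inequality shapes the count. Y has O(k²) vertices and a twin class has O(k), so boundedly
-- many twin classes per vertex of Y are affordable; but a block has O(k) parts of O(k) vertices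
-- each and would cost O(k⁴) if charged to Y. Blocks are therefore charged to X, which has only O(k)
-- vertices. This is why both sets are kept, and why the last step produces a paw whose centre is a
-- neighbour of the charged vertex. The form 2k + 3 of θ is dictated by the block rule: a solution
-- touches at most 2k vertices, so four of 2k + 4 pairwise adjacent representatives are untouched,
-- and three given neighbours of v miss at most one of them each. The other rules get by with less,
-- but with a common threshold a single counting quantifier expresses all of them. A solution of the
-- graph after a deletion cannot always be reused as it stands: for the two rules about blocks, some
-- of the edges that it deletes at the block are given back first.

-- Polynomial bounds in the size of an encoding

record Bounded {A : Set} (i : A → Tree) (f : A → ℕ) : Set where
  constructor bounded
  field
    factor degree : ℕ
    bound         : ∀ a → f a ≤ factor * size (i a) ^ degree

open Bounded

1≤size : ∀ t → 1 ≤ size t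
1≤size nil     = ≤-refl
1≤size (_ ∙ _) = s≤s z≤n

1≤^ : ∀ {s} d → 1 ≤ s → 1 ≤ s ^ d
1≤^ {s} d 1≤s = subst (_≤ s ^ d) (^-zeroˡ d) (^-monoˡ-≤ d 1≤s)

module _ {A : Set} {i : A → Tree} where

  bounded-≤ : ∀ {f g} → (∀ a → f a ≤ g a) → Bounded i g → Bounded i f
  bounded-≤ f≤g (bounded c d g≤) = bounded c d λ a → ≤-trans (f≤g a) (g≤ a)

  bounded-const : ∀ n → Bounded i (λ _ → n)
  bounded-const n = bounded n 0 λ _ → ≤-reflexive (sym (*-identityʳ n))

  bounded-size : Bounded i (size ∘ i)
  bounded-size = bounded 1 1 λ a →
    ≤-reflexive (sym (trans (*-identityˡ _) (^-identityʳ _)))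

  -- Adding the exponents dominates both powers, because every tree has size at least 1.
  bounded-+ : ∀ {f g} → Bounded i f → Bounded i g → Bounded i (λ a → f a + g a)
  bounded-+ {f} {g} (bounded c d f≤) (bounded c′ d′ g≤) = bounded (c + c′) (d + d′) λ a →
    let s  = size (i a)
        1≤ = λ e → 1≤^ e (1≤size (i a))
        open ≤-Reasoning
    in begin
      f a + g a                             ≤⟨ +-mono-≤ (f≤ a) (g≤ a) ⟩
      c * s ^ d + c′ * s ^ d′               ≤⟨ +-mono-≤
        (*-monoʳ-≤ c (m≤m*n′ (s ^ d) (1≤ d′))) (*-monoʳ-≤ c′ (m≤n*m′ (s ^ d′) (1≤ d))) ⟩
      c * (s ^ d * s ^ d′) + c′ * (s ^ d * s ^ d′) ≡⟨ *-distribʳ-+ (s ^ d * s ^ d′) c c′ ⟨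
      (c + c′) * (s ^ d * s ^ d′)           ≡⟨ cong ((c + c′) *_) (^-distribˡ-+-* s d d′) ⟨
      (c + c′) * s ^ (d + d′)               ∎
    where
    m≤m*n′ : ∀ m {n} → 1 ≤ n → m ≤ m * n
    m≤m*n′ m 1≤n = subst (_≤ m * _) (*-identityʳ m) (*-monoʳ-≤ m 1≤n)
    m≤n*m′ : ∀ m {n} → 1 ≤ n → m ≤ n * m
    m≤n*m′ m {n} 1≤n = subst (m ≤_) (*-comm m n) (m≤m*n′ m 1≤n)

  bounded-* : ∀ {f g} → Bounded i f → Bounded i g → Bounded i (λ a → f a * g a)
  bounded-* {f} {g} (bounded c d f≤) (bounded c′ d′ g≤) = bounded (c * c′) (d + d′) λ a →
    let s = size (i a)
        open ≤-Reasoning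
    in begin
      f a * g a                     ≤⟨ *-mono-≤ (f≤ a) (g≤ a) ⟩
      (c * s ^ d) * (c′ * s ^ d′)   ≡⟨ [m*n]*[o*p]≡[m*o]*[n*p] c (s ^ d) c′ (s ^ d′) ⟩
      c * c′ * (s ^ d * s ^ d′)     ≡⟨ cong (c * c′ *_) (^-distribˡ-+-* s d d′) ⟨
      c * c′ * s ^ (d + d′)         ∎

  bounded-^ : ∀ {f} d → Bounded i f → Bounded i (λ a → f a ^ d)
  bounded-^ zero    b = bounded-const 1
  bounded-^ (suc d) b = bounded-* b (bounded-^ d b)

  bounded-∘ : ∀ {m f} → Bounded i (size ∘ m) → Bounded m f → Bounded i f
  bounded-∘ {m} b (bounded c d f≤) =
    bounded-≤ f≤ (bounded-* (bounded-const c) (bounded-^ d b))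

  bounded-reindex : ∀ {B : Set} {f} (g : B → A) → Bounded i f → Bounded (i ∘ g) (f ∘ g)
  bounded-reindex g (bounded c d b) = bounded c d (b ∘ g)

  -- Each branch is bounded only on the inputs that take it. Both bounds are polynomials in the
  -- size, so their sum makes sense on every input.
  bounded-split : ∀ {f} (p : A → Bool) →
    Bounded {Σ A (T ∘ p)} (i ∘ proj₁) (f ∘ proj₁) →
    Bounded {Σ A (T ∘ not ∘ p)} (i ∘ proj₁) (f ∘ proj₁) → Bounded i f
  bounded-split {f} p (bounded c d b) (bounded c′ d′ b′) = bounded-≤ f≤
    (bounded-+ (bounded-* (bounded-const c) (bounded-^ d bounded-size))
               (bounded-* (bounded-const c′) (bounded-^ d′ bounded-size)))
    where
    cases : ∀ a x → p a ≡ x → f a ≤ c * size (i a) ^ d + c′ * size (i a) ^ d′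
    cases a true  eq = ≤-trans (b  (a , subst T (sym eq) _)) (m≤m+n _ _)
    cases a false eq = ≤-trans (b′ (a , subst (T ∘ not) (sym eq) _)) (m≤n+m _ _)
    f≤ : ∀ a → f a ≤ c * size (i a) ^ d + c′ * size (i a) ^ d′
    f≤ a = cases a (p a) refl

-- Polynomial-time programs and their combinators

-- Programs use their single variable as a stack of trees.

infix 4 _⊢_⇒_within_

_⊢_⇒_within_ : Cmd 1 → Tree → Tree → ℕ → Set
c ⊢ s ⇒ t within K = ∃[ u ] (c ⊢ s ∷ [] ⇓ t ∷ [] in-time u) × u ≤ K

assign-run : ∀ e {s} → 0F ≔ e ⊢ s ⇒ eval e (s ∷ []) within suc (cost e)
assign-run e = _ , assign , ≤-refl

seq-run : ∀ {c d s t u K L} → c ⊢ s ⇒ t within K → d ⊢ t ⇒ u within L →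
          c ⨾ d ⊢ s ⇒ u within K + L
seq-run (_ , x , x≤) (_ , y , y≤) = _ , seq x y , +-mono-≤ x≤ y≤

-- `size-bounded` serves composition: the time of the next program is polynomial in the size of its
-- own input, which is the output of this one.
record PT {A : Set} (i o : A → Tree) : Set where
  field
    code         : Cmd 1
    time         : A → ℕ
    time-bounded : Bounded i time
    size-bounded : Bounded i (size ∘ o)
    run          : ∀ a r → code ⊢ i a ∙ r ⇒ o a ∙ r within time a

open PT

private
  top : Expr 1
  top = hd (var 0F)

  rest : Expr 1
  rest = tl (var 0F)

module _ {A : Set} {i : A → Tree} where

  opaque
    idᴾ : PT i i
    idᴾ = record
      { code         = 0F ≔ var 0F
      ; time-bounded = bounded-const 2
      ; size-bounded = bounded-size
      ; run          = λ _ _ → assign-run (var 0F)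
      }

    castᴾ : ∀ {o o′} → (∀ a → o a ≡ o′ a) → PT i o → PT i o′
    castᴾ eq p = record
      { code         = code p
      ; time-bounded = time-bounded p
      ; size-bounded = bounded-≤ (λ a → ≤-reflexive (cong size (sym (eq a)))) (size-bounded p)
      ; run          = λ a r → subst (λ t → code p ⊢ i a ∙ r ⇒ t ∙ r within time p a) (eq a) (run p a r)
      }

    reindexᴾ : ∀ {B : Set} {o} (g : B → A) → PT i o → PT (i ∘ g) (o ∘ g)
    reindexᴾ g p = record
      { code         = code p
      ; time-bounded = bounded-reindex g (time-bounded p)
      ; size-bounded = bounded-reindex g (size-bounded p)
      ; run          = run p ∘ g
      }

    infixl 5 _≫_

    _≫_ : ∀ {m o} → PT i m → PT m o → PT i o
    p ≫ q = record
      { code         = code p ⨾ code q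
      ; time-bounded = bounded-+ (time-bounded p) (bounded-∘ (size-bounded p) (time-bounded q))
      ; size-bounded = bounded-∘ (size-bounded p) (size-bounded q)
      ; run          = λ a r → seq-run (run p a r) (run q a r)
      }

    headᴾ : ∀ {o} → PT i o → PT i (head ∘ o)
    headᴾ {o} p = p ≫ record
      { code         = 0F ≔ cons (hd top) rest
      ; time-bounded = bounded-const _
      ; size-bounded = bounded-≤ (λ a → size-head (o a)) bounded-size
      ; run          = λ _ _ → assign-run _
      }
      where
      size-head : ∀ t → size (head t) ≤ size t
      size-head nil     = ≤-refl
      size-head (s ∙ t) = m≤n⇒m≤1+n (m≤m+n _ _)

    tailᴾ : ∀ {o} → PT i o → PT i (tail ∘ o)
    tailᴾ {o} p = p ≫ record
      { code         = 0F ≔ cons (tl top) rest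
      ; time-bounded = bounded-const _
      ; size-bounded = bounded-≤ (λ a → size-tail (o a)) bounded-size
      ; run          = λ _ _ → assign-run _
      }
      where
      size-tail : ∀ t → size (tail t) ≤ size t
      size-tail nil     = ≤-refl
      size-tail (s ∙ t) = m≤n⇒m≤1+n (m≤n+m _ _)

    infixr 4 _,ᴾ_

    _,ᴾ_ : ∀ {o o′} → PT i o → PT i o′ → PT i (λ a → o a ∙ o′ a)
    p ,ᴾ q = record
      { code         = 0F ≔ cons top (var 0F)
                     ⨾ code p
                     ⨾ 0F ≔ cons (hd rest) (cons top (tl rest))
                     ⨾ code q
                     ⨾ 0F ≔ cons (cons (hd rest) top) (tl rest)
      ; time-bounded = bounded-+ (bounded-const 5) (bounded-+ (time-bounded p)
                         (bounded-+ (bounded-const 11) (bounded-+ (time-bounded q) (bounded-const 11))))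
      ; size-bounded = bounded-+ (bounded-const 1) (bounded-+ (size-bounded p) (size-bounded q))
      ; run          = λ a r →
          seq-run (assign-run _) (seq-run (run p a _)
            (seq-run (assign-run _) (seq-run (run q a _) (assign-run _))))
      }

    nilᴾ : PT i (λ _ → nil)
    nilᴾ = record
      { code         = 0F ≔ cons nil rest
      ; time-bounded = bounded-const _
      ; size-bounded = bounded-const _
      ; run          = λ _ _ → assign-run _
      }

    constᴾ : ∀ t → PT i (λ _ → t)
    constᴾ nil     = nilᴾ
    constᴾ (s ∙ t) = constᴾ s ,ᴾ constᴾ t

    -- Each branch may rely on the outcome of the test, being a program for the subtype of inputs
    -- that reach it. The running times of the branches are functions on these subtypes, so the
    -- total is formed from their polynomial bounds instead.
    splitᴾ : ∀ {o} {p : A → Bool} → PT i (encodeBool ∘ p) →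
      PT {Σ A (T ∘ p)} (i ∘ proj₁) (o ∘ proj₁) →
      PT {Σ A (T ∘ not ∘ p)} (i ∘ proj₁) (o ∘ proj₁) → PT i o
    splitᴾ {o} {p} b q q′ = record
      { code         = 0F ≔ cons top (var 0F)
                     ⨾ code b
                     ⨾ if top then 0F ≔ rest ⨾ code q else (0F ≔ rest ⨾ code q′)
      ; time-bounded = bounded-+ (bounded-const 5) (bounded-+ (time-bounded b)
                         (bounded-+ (bounded-const 6) (bounded-+
                           (bounded-* (bounded-const c) (bounded-^ d bounded-size))
                           (bounded-* (bounded-const c′) (bounded-^ d′ bounded-size)))))
      ; size-bounded = bounded-split p (size-bounded q) (size-bounded q′)
      ; run          = λ a r →
          seq-run (assign-run _) (seq-run (run b a _) (choose a r (p a) refl))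
      }
      where
      c d c′ d′ : ℕ
      c  = factor (time-bounded q)
      d  = degree (time-bounded q)
      c′ = factor (time-bounded q′)
      d′ = degree (time-bounded q′)
      choose : ∀ a r x → p a ≡ x →
        if top then 0F ≔ rest ⨾ code q else (0F ≔ rest ⨾ code q′)
          ⊢ encodeBool (p a) ∙ (i a ∙ r) ⇒ o a ∙ r
          within 6 + (c * size (i a) ^ d + c′ * size (i a) ^ d′)
      choose a r true eq =
        let a′ = a , subst T (sym eq) _
            u , x , u≤ = seq-run (assign-run rest) (run q a′ r)
        in _ , if-true (cong encodeBool eq) x ,
           +-monoʳ-≤ 3 (≤-trans u≤ (+-monoʳ-≤ 3 (≤-trans (bound (time-bounded q) a′) (m≤m+n _ _))))
      choose a r false eq =
        let a′ = a , subst (T ∘ not) (sym eq) _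
            u , x , u≤ = seq-run (assign-run rest) (run q′ a′ r)
        in _ , if-false (cong encodeBool eq) x ,
           +-monoʳ-≤ 3 (≤-trans u≤ (+-monoʳ-≤ 3 (≤-trans (bound (time-bounded q′) a′) (m≤n+m _ _))))

module _ {A : Set} {i : A → Tree} where

  opaque
    ifᴾ : ∀ {B : A → Set} (enc : ∀ a → B a → Tree) {p : A → Bool} (f g : ∀ a → B a) →
      PT i (encodeBool ∘ p) → PT i (λ a → enc a (f a)) → PT i (λ a → enc a (g a)) →
      PT i (λ a → enc a (ifᵇ p a then f a else g a))
    ifᴾ enc {p} f g b q q′ =
      splitᴾ b (castᴾ (λ (a , t) → yes-case a (p a) t) (reindexᴾ proj₁ q))
               (castᴾ (λ (a , t) → no-case a (p a) t) (reindexᴾ proj₁ q′))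
      where
      yes-case : ∀ a x → T x → enc a (f a) ≡ enc a (ifᵇ x then f a else g a)
      yes-case a true _ = refl
      no-case : ∀ a x → T (not x) → enc a (g a) ≡ enc a (ifᵇ x then f a else g a)
      no-case a false _ = refl

module _ {A : Set} {i : A → Tree} {E B : A → Set}
         (encE : ∀ a → E a → Tree) (encB : ∀ a → B a → Tree)
         (l : ∀ a → List (E a)) (z : ∀ a → B a) (f : ∀ a → E a → B a → B a) where

  private
    reversing looping : Expr 1
    reversing = cons (tl top) (cons (cons (hd top) (hd rest)) (tl rest))
    looping = cons (cons (hd (hd rest)) (cons top (hd (tl rest)))) (cons (tl (hd rest)) (tl rest))

  opaque
    -- A right fold consumes its list from the end, so the program reverses the list first. The
    -- `Bounded` hypothesis ranges over all lists and thus covers every suffix that yields an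
    -- intermediate result.
    foldrᴾ :
      PT i (λ a → encodeList (encE a) (l a)) →
      PT i (λ a → encB a (z a)) →
      PT {Σ A λ a → E a × B a} (λ (a , e , b) → encE a e ∙ encB a b ∙ i a)
                               (λ (a , e , b) → encB a (f a e b)) →
      Bounded {Σ A (List ∘ E)} (λ (a , es) → encodeList (encE a) es ∙ i a)
                               (λ (a , es) → size (encB a (foldr (f a) (z a) es))) →
      PT i (λ a → encB a (foldr (f a) (z a) (l a)))
    foldrᴾ pl pz pf (bounded cb db b≤) = record
      { code         = 0F ≔ cons top (var 0F) ⨾ code pl
                     ⨾ 0F ≔ cons top (cons nil rest)
                     ⨾ (while top loop (0F ≔ reversing))
                     ⨾ 0F ≔ cons (hd (tl rest)) rest ⨾ code pz
                     ⨾ (while hd rest loop (0F ≔ looping ⨾ code pf))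
                     ⨾ 0F ≔ cons top (tl (tl rest))
      ; time-bounded =
          bounded-+ (bounded-const 5) (bounded-+ (time-bounded pl) (bounded-+ (bounded-const 8)
            (bounded-+ (bounded-+ (bounded-* sL (bounded-const 19)) (bounded-const 3)) (bounded-+ (bounded-const 8) (bounded-+ (time-bounded pz)
              (bounded-+ (bounded-+ (bounded-* sL bK) (bounded-const 4)) (bounded-const 8)))))))
      ; size-bounded = bounded-∘ {m = λ a → encodeList (encE a) (l a) ∙ i a} bsize
                         (bounded cb db λ a → b≤ (a , l a))
      ; run          = λ a r →
          seq-run (assign-run _) (seq-run (run pl a _) (seq-run (assign-run _)
            (seq-run (reversal a _ (l a) []) (seq-run (assign-run _) (seq-run (run pz a _)
              (seq-run (whole-list a r) (finish a r)))))))
      }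
      where
      L : A → ℕ
      L a = size (encodeList (encE a) (l a))
      sL : Bounded i L
      sL = size-bounded pl
      bsize : Bounded i (λ a → size (encodeList (encE a) (l a) ∙ i a))
      bsize = bounded-+ (bounded-const 1) (bounded-+ sL bounded-size)
      ct dt : ℕ
      ct = factor (time-bounded pf)
      dt = degree (time-bounded pf)
      P W K : A → ℕ
      P a = cb * size (encodeList (encE a) (l a) ∙ i a) ^ db
      W a = suc (L a + suc (P a + size (i a)))
      -- A round costs 4 for the test, 22 for the assignment `looping` and the time of the body,
      -- whose input has size at most `W a`.
      K a = 26 + ct * W a ^ dt
      bK : Bounded i K
      bK = bounded-+ (bounded-const 26) (bounded-* (bounded-const ct) (bounded-^ dt
             (bounded-+ (bounded-const 1) (bounded-+ sL (bounded-+ (bounded-const 1)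
               (bounded-+ (bounded-* (bounded-const cb) (bounded-^ db bsize)) bounded-size))))))

      size-ʳ++ : ∀ a es rs → suc (size (encodeList (encE a) (es ʳ++ rs)))
                           ≡ size (encodeList (encE a) es) + size (encodeList (encE a) rs)
      size-ʳ++ a []       rs = refl
      size-ʳ++ a (e ∷ es) rs = trans (size-ʳ++ a es (e ∷ rs)) (rearrange (size (encE a e)) _ _)
        where
        rearrange : ∀ m n o → n + suc (m + o) ≡ suc (m + n) + o
        rearrange = solve-∀

      reversal : ∀ a r es rs →
        while top loop (0F ≔ reversing)
          ⊢ encodeList (encE a) es ∙ encodeList (encE a) rs ∙ r
          ⇒ nil ∙ encodeList (encE a) (es ʳ++ rs) ∙ r within size (encodeList (encE a) es) * 19 + 3
      reversal a r []       rs = _ , while-false refl , ≤-refl′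
        where
        ≤-refl′ : 3 ≤ 22
        ≤-refl′ = m≤m+n 3 19
      reversal a r (e ∷ es) rs =
        let _ , x , x≤ = reversal a r es (e ∷ rs)
        in _ , while-true refl assign x ,
           ≤-trans (+-monoʳ-≤ 19 x≤)
             (+-monoʳ-≤ 19 (+-monoˡ-≤ 3 (*-monoˡ-≤ 19 (m≤n+m _ (size (encE a e))))))

      body-time : ∀ a e b → size (encE a e) ≤ L a → size (encB a b) ≤ P a →
                  time pf (a , e , b) ≤ ct * W a ^ dt
      body-time a e b e≤ b≤ = ≤-trans (bound (time-bounded pf) (a , e , b))
        (*-monoʳ-≤ ct (^-monoˡ-≤ dt (s≤s (+-mono-≤ e≤ (s≤s (+-monoˡ-≤ (size (i a)) b≤))))))

      -- `ps` holds the entries still to come, reversed, and `ys` those already folded. Each of the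
      -- two encodings ends in a `nil` of size 1, so together they exceed the encoding of the whole
      -- list by one.
      iteration : ∀ a r ps ys →
        size (encodeList (encE a) ps) + size (encodeList (encE a) ys) ≤ suc (L a) →
        while hd rest loop (0F ≔ looping ⨾ code pf)
          ⊢ encB a (foldr (f a) (z a) ys) ∙ encodeList (encE a) ps ∙ i a ∙ r
          ⇒ encB a (foldr (f a) (z a) (ps ʳ++ ys)) ∙ nil ∙ i a ∙ r
          within size (encodeList (encE a) ps) * K a + 4
      iteration a r []       ys _ = _ , while-false refl , m≤n+m 4 (1 * K a)
      iteration a r (p ∷ ps) ys inv =
        let _ , x , x≤ = iteration a r ps (p ∷ ys) (≤-trans (≤-reflexive move) inv)
        in _ , while-true refl (seq assign (proj₁ (proj₂ now))) x , (begin
             _ ≤⟨ +-monoʳ-≤ 4 (+-mono-≤ (+-monoʳ-≤ 22 (≤-trans (proj₂ (proj₂ now)) (body-time a p _ p≤ acc≤))) x≤) ⟩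
             4 + ((22 + ct * W a ^ dt) + (size (encodeList (encE a) ps) * K a + 4)) ≡⟨ +-assoc 4 (22 + ct * W a ^ dt) _ ⟨
             K a + (size (encodeList (encE a) ps) * K a + 4) ≡⟨ +-assoc (K a) _ 4 ⟨
             suc (size (encodeList (encE a) ps)) * K a + 4 ≤⟨ +-monoˡ-≤ 4 (*-monoˡ-≤ (K a) (s≤s (m≤n+m _ (size (encE a p))))) ⟩
             suc (size (encE a p) + size (encodeList (encE a) ps)) * K a + 4 ∎)
        where
        open ≤-Reasoning
        move : size (encodeList (encE a) ps) + suc (size (encE a p) + size (encodeList (encE a) ys))
             ≡ suc (size (encE a p) + size (encodeList (encE a) ps)) + size (encodeList (encE a) ys)
        move = rearrange _ (size (encE a p)) _
          where
          rearrange : ∀ m n o → m + suc (n + o) ≡ suc (n + m) + o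
          rearrange = solve-∀
        p≤ : size (encE a p) ≤ L a
        p≤ = ≤-pred (≤-trans (s≤s (m≤m+n _ _)) (≤-trans (m≤m+n _ _) inv))
        ys≤ : size (encodeList (encE a) ys) ≤ L a
        ys≤ = ≤-pred (≤-trans (+-monoˡ-≤ _ (s≤s z≤n)) inv)
        acc≤ : size (encB a (foldr (f a) (z a) ys)) ≤ P a
        acc≤ = ≤-trans (b≤ (a , ys)) (*-monoʳ-≤ cb (^-monoˡ-≤ db (s≤s (+-monoˡ-≤ (size (i a)) ys≤))))
        now : code pf ⊢ (encE a p ∙ encB a (foldr (f a) (z a) ys) ∙ i a) ∙ encodeList (encE a) ps ∙ i a ∙ r
            ⇒ encB a (foldr (f a) (z a) (p ∷ ys)) ∙ encodeList (encE a) ps ∙ i a ∙ r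
            within time pf (a , p , foldr (f a) (z a) ys)
        now = run pf (a , p , foldr (f a) (z a) ys) (encodeList (encE a) ps ∙ i a ∙ r)

      size-reverse : ∀ a → size (encodeList (encE a) (reverse (l a))) ≡ L a
      size-reverse a = suc-injective (trans (size-ʳ++ a (l a) []) (+-comm _ 1))

      start : ∀ a → size (encodeList (encE a) (reverse (l a))) + 1 ≤ suc (L a)
      start a = ≤-reflexive (trans (cong (_+ 1) (size-reverse a)) (+-comm _ 1))

      whole-list : ∀ a r →
        while hd rest loop (0F ≔ looping ⨾ code pf)
          ⊢ encB a (z a) ∙ encodeList (encE a) (reverse (l a)) ∙ i a ∙ r
          ⇒ encB a (foldr (f a) (z a) (reverse (l a) ʳ++ [])) ∙ nil ∙ i a ∙ r within L a * K a + 4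
      whole-list a r = subst
        (λ m → while hd rest loop (0F ≔ looping ⨾ code pf)
          ⊢ encB a (z a) ∙ encodeList (encE a) (reverse (l a)) ∙ i a ∙ r
          ⇒ encB a (foldr (f a) (z a) (reverse (l a) ʳ++ [])) ∙ nil ∙ i a ∙ r within m * K a + 4)
        (size-reverse a) (iteration a r (reverse (l a)) [] (start a))

      finish : ∀ a r →
        0F ≔ cons top (tl (tl rest))
          ⊢ encB a (foldr (f a) (z a) (reverse (l a) ʳ++ [])) ∙ nil ∙ i a ∙ r
          ⇒ encB a (foldr (f a) (z a) (l a)) ∙ r within 8
      finish a r = subst
        (λ es → 0F ≔ cons top (tl (tl rest)) ⊢ encB a (foldr (f a) (z a) (reverse (l a) ʳ++ [])) ∙ nil ∙ i a ∙ r
                   ⇒ encB a (foldr (f a) (z a) es) ∙ r within 8)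
        (List.reverse-involutive (l a)) (assign-run _)

module _ {A : Set} {i : A → Tree} {E B : A → Set}
         (encE : ∀ a → E a → Tree) (encB : ∀ a → B a → Tree)
         (l : ∀ a → List (E a)) (z : ∀ a → B a) (f : ∀ a → E a → B a → B a) where

  -- If a step adds an amount that does not depend on the accumulator, sizes grow linearly in the
  -- number of steps, and all intermediate results stay polynomial. A step that doubled the
  -- accumulator would be excluded.
  foldr⁺ᴾ :
    PT i (λ a → encodeList (encE a) (l a)) →
    PT i (λ a → encB a (z a)) →
    PT {Σ A λ a → E a × B a} (λ (a , e , b) → encE a e ∙ encB a b ∙ i a)
                             (λ (a , e , b) → encB a (f a e b)) →
    (g : Σ A E → ℕ) → Bounded (λ (a , e) → encE a e ∙ i a) g →
    (∀ a e b → size (encB a (f a e b)) ≤ g (a , e) + size (encB a b)) →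
    PT i (λ a → encB a (foldr (f a) (z a) (l a)))
  foldr⁺ᴾ pl pz pf g (bounded cg dg g≤) grow = foldrᴾ encE encB l z f pl pz pf
    (bounded-≤ {i = input} (λ (a , es) → total a es _ ≤-refl)
      (bounded-+ (bounded-* list-bounded (bounded-* (bounded-const cg) (bounded-^ dg bounded-size)))
                 start-bounded))
    where
    input : Σ A (List ∘ E) → Tree
    input (a , es) = encodeList (encE a) es ∙ i a
    list-bounded : Bounded input (λ (a , es) → size (encodeList (encE a) es))
    list-bounded = bounded-≤ (λ (a , es) → m≤n⇒m≤1+n (m≤m+n _ (size (i a)))) bounded-size
    context-bounded : Bounded input (λ (a , es) → size (i a))
    context-bounded = bounded-≤ (λ (a , es) → m≤n⇒m≤1+n (m≤n+m _ (size (encodeList (encE a) es)))) bounded-size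
    start-bounded : Bounded input (λ (a , es) → size (encB a (z a)))
    start-bounded = bounded-∘ {m = i ∘ proj₁} context-bounded (bounded-reindex proj₁ (size-bounded pz))
    total : ∀ a es M → size (encodeList (encE a) es ∙ i a) ≤ M →
      size (encB a (foldr (f a) (z a) es)) ≤
      size (encodeList (encE a) es) * (cg * M ^ dg) + size (encB a (z a))
    total a []       M _   = m≤n+m _ _
    total a (e ∷ es) M ≤M = begin
      size (encB a (f a e (foldr (f a) (z a) es)))
        ≤⟨ grow a e _ ⟩
      g (a , e) + size (encB a (foldr (f a) (z a) es))
        ≤⟨ +-mono-≤ (≤-trans (g≤ (a , e)) (*-monoʳ-≤ cg (^-monoˡ-≤ dg (≤-trans e≤ ≤M))))
                    (total a es M (≤-trans es≤ ≤M)) ⟩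
      cg * M ^ dg + (size (encodeList (encE a) es) * (cg * M ^ dg) + size (encB a (z a)))
        ≡⟨ +-assoc (cg * M ^ dg) _ _ ⟨
      suc (size (encodeList (encE a) es)) * (cg * M ^ dg) + size (encB a (z a))
        ≤⟨ +-monoˡ-≤ _ (*-monoˡ-≤ (cg * M ^ dg) (s≤s (m≤n+m _ (size (encE a e))))) ⟩
      size (encodeList (encE a) (e ∷ es)) * (cg * M ^ dg) + size (encB a (z a)) ∎
      where
      open ≤-Reasoning
      e≤ : size (encE a e ∙ i a) ≤ size (encodeList (encE a) (e ∷ es) ∙ i a)
      e≤ = s≤s (+-monoˡ-≤ (size (i a)) (m≤n⇒m≤1+n (m≤m+n (size (encE a e)) _)))
      es≤ : size (encodeList (encE a) es ∙ i a) ≤ size (encodeList (encE a) (e ∷ es) ∙ i a)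
      es≤ = s≤s (+-monoˡ-≤ _ (m≤n⇒m≤1+n (m≤n+m _ (size (encE a e)))))

-- In the body of a fold the accumulator lies between the element and the context.
module _ {A : Set} {i : A → Tree} {E B : A → Set}
         {encE : ∀ a → E a → Tree} {encB : ∀ a → B a → Tree} where

  elementᴾ : PT {Σ A λ a → E a × B a} (λ (a , e , b) → encE a e ∙ encB a b ∙ i a)
                                      (λ (a , e , b) → encE a e)
  elementᴾ = headᴾ idᴾ

  accumulatorᴾ : PT {Σ A λ a → E a × B a} (λ (a , e , b) → encE a e ∙ encB a b ∙ i a)
                                          (λ (a , e , b) → encB a b)
  accumulatorᴾ = headᴾ (tailᴾ idᴾ)

  contextᴾ : PT {Σ A λ a → E a × B a} (λ (a , e , b) → encE a e ∙ encB a b ∙ i a)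
                                      (λ (a , e , b) → i a)
  contextᴾ = tailᴾ (tailᴾ idᴾ)

  locallyᴾ : ∀ {o : Σ A E → Tree} → PT {Σ A E} (λ (a , e) → encE a e ∙ i a) o →
             PT {Σ A λ a → E a × B a} (λ (a , e , b) → encE a e ∙ encB a b ∙ i a)
                                      (λ (a , e , b) → o (a , e))
  locallyᴾ p = (elementᴾ ,ᴾ contextᴾ) ≫ reindexᴾ (λ (a , e , b) → a , e) p

-- Boolean tests and list operations

isNode : Tree → Bool
isNode nil     = false
isNode (_ ∙ _) = true

module _ {A : Set} {i : A → Tree} where

  isNodeᴾ : ∀ {o} → PT i o → PT i (encodeBool ∘ isNode ∘ o)
  isNodeᴾ {o} p = p ≫ record
    { code         = if hd (var 0F) then 0F ≔ cons (cons nil nil) (tl (var 0F))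
                     else (0F ≔ cons nil (tl (var 0F)))
    ; time-bounded = bounded-const 10
    ; size-bounded = bounded-≤ (λ a → size-isNode (o a)) (bounded-const 3)
    ; run          = λ a r → test (o a) r
    }
    where
    size-isNode : ∀ t → size (encodeBool (isNode t)) ≤ 3
    size-isNode nil     = s≤s z≤n
    size-isNode (_ ∙ _) = ≤-refl
    test : ∀ t r → if hd (var 0F) then 0F ≔ cons (cons nil nil) (tl (var 0F))
                   else (0F ≔ cons nil (tl (var 0F)))
                   ⊢ t ∙ r ⇒ encodeBool (isNode t) ∙ r within 10
    test nil     r = _ , if-false refl assign , ≤-trans (n≤1+n _) (n≤1+n _)
    test (_ ∙ _) r = _ , if-true refl assign , ≤-refl

  module _ {p : A → Bool} where

    notᴾ : PT i (encodeBool ∘ p) → PT i (encodeBool ∘ not ∘ p)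
    notᴾ b = castᴾ (λ a → case′ (p a)) (ifᴾ (λ _ → encodeBool) (λ _ → false) (λ _ → true) b (constᴾ _) (constᴾ _))
      where
      case′ : ∀ x → encodeBool (ifᵇ x then false else true) ≡ encodeBool (not x)
      case′ true  = refl
      case′ false = refl

  module _ {p q : A → Bool} where

    andᴾ : PT i (encodeBool ∘ p) → PT i (encodeBool ∘ q) → PT i (λ a → encodeBool (p a ∧ q a))
    andᴾ b c = castᴾ (λ a → case′ (p a) (q a)) (ifᴾ (λ _ → encodeBool) q (λ _ → false) b c nilᴾ)
      where
      case′ : ∀ x y → encodeBool (ifᵇ x then y else false) ≡ encodeBool (x ∧ y)
      case′ true  y = refl
      case′ false y = refl

    orᴾ : PT i (encodeBool ∘ p) → PT i (encodeBool ∘ q) → PT i (λ a → encodeBool (p a ∨ q a))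
    orᴾ b c = castᴾ (λ a → case′ (p a) (q a)) (ifᴾ (λ _ → encodeBool) (λ _ → true) q b (constᴾ _) c)
      where
      case′ : ∀ x y → encodeBool (ifᵇ x then true else y) ≡ encodeBool (x ∨ y)
      case′ true  y = refl
      case′ false y = refl

size-encodeBool : ∀ b → size (encodeBool b) ≤ 3
size-encodeBool true  = ≤-refl
size-encodeBool false = s≤s z≤n

size-++ : ∀ {X : Set} (enc : X → Tree) xs ys →
          suc (size (encodeList enc (xs ++ ys))) ≡ size (encodeList enc xs) + size (encodeList enc ys)
size-++ enc []       ys = refl
size-++ enc (x ∷ xs) ys =
  cong suc (trans (sym (+-suc _ _)) (trans (cong (size (enc x) +_) (size-++ enc xs ys)) (sym (+-assoc (size (enc x)) _ _))))

size-encodeList-≤ : ∀ {X : Set} (enc : X → Tree) M xs → (∀ x → size (enc x) ≤ M) →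
                    size (encodeList enc xs) ≤ suc (length xs * suc M)
size-encodeList-≤ enc M []       le = ≤-refl
size-encodeList-≤ enc M (x ∷ xs) le =
  s≤s (≤-trans (+-mono-≤ (le x) (size-encodeList-≤ enc M xs le)) (≤-reflexive (+-suc M _)))

length≤size : ∀ {X : Set} (enc : X → Tree) xs → length xs ≤ size (encodeList enc xs)
length≤size enc []       = z≤n
length≤size enc (x ∷ xs) = s≤s (≤-trans (length≤size enc xs) (m≤n+m _ _))

module _ {A : Set} {i : A → Tree} {E : A → Set} (encE : ∀ a → E a → Tree) (l : ∀ a → List (E a)) where

  mapᴾ : {F : A → Set} (encF : ∀ a → F a → Tree) (f : ∀ a → E a → F a) →
         PT i (λ a → encodeList (encE a) (l a)) →
         PT {Σ A E} (λ (a , e) → encE a e ∙ i a) (λ (a , e) → encF a (f a e)) →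
         PT i (λ a → encodeList (encF a) (map (f a) (l a)))
  mapᴾ encF f pl pf = castᴾ (λ a → cong (encodeList (encF a)) (sym (map-is-foldr (l a))))
    (foldr⁺ᴾ encE (λ a → encodeList (encF a)) l (λ _ → []) (λ a e fs → f a e ∷ fs) pl nilᴾ
      (locallyᴾ {encE = encE} {λ a → encodeList (encF a)} pf ,ᴾ accumulatorᴾ {encE = encE} {λ a → encodeList (encF a)})
      (λ (a , e) → suc (size (encF a (f a e)))) (bounded-+ (bounded-const 1) (size-bounded pf))
      (λ a e b → ≤-refl))
    where
    map-is-foldr : ∀ {a} es → map (f a) es ≡ foldr (λ e → f a e ∷_) [] es
    map-is-foldr []       = refl
    map-is-foldr (e ∷ es) = cong (_ ∷_) (map-is-foldr es)

  ++ᴾ : (l′ : ∀ a → List (E a)) → PT i (λ a → encodeList (encE a) (l a)) →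
        PT i (λ a → encodeList (encE a) (l′ a)) → PT i (λ a → encodeList (encE a) (l a ++ l′ a))
  ++ᴾ l′ pl pl′ = castᴾ (λ a → cong (encodeList (encE a)) (sym (++-is-foldr (l a))))
    (foldr⁺ᴾ encE (λ a → encodeList (encE a)) l l′ (λ a → _∷_) pl pl′
      (elementᴾ {encE = encE} {λ a → encodeList (encE a)} ,ᴾ accumulatorᴾ {encE = encE} {λ a → encodeList (encE a)})
      (λ (a , e) → suc (size (encE a e)))
      (bounded-≤ (λ (a , e) → s≤s (m≤m+n _ (size (i a)))) bounded-size) (λ a e b → ≤-refl))
    where
    ++-is-foldr : ∀ {a} es → es ++ l′ a ≡ foldr _∷_ (l′ a) es
    ++-is-foldr []       = refl
    ++-is-foldr (e ∷ es) = cong (e ∷_) (++-is-foldr es)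

  quantifierᴾ : ∀ (_⊕_ : Bool → Bool → Bool) (u : Bool) (p : ∀ a → E a → Bool) →
    (∀ {A : Set} {i : A → Tree} {p q : A → Bool} → PT i (encodeBool ∘ p) → PT i (encodeBool ∘ q) → PT i (λ a → encodeBool (p a ⊕ q a))) →
    PT i (λ a → encodeList (encE a) (l a)) →
    PT {Σ A E} (λ (a , e) → encE a e ∙ i a) (λ (a , e) → encodeBool (p a e)) →
    PT i (λ a → encodeBool (foldr (λ e b → p a e ⊕ b) u (l a)))
  quantifierᴾ _⊕_ u p ⊕ᴾ pl pp =
    foldr⁺ᴾ encE (λ _ → encodeBool) l (λ _ → u) (λ a e b → p a e ⊕ b) pl (constᴾ (encodeBool u))
      (⊕ᴾ {p = λ (a , e , b) → p a e} {q = λ (a , e , b) → b} (locallyᴾ {encE = encE} {λ _ → encodeBool} pp) (accumulatorᴾ {encE = encE} {λ _ → encodeBool}))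
      (λ _ → 3) (bounded-const 3) (λ a e b → ≤-trans (size-encodeBool (p a e ⊕ b)) (m≤m+n 3 _))

-- Unary numbers, vertices and adjacency

encodeUnary : ℕ → Tree
encodeUnary zero    = nil
encodeUnary (suc n) = nil ∙ encodeUnary n

encodeFin : ∀ {n} → Fin n → Tree
encodeFin = encodeUnary ∘ toℕ

tail^ : ℕ → Tree → Tree
tail^ zero    t = t
tail^ (suc n) t = tail (tail^ n t)

tail^-tail : ∀ n t → tail^ n (tail t) ≡ tail (tail^ n t)
tail^-tail zero    t = refl
tail^-tail (suc n) t = cong tail (tail^-tail n t)

tail^-+ : ∀ m n t → tail^ m (tail^ n t) ≡ tail^ (m + n) t
tail^-+ zero    n t = refl
tail^-+ (suc m) n t = cong tail (tail^-+ m n t)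

tail^-nil : ∀ n → tail^ n nil ≡ nil
tail^-nil zero    = refl
tail^-nil (suc n) = cong tail (tail^-nil n)

isNode-tail^ : ∀ {X : Set} (enc : X → Tree) n xs → isNode (tail^ n (encodeList enc xs)) ≡ (n <ᵇ length xs)
isNode-tail^ enc zero    []       = refl
isNode-tail^ enc zero    (x ∷ xs) = refl
isNode-tail^ enc (suc n) []       = cong isNode (tail^-nil (suc n))
isNode-tail^ enc (suc n) (x ∷ xs) = trans (cong isNode (sym (tail^-tail n _))) (isNode-tail^ enc n xs)

tail^-unary : ∀ m n → tail^ m (encodeUnary n) ≡ encodeUnary (n ∸ m)
tail^-unary zero    n       = refl
tail^-unary (suc m) zero    = tail^-nil (suc m)
tail^-unary (suc m) (suc n) = trans (sym (tail^-tail m _)) (tail^-unary m n)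

tail^-tabulate : ∀ {n} {X : Set} (enc : X → Tree) (f : Fin n → X) i →
                 head (tail^ (toℕ i) (encodeList enc (tabulate f))) ≡ enc (f i)
tail^-tabulate enc f zero    = refl
tail^-tabulate enc f (suc i) = trans (cong head (sym (tail^-tail (toℕ i) _))) (tail^-tabulate enc (f ∘ suc) i)

module _ {A : Set} {i : A → Tree} where

  tail^ᴾ : ∀ {n o} → PT i (encodeUnary ∘ n) → PT i o → PT i (λ a → tail^ (n a) (o a))
  tail^ᴾ {n} {o} pn po = castᴾ (λ a → steps (n a) (o a))
    (foldr⁺ᴾ {E = λ _ → ⊤} (λ _ _ → nil) (λ _ → id) (λ a → replicate (n a) tt) o (λ _ _ → tail)
      (castᴾ (λ a → unary-list (n a)) pn) po (tailᴾ (accumulatorᴾ {encE = λ _ _ → nil} {λ _ → id}))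
      (λ _ → 0) (bounded-const 0) λ _ _ → size-tail)
    where
    steps : ∀ n t → foldr (λ _ → tail) t (replicate n tt) ≡ tail^ n t
    steps zero    t = refl
    steps (suc n) t = cong tail (steps n t)
    unary-list : ∀ n → encodeUnary n ≡ encodeList (λ _ → nil) (replicate n tt)
    unary-list zero    = refl
    unary-list (suc n) = cong (nil ∙_) (unary-list n)
    size-tail : ∀ t → size (tail t) ≤ size t
    size-tail nil     = ≤-refl
    size-tail (s ∙ t) = m≤n⇒m≤1+n (m≤n+m _ _)

  module _ {n : A → ℕ} where

    adjᴾ : {G : ∀ a → Graph (n a)} {v w : ∀ a → Fin (n a)} →
           PT i (λ a → encodeGraph (G a)) → PT i (λ a → encodeFin (v a)) → PT i (λ a → encodeFin (w a)) →
           PT i (λ a → encodeBool (adj (G a) (v a) (w a)))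
    adjᴾ {G} {v} {w} pG pv pw = castᴾ entry (headᴾ (tail^ᴾ {n = toℕ ∘ w} pw (headᴾ (tail^ᴾ {n = toℕ ∘ v} pv pG))))
      where
      entry : ∀ a → head (tail^ (toℕ (w a)) (head (tail^ (toℕ (v a)) (encodeGraph (G a)))))
                  ≡ encodeBool (adj (G a) (v a) (w a))
      entry a = trans (cong (λ t → head (tail^ (toℕ (w a)) t)) (tail^-tabulate _ _ (v a)))
                      (tail^-tabulate encodeBool (adj (G a) (v a)) (w a))

    -- Two unary numbers agree when removing either from the other leaves nothing.
    equalᴾ : {v w : ∀ a → Fin (n a)} →
             PT i (λ a → encodeFin (v a)) → PT i (λ a → encodeFin (w a)) →
             PT i (λ a → encodeBool (does (v a Fin.≟ w a)))
    equalᴾ {v} {w} pv pw = castᴾ (λ a → cong encodeBool (equal (v a) (w a)))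
      (andᴾ (notᴾ (isNodeᴾ (tail^ᴾ {n = toℕ ∘ v} pv pw))) (notᴾ (isNodeᴾ (tail^ᴾ {n = toℕ ∘ w} pw pv))))
      where
      gap : ∀ m n → m < n → isNode (tail^ m (encodeUnary n)) ≡ true
      gap m (suc n) (s≤s m≤n) rewrite tail^-unary m (suc n) | +-∸-assoc 1 m≤n = refl
      equal : ∀ {n} (v w : Fin n) →
        not (isNode (tail^ (toℕ v) (encodeFin w))) ∧ not (isNode (tail^ (toℕ w) (encodeFin v)))
        ≡ does (v Fin.≟ w)
      equal v w with v Fin.≟ w
      equal v .v | yes refl rewrite tail^-unary (toℕ v) (toℕ v) | n∸n≡0 (toℕ v) = refl
      equal v w  | no v≢w with <-cmp (toℕ v) (toℕ w)
      ... | tri< v<w _ _ rewrite gap _ _ v<w = refl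
      ... | tri≈ _ v≡w _ = contradiction (Fin.toℕ-injective v≡w) v≢w
      ... | tri> _ _ w<v rewrite gap _ _ w<v = Bool.∧-zeroʳ _

size-encodeUnary : ∀ n → size (encodeUnary n) ≡ suc (n + n)
size-encodeUnary zero    = refl
size-encodeUnary (suc n) = cong (2 +_) (trans (size-encodeUnary n) (sym (+-suc n n)))

module _ {A : Set} {i : A → Tree} {n : A → ℕ} where

  -- The order is present in the input only as the number of rows of the matrix, so the vertices are
  -- generated row by row, shifting the earlier ones by `suc`. Such a step changes every entry of
  -- the accumulator, which calls for the general fold and a quadratic bound on its values.
  allFinᴾ : {G : ∀ a → Graph (n a)} → PT i (λ a → encodeGraph (G a)) →
            PT i (λ a → encodeList encodeFin (allFin (n a)))
  allFinᴾ {G} pG = castᴾ (λ a → trans (cong (encodeList encodeUnary) (trans (count (rows a)) (cong (map toℕ ∘ allFin) (List.length-tabulate (tabulate ∘ adj (G a)))))) (encode-map (allFin (n a))))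
    (foldrᴾ {E = λ _ → List Bool} {B = λ _ → List ℕ} (λ _ → encodeList encodeBool) (λ _ → encodeList encodeUnary)
      rows (λ _ → []) (λ _ _ ms → 0 ∷ map suc ms) pG nilᴾ
      (nilᴾ ,ᴾ mapᴾ {E = λ _ → ℕ} (λ _ → encodeUnary) (λ (_ , _ , ms) → ms) (λ _ → encodeUnary) (λ _ m → suc m) (accumulatorᴾ {encE = λ _ → encodeList encodeBool} {λ _ → encodeList encodeUnary}) (nilᴾ ,ᴾ headᴾ idᴾ))
      (bounded-≤ (λ (a , rows) → small (i a) rows)
        (bounded-+ (bounded-const 1) (bounded-* bounded-size
          (bounded-+ (bounded-const 2) (bounded-+ bounded-size bounded-size))))))
    where
    rows : ∀ a → List (List Bool)
    rows a = tabulate (tabulate ∘ adj (G a))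
    count : ∀ {X : Set} (xs : List X) → foldr (λ _ ms → 0 ∷ map suc ms) [] xs ≡ map toℕ (allFin (length xs))
    count []       = refl
    count (x ∷ xs) = cong (0 ∷_) (trans (cong (map suc) (count xs)) (trans (sym (List.map-∘ (allFin (length xs))))
      (trans (List.map-∘ (allFin (length xs))) (cong (map toℕ) (List.map-tabulate id suc)))))
    encode-map : ∀ {m} (vs : List (Fin m)) → encodeList encodeUnary (map toℕ vs) ≡ encodeList encodeFin vs
    encode-map []       = refl
    encode-map (v ∷ vs) = cong (encodeFin v ∙_) (encode-map vs)
    small : ∀ t rows → let s = size (encodeList (encodeList encodeBool) rows ∙ t) in
            size (encodeList encodeUnary (foldr (λ _ ms → 0 ∷ map suc ms) [] rows)) ≤ 1 + s * (2 + (s + s))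
    small t rows rewrite count rows | encode-map (allFin (length rows)) = begin
      size (encodeList encodeFin (allFin (length rows)))
        ≤⟨ size-encodeList-≤ encodeFin (suc (length rows + length rows)) (allFin (length rows)) (λ v → ≤-trans (≤-reflexive (size-encodeUnary (toℕ v))) (s≤s (+-mono-≤ (<⇒≤ (Fin.toℕ<n v)) (<⇒≤ (Fin.toℕ<n v))))) ⟩
      1 + length (allFin (length rows)) * (2 + (length rows + length rows))
        ≡⟨ cong (λ m → 1 + m * (2 + (length rows + length rows))) (List.length-tabulate {n = length rows} id) ⟩
      1 + length rows * (2 + (length rows + length rows))
        ≤⟨ s≤s (*-mono-≤ len (+-monoʳ-≤ 2 (+-mono-≤ len len))) ⟩
      1 + s * (2 + (s + s)) ∎
      where
      open ≤-Reasoning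
      s = size (encodeList (encodeList encodeBool) rows ∙ t)
      len : length rows ≤ s
      len = m≤n⇒m≤1+n (≤-trans (length≤size _ rows) (m≤m+n _ _))

-- Tuples of vertices

-- The last argument is the encoded state below the variables, so that binding a further variable is
-- a single `∙`.
encodeVec : ∀ {n m} → Vec (Fin n) m → Tree → Tree
encodeVec []      t = t
encodeVec (v ∷ ρ) t = encodeFin v ∙ encodeVec ρ t

encodeTuple : ∀ {n m} → Vec (Fin n) m → Tree
encodeTuple ρ = encodeVec ρ nil

tuples : ∀ n r → List (Vec (Fin n) r)
tuples n zero    = [] ∷ []
tuples n (suc r) = cartesianProductWith _∷_ (allFin n) (tuples n r)

∈-tuples : ∀ {n r} (t : Vec (Fin n) r) → t ∈ tuples n r
∈-tuples []      = here refl
∈-tuples (v ∷ t) = ∈-cartesianProductWith⁺ _∷_ (∈-allFin v) (∈-tuples t)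

module _ {A : Set} {i : A → Tree} {n : A → ℕ} where

  lookupᴾ : ∀ {m} {ρ : ∀ a → Vec (Fin (n a)) m} {t : A → Tree} →
            PT i (λ a → encodeVec (ρ a) (t a)) → ∀ x → PT i (λ a → encodeFin (lookup (ρ a) x))
  lookupᴾ {ρ = ρ} {t} pρ zero    = castᴾ (λ a → first (ρ a) (t a)) (headᴾ pρ)
    where
    first : ∀ {n m} (ρ : Vec (Fin n) (suc m)) t → head (encodeVec ρ t) ≡ encodeFin (lookup ρ zero)
    first (v ∷ ρ) t = refl
  lookupᴾ {ρ = ρ} {t} pρ (suc x) = castᴾ (λ a → cong encodeFin (later (ρ a)))
    (lookupᴾ {ρ = Vec.tail ∘ ρ} {t} (castᴾ (λ a → others (ρ a) (t a)) (tailᴾ pρ)) x)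
    where
    others : ∀ {n m} (ρ : Vec (Fin n) (suc m)) t → tail (encodeVec ρ t) ≡ encodeVec (Vec.tail ρ) t
    others (v ∷ ρ) t = refl
    later : ∀ {n m} {x : Fin m} (ρ : Vec (Fin n) (suc m)) → lookup (Vec.tail ρ) x ≡ lookup ρ (suc x)
    later (v ∷ ρ) = refl

  prependᴾ : ∀ {r m} {s : ∀ a → Vec (Fin (n a)) r} {ρ : ∀ a → Vec (Fin (n a)) m} {t : A → Tree} →
             PT i (λ a → encodeTuple (s a)) → PT i (λ a → encodeVec (ρ a) (t a)) →
             PT i (λ a → encodeVec (s a Vec.++ ρ a) (t a))
  prependᴾ {zero}  {s = s} {ρ} {t} ps pρ = castᴾ (λ a → none (s a) (ρ a) (t a)) pρ
    where
    none : ∀ {n m} (s : Vec (Fin n) 0) (ρ : Vec (Fin n) m) t → encodeVec ρ t ≡ encodeVec (s Vec.++ ρ) t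
    none [] ρ t = refl
  prependᴾ {suc r} {s = s} {ρ} {t} ps pρ = castᴾ (λ a → step (s a) (ρ a) (t a))
    (headᴾ ps ,ᴾ prependᴾ {s = Vec.tail ∘ s} {ρ} {t} (castᴾ (λ a → others (s a)) (tailᴾ ps)) pρ)
    where
    others : ∀ {n m} (ρ : Vec (Fin n) (suc m)) → tail (encodeTuple ρ) ≡ encodeTuple (Vec.tail ρ)
    others (v ∷ ρ) = refl
    step : ∀ {n m r} (s : Vec (Fin n) (suc r)) (ρ : Vec (Fin n) m) t →
           head (encodeTuple s) ∙ encodeVec (Vec.tail s Vec.++ ρ) t ≡ encodeVec (s Vec.++ ρ) t
    step (v ∷ s) ρ t = refl

  tuplesᴾ : ∀ r → PT i (λ a → encodeList encodeFin (allFin (n a))) →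
            PT i (λ a → encodeList encodeTuple (tuples (n a) r))
  tuplesᴾ zero    pv = constᴾ (nil ∙ nil)
  tuplesᴾ (suc r) pv = castᴾ (λ a → cong (encodeList encodeTuple) (sym (product-is-foldr (tuples (n a) r) (allFin (n a)))))
    (foldr⁺ᴾ {E = λ a → Fin (n a)} {B = λ a → List (Vec (Fin (n a)) (suc r))} (λ _ → encodeFin) (λ _ → encodeList encodeTuple)
      (allFin ∘ n) (λ _ → []) (λ a v ts → map (v ∷_) (tuples (n a) r) ++ ts) pv nilᴾ
      (++ᴾ (λ _ → encodeTuple) (λ (a , v , _) → map (v ∷_) (tuples (n a) r)) (λ (_ , _ , ts) → ts)
        (locallyᴾ {E = λ a → Fin (n a)} {λ a → List (Vec (Fin (n a)) (suc r))} {λ _ → encodeFin} {λ _ → encodeList encodeTuple} extensions)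
        (accumulatorᴾ {E = λ a → Fin (n a)} {λ a → List (Vec (Fin (n a)) (suc r))} {encE = λ _ → encodeFin} {λ _ → encodeList encodeTuple}))
      (λ (a , v) → size (encodeList encodeTuple (map (v ∷_) (tuples (n a) r)))) (size-bounded extensions)
      (λ a v ts → ≤-trans (n≤1+n _) (≤-reflexive (size-++ encodeTuple (map (v ∷_) (tuples (n a) r)) ts))))
    where
    product-is-foldr : ∀ {n} (ts : List (Vec (Fin n) r)) vs →
      cartesianProductWith _∷_ vs ts ≡ foldr (λ v us → map (v ∷_) ts ++ us) [] vs
    product-is-foldr ts []       = refl
    product-is-foldr ts (v ∷ vs) = cong (map (v ∷_) ts ++_) (product-is-foldr ts vs)
    extensions : PT {Σ A (Fin ∘ n)} (λ (a , v) → encodeFin v ∙ i a)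
                    (λ (a , v) → encodeList encodeTuple (map (v ∷_) (tuples (n a) r)))
    extensions = mapᴾ {E = λ (a , _) → Vec (Fin (n a)) r} (λ _ → encodeTuple) (λ (a , v) → tuples (n a) r) (λ _ → encodeTuple) (λ (a , v) → v ∷_)
      (tailᴾ idᴾ ≫ reindexᴾ proj₁ (tuplesᴾ r pv)) (headᴾ (tailᴾ idᴾ) ,ᴾ headᴾ idᴾ)

-- Formulas with a counting quantifier

threshold : ℕ → ℕ
threshold k = k + (k + 3)

greedy : {X : Set} → (X → Bool) → (X → X → Bool) → List X → List X
greedy p r = foldr (λ x xs → ifᵇ p x ∧ foldr (λ y b → r x y ∧ b) true xs then x ∷ xs else xs) []

infix  7 _∼_ _≐_
infix  6 ¬̇_
infixr 5 _∧̇_ _∨̇_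
infixr 4 _⇒̇_
infix  3 ∃̇_ ∀̇_

-- Formulas with m free vertex variables, in de Bruijn style.  many r φ ψ says
-- that the greedy list of r-tuples satisfying φ and pairwise satisfying ψ
-- exceeds the threshold; in ψ the newer tuple precedes the older one.
data Formula (m : ℕ) : Set where
  _∼_ _≐_        : Fin m → Fin m → Formula m
  positive       : Formula m
  ¬̇_             : Formula m → Formula m
  _∧̇_ _∨̇_ _⇒̇_   : Formula m → Formula m → Formula m
  ∃̇_ ∀̇_         : Formula (suc m) → Formula m
  many           : ∀ r → Formula (r + m) → Formula (r + (r + m)) → Formula m

module _ {n} (G : Graph n) (k : ℕ) where

  ⟦_⟧ : ∀ {m} → Formula m → Vec (Fin n) m → Bool
  ⟦ x ∼ y      ⟧ ρ = adj G (lookup ρ x) (lookup ρ y)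
  ⟦ x ≐ y      ⟧ ρ = does (lookup ρ x Fin.≟ lookup ρ y)
  ⟦ positive   ⟧ ρ = 0 <ᵇ k
  ⟦ ¬̇ φ        ⟧ ρ = not (⟦ φ ⟧ ρ)
  ⟦ φ ∧̇ ψ      ⟧ ρ = ⟦ φ ⟧ ρ ∧ ⟦ ψ ⟧ ρ
  ⟦ φ ∨̇ ψ      ⟧ ρ = ⟦ φ ⟧ ρ ∨ ⟦ ψ ⟧ ρ
  ⟦ φ ⇒̇ ψ      ⟧ ρ = not (⟦ φ ⟧ ρ) ∨ ⟦ ψ ⟧ ρ
  ⟦ ∃̇ φ        ⟧ ρ = foldr (λ v b → ⟦ φ ⟧ (v ∷ ρ) ∨ b) false (allFin n)
  ⟦ ∀̇ φ        ⟧ ρ = foldr (λ v b → ⟦ φ ⟧ (v ∷ ρ) ∧ b) true (allFin n)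
  ⟦ many r φ ψ ⟧ ρ = threshold k <ᵇ length (greedy (λ t → ⟦ φ ⟧ (t Vec.++ ρ)) (λ t s → ⟦ ψ ⟧ (t Vec.++ (s Vec.++ ρ))) (tuples n r))

  selection : ∀ {m} r → Formula (r + m) → Formula (r + (r + m)) → Vec (Fin n) m → List (Vec (Fin n) r)
  selection r φ ψ ρ = greedy (λ t → ⟦ φ ⟧ (t Vec.++ ρ)) (λ t s → ⟦ ψ ⟧ (t Vec.++ (s Vec.++ ρ))) (tuples n r)

  Sat : ∀ {m} → Formula m → Vec (Fin n) m → Set
  Sat (x ∼ y)      ρ = Edge G (lookup ρ x) (lookup ρ y)
  Sat (x ≐ y)      ρ = lookup ρ x ≡ lookup ρ y
  Sat positive     ρ = 0 < k
  Sat (¬̇ φ)        ρ = ¬ Sat φ ρ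
  Sat (φ ∧̇ ψ)      ρ = Sat φ ρ × Sat ψ ρ
  Sat (φ ∨̇ ψ)      ρ = Sat φ ρ ⊎ Sat ψ ρ
  Sat (φ ⇒̇ ψ)      ρ = Sat φ ρ → Sat ψ ρ
  Sat (∃̇ φ)        ρ = ∃[ v ] Sat φ (v ∷ ρ)
  Sat (∀̇ φ)        ρ = ∀ v → Sat φ (v ∷ ρ)
  Sat (many r φ ψ) ρ = threshold k < length (selection r φ ψ ρ)

  reflects-∃ : {P : Fin n → Set} {p : Fin n → Bool} → (∀ v → Reflects (P v) (p v)) →
               Reflects (∃ P) (foldr (λ v b → p v ∨ b) false (allFin n))
  reflects-∃ {P} {p} pr = go (allFin n) (λ (v , q) → v , ∈-allFin v , q)
    where
    go : ∀ vs → (∃ P → ∃ λ v → v ∈ vs × P v) → Reflects (∃ P) (foldr (λ v b → p v ∨ b) false vs)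
    go []       all = ofⁿ λ q → case proj₁ (proj₂ (all q)) of λ ()
    go (v ∷ vs) all with p v | pr v
    ... | true  | ofʸ q  = ofʸ (v , q)
    ... | false | ofⁿ ¬q = go vs λ x → case all x of λ where
            (_ , here refl , q) → contradiction q ¬q
            (w , there w∈ , q)  → w , w∈ , q

  reflects-∀ : {P : Fin n → Set} {p : Fin n → Bool} → (∀ v → Reflects (P v) (p v)) →
               Reflects (∀ v → P v) (foldr (λ v b → p v ∧ b) true (allFin n))
  reflects-∀ {P} {p} pr = go (allFin n) (λ f v → f v (∈-allFin v))
    where
    go : ∀ vs → ((∀ v → v ∈ vs → P v) → ∀ v → P v) → Reflects (∀ v → P v) (foldr (λ v b → p v ∧ b) true vs)
    go []       all = ofʸ (all λ _ ())
    go (v ∷ vs) all with p v | pr v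
    ... | false | ofⁿ ¬q = ofⁿ λ f → ¬q (f v)
    ... | true  | ofʸ q  = go vs λ f → all λ where
            _ (here refl) → q
            w (there w∈)  → f w w∈

  reflects : ∀ {m} (φ : Formula m) ρ → Reflects (Sat φ ρ) (⟦ φ ⟧ ρ)
  reflects (x ∼ y)      ρ = T-reflects _
  reflects (x ≐ y)      ρ = proof (lookup ρ x Fin.≟ lookup ρ y)
  reflects positive     ρ = <ᵇ-reflects-< 0 k
  reflects (¬̇ φ)        ρ = ¬-reflects (reflects φ ρ)
  reflects (φ ∧̇ ψ)      ρ = reflects φ ρ ×-reflects reflects ψ ρ
  reflects (φ ∨̇ ψ)      ρ = reflects φ ρ ⊎-reflects reflects ψ ρ
  reflects (φ ⇒̇ ψ)      ρ = reflects φ ρ →-reflects reflects ψ ρ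
  reflects (∃̇ φ)        ρ = reflects-∃ λ v → reflects φ (v ∷ ρ)
  reflects (∀̇ φ)        ρ = reflects-∀ λ v → reflects φ (v ∷ ρ)
  reflects (many r φ ψ) ρ = <ᵇ-reflects-< _ _

  sat? : ∀ {m} (φ : Formula m) ρ → Dec (Sat φ ρ)
  sat? φ ρ = _ because reflects φ ρ

-- Evaluation of formulas in polynomial time

-- The parameter is kept both in unary, to be compared with list lengths, and
-- in binary, to be output at the end.
Config : Set
Config = Σ[ n ∈ ℕ ] Graph n × ℕ

encodeState : ∀ {n} → Graph n × ℕ → Tree
encodeState (G , k) = encodeGraph G ∙ encodeUnary k ∙ encodeℕ k

Env : ℕ → Set
Env m = Σ[ s ∈ Config ] Vec (Fin (proj₁ s)) m

encodeEnv : ∀ {m} → Env m → Tree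
encodeEnv ((n , s) , ρ) = encodeVec ρ (encodeState s)

module _ {A : Set} {i : A → Tree} where

  module _ {E : A → Set} (encE : ∀ a → E a → Tree) (l : ∀ a → List (E a)) where

    greedyᴾ : (p : ∀ a → E a → Bool) (r : ∀ a → E a → E a → Bool) →
      PT i (λ a → encodeList (encE a) (l a)) →
      PT {Σ A E} (λ (a , e) → encE a e ∙ i a) (λ (a , e) → encodeBool (p a e)) →
      PT {Σ A λ a → E a × E a} (λ (a , e , e′) → encE a e ∙ encE a e′ ∙ i a) (λ (a , e , e′) → encodeBool (r a e e′)) →
      PT i (λ a → encodeList (encE a) (greedy (p a) (r a) (l a)))
    greedyᴾ p r pl pp pr = foldr⁺ᴾ encE (λ a → encodeList (encE a)) l (λ _ → [])
      (λ a e es → ifᵇ p a e ∧ foldr (λ e′ b → r a e e′ ∧ b) true es then e ∷ es else es) pl nilᴾ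
      (ifᴾ (λ (a , e , es) → encodeList (encE a)) (λ (a , e , es) → e ∷ es) (λ (a , e , es) → es)
        (andᴾ (locallyᴾ {encE = encE} {λ a → encodeList (encE a)} pp)
          (quantifierᴾ (λ (a , _) → encE a) (λ (_ , _ , es) → es) _∧_ true (λ (a , e , _) e′ → r a e e′) andᴾ
            acc ((headᴾ (tailᴾ idᴾ) ,ᴾ headᴾ idᴾ ,ᴾ tailᴾ (tailᴾ (tailᴾ idᴾ))) ≫ reindexᴾ (λ ((a , e , es) , e′) → a , e , e′) pr)))
        (elementᴾ {encE = encE} {λ a → encodeList (encE a)} ,ᴾ acc) acc)
      (λ (a , e) → suc (size (encE a e)))
      (bounded-≤ (λ (a , e) → s≤s (m≤m+n _ (size (i a)))) bounded-size)
      (λ a e es → grow (encE a) (p a e ∧ foldr (λ e′ b → r a e e′ ∧ b) true es) e es)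
      where
      acc = accumulatorᴾ {encE = encE} {λ a → encodeList (encE a)}
      grow : ∀ {X : Set} (enc : X → Tree) b x xs →
        size (encodeList enc (ifᵇ b then x ∷ xs else xs)) ≤ suc (size (enc x)) + size (encodeList enc xs)
      grow enc true  x xs = ≤-refl
      grow enc false x xs = m≤n+m _ (suc (size (enc x)))

    -- The number k + (k + 3) is never computed: 3, k and again k entries are removed from the list,
    -- and something has to remain.
    largeᴾ : {k : A → ℕ} → PT i (encodeUnary ∘ k) → PT i (λ a → encodeList (encE a) (l a)) →
             PT i (λ a → encodeBool (threshold (k a) <ᵇ length (l a)))
    largeᴾ {k} pk pl = castᴾ (λ a → cong encodeBool (trans
        (cong isNode (trans (cong (tail^ (k a)) (tail^-+ (k a) 3 _)) (tail^-+ (k a) (k a + 3) _)))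
        (isNode-tail^ (encE a) (threshold (k a)) (l a))))
      (isNodeᴾ (tail^ᴾ pk (tail^ᴾ pk (tailᴾ (tailᴾ (tailᴾ pl))))))

stateᴾ : ∀ {m} → PT {Env m} encodeEnv (λ ((n , s) , ρ) → encodeState s)
stateᴾ {zero}  = castᴾ (λ { (_ , []) → refl }) idᴾ
stateᴾ {suc m} = castᴾ (λ { (_ , _ ∷ _) → refl }) (tailᴾ idᴾ) ≫ reindexᴾ (λ (s , ρ) → s , Vec.tail ρ) stateᴾ

module _ {m : ℕ} where

  graphᴾ : PT {Env m} encodeEnv (λ ((n , G , k) , ρ) → encodeGraph G)
  graphᴾ = headᴾ stateᴾ

  unaryᴾ : PT {Env m} encodeEnv (λ ((n , G , k) , ρ) → encodeUnary k)
  unaryᴾ = headᴾ (tailᴾ stateᴾ)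

  verticesᴾ : PT {Env m} encodeEnv (λ ((n , G , k) , ρ) → encodeList encodeFin (allFin n))
  verticesᴾ = allFinᴾ {G = λ ((n , G , k) , ρ) → G} graphᴾ

  variableᴾ : ∀ x → PT {Env m} encodeEnv (λ (s , ρ) → encodeFin (lookup ρ x))
  variableᴾ = lookupᴾ {ρ = proj₂} {λ ((n , s) , ρ) → encodeState s} idᴾ

formulaᴾ : ∀ {m} (φ : Formula m) →
           PT {Env m} encodeEnv (λ ((n , G , k) , ρ) → encodeBool (⟦_⟧ G k φ ρ))
formulaᴾ (x ∼ y)      = adjᴾ {G = λ ((n , G , k) , ρ) → G} graphᴾ (variableᴾ x) (variableᴾ y)
formulaᴾ (x ≐ y)      = equalᴾ (variableᴾ x) (variableᴾ y)
formulaᴾ positive     = castᴾ (λ ((n , G , k) , ρ) → cong encodeBool (nonzero k)) (isNodeᴾ unaryᴾ)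
  where
  nonzero : ∀ k → isNode (encodeUnary k) ≡ (0 <ᵇ k)
  nonzero zero    = refl
  nonzero (suc _) = refl
formulaᴾ (¬̇ φ)        = notᴾ (formulaᴾ φ)
formulaᴾ (φ ∧̇ ψ)      = andᴾ (formulaᴾ φ) (formulaᴾ ψ)
formulaᴾ (φ ∨̇ ψ)      = orᴾ (formulaᴾ φ) (formulaᴾ ψ)
formulaᴾ (φ ⇒̇ ψ)      = orᴾ (notᴾ (formulaᴾ φ)) (formulaᴾ ψ)
formulaᴾ (∃̇ φ)        = quantifierᴾ (λ _ → encodeFin) (λ ((n , _) , _) → allFin n) _∨_ false (λ ((n , G , k) , ρ) v → ⟦_⟧ G k φ (v ∷ ρ)) orᴾ
                          verticesᴾ (reindexᴾ (λ ((s , ρ) , v) → s , v ∷ ρ) (formulaᴾ φ))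
formulaᴾ (∀̇ φ)        = quantifierᴾ (λ _ → encodeFin) (λ ((n , _) , _) → allFin n) _∧_ true (λ ((n , G , k) , ρ) v → ⟦_⟧ G k φ (v ∷ ρ)) andᴾ
                          verticesᴾ (reindexᴾ (λ ((s , ρ) , v) → s , v ∷ ρ) (formulaᴾ φ))
formulaᴾ {m} (many r φ ψ) = largeᴾ (λ _ → encodeTuple) (λ ((n , G , k) , ρ) → selection G k r φ ψ ρ) unaryᴾ
  (greedyᴾ (λ _ → encodeTuple) (λ ((n , s) , ρ) → tuples n r)
    (λ ((n , G , k) , ρ) t → ⟦_⟧ G k φ (t Vec.++ ρ)) (λ ((n , G , k) , ρ) t s → ⟦_⟧ G k ψ (t Vec.++ (s Vec.++ ρ)))
    (tuplesᴾ r verticesᴾ)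
    (prependᴾ {s = proj₂} {ρ = λ ((s , ρ) , t) → ρ} {λ (((n , s) , ρ) , t) → encodeState s} (headᴾ idᴾ) (tailᴾ idᴾ)
      ≫ reindexᴾ (λ ((s , ρ) , t) → s , t Vec.++ ρ) (formulaᴾ φ))
    (prependᴾ {s = λ (_ , t , s) → t} {ρ = λ ((_ , ρ) , t , s) → s Vec.++ ρ} {λ (((n , s) , ρ) , _) → encodeState s} (headᴾ idᴾ)
      (prependᴾ {s = λ (_ , t , s) → s} {ρ = λ ((_ , ρ) , t , s) → ρ} {λ (((n , s) , ρ) , _) → encodeState s} (headᴾ (tailᴾ idᴾ)) (tailᴾ (tailᴾ idᴾ)))
      ≫ reindexᴾ (λ ((s , ρ) , t , s′) → s , t Vec.++ (s′ Vec.++ ρ)) (formulaᴾ ψ)))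

-- Predecessor in bijective binary notation

bits : ℕᵇ.ℕᵇ → List Bool
bits ℕᵇ.zero     = []
bits ℕᵇ.2[1+ b ] = false ∷ bits b
bits ℕᵇ.1+[2 b ] = true ∷ bits b

encode-bits : ∀ b → encodeList encodeBool (bits b) ≡ encodeℕᵇ b
encode-bits ℕᵇ.zero     = refl
encode-bits ℕᵇ.2[1+ b ] = cong (_ ∙_) (encode-bits b)
encode-bits ℕᵇ.1+[2 b ] = cong (_ ∙_) (encode-bits b)

-- Doubling a number whose lowest bit is 2 leaves the remaining bits unchanged,
-- so they are accumulated alongside the result.
doubleStep : Bool → List Bool × List Bool → List Bool × List Bool
doubleStep b (bs , ds) = b ∷ bs , false ∷ (ifᵇ b then ds else true ∷ bs)

doubleBits : List Bool → List Bool × List Bool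
doubleBits = foldr doubleStep ([] , [])

doubleBits-double : ∀ b → doubleBits (bits b) ≡ (bits b , bits (ℕᵇ.double b))
doubleBits-double ℕᵇ.zero     = refl
doubleBits-double ℕᵇ.2[1+ b ] = cong (doubleStep false) (doubleBits-double b)
doubleBits-double ℕᵇ.1+[2 b ] = cong (doubleStep true) (doubleBits-double b)

encodeBits² : List Bool × List Bool → Tree
encodeBits² (bs , ds) = encodeList encodeBool bs ∙ encodeList encodeBool ds

doubleBits-fst : ∀ bs → proj₁ (doubleBits bs) ≡ bs
doubleBits-fst []       = refl
doubleBits-fst (b ∷ bs) = cong (b ∷_) (doubleBits-fst bs)

size-doubleBits : ∀ bs → size (encodeList encodeBool (proj₂ (doubleBits bs))) ≤ 4 + size (encodeList encodeBool bs)
size-doubleBits []           = s≤s z≤n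
size-doubleBits (true ∷ bs)  = +-monoʳ-≤ 2 (≤-trans (size-doubleBits bs) (+-monoʳ-≤ 4 (m≤n+m _ 2)))
size-doubleBits (false ∷ bs) rewrite doubleBits-fst bs = ≤-refl

size-double : ∀ b → size (encodeℕᵇ (ℕᵇ.double b)) ≤ 4 + size (encodeℕᵇ b)
size-double b = subst₂ (λ s t → size s ≤ 4 + size t)
  (trans (cong (encodeList encodeBool ∘ proj₂) (doubleBits-double b)) (encode-bits (ℕᵇ.double b))) (encode-bits b)
  (size-doubleBits (bits b))

-- The predecessor can have the larger encoding, since the digit 2 is coded by `nil` and the digit 1
-- by a tree of size 3. An additive bound is what `foldr⁺ᴾ` needs for repeated decrements.
size-pred : ∀ k → size (encodeℕ (pred k)) ≤ 4 + size (encodeℕ k)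
size-pred k = subst (λ b → size (encodeℕᵇ b) ≤ 4 + size (encodeℕ k)) (sym (ℕᵇ.fromℕ-pred k)) (size-predᵇ (ℕᵇ.fromℕ k))
  where
  size-predᵇ : ∀ b → size (encodeℕᵇ (ℕᵇ.pred b)) ≤ 4 + size (encodeℕᵇ b)
  size-predᵇ ℕᵇ.zero     = s≤s z≤n
  size-predᵇ ℕᵇ.2[1+ b ] = +-monoʳ-≤ 4 (m≤n+m _ 2)
  size-predᵇ ℕᵇ.1+[2 b ] = ≤-trans (size-double b) (+-monoʳ-≤ 4 (m≤n+m _ 4))

module _ {A : Set} {i : A → Tree} where

  doubleᴾ : {b : A → ℕᵇ.ℕᵇ} → PT i (encodeℕᵇ ∘ b) → PT i (encodeℕᵇ ∘ ℕᵇ.double ∘ b)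
  doubleᴾ {b} pb = castᴾ (λ a → trans (cong (encodeList encodeBool ∘ proj₂) (doubleBits-double (b a))) (encode-bits (ℕᵇ.double (b a))))
    (tailᴾ (foldrᴾ {E = λ _ → Bool} (λ _ → encodeBool) (λ _ → encodeBits²) (bits ∘ b) (λ _ → [] , []) (λ _ → doubleStep)
      (castᴾ (λ a → sym (encode-bits (b a))) pb) (constᴾ (nil ∙ nil))
      ((element ,ᴾ headᴾ accumulator)
        ,ᴾ (nilᴾ ,ᴾ ifᴾ (λ _ → encodeList encodeBool) (λ (_ , _ , _ , ds) → ds) (λ (_ , _ , bs , _) → true ∷ bs) element (tailᴾ accumulator) (constᴾ (nil ∙ nil) ,ᴾ headᴾ accumulator)))
      (bounded-≤ (λ (a , bs) → small (i a) bs) (bounded-+ (bounded-const 5) (bounded-+ bounded-size bounded-size)))))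
    where
    element = elementᴾ {encE = λ _ → encodeBool} {λ _ → encodeBits²}
    accumulator = accumulatorᴾ {encE = λ _ → encodeBool} {λ _ → encodeBits²}
    small : ∀ t bs → let s = size (encodeList encodeBool bs ∙ t) in
            size (encodeBits² (doubleBits bs)) ≤ 5 + (s + s)
    small t bs rewrite doubleBits-fst bs = begin
      suc (m + size (encodeList encodeBool (proj₂ (doubleBits bs)))) ≤⟨ s≤s (+-monoʳ-≤ m (size-doubleBits bs)) ⟩
      suc (m + (4 + m)) ≡⟨ cong suc (x+[4+y] m m) ⟩
      5 + (m + m) ≤⟨ +-monoʳ-≤ 5 (+-mono-≤ m≤ m≤) ⟩
      _ ∎
      where
      open ≤-Reasoning
      m = size (encodeList encodeBool bs)
      m≤ : m ≤ size (encodeList encodeBool bs ∙ t)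
      m≤ = m≤n⇒m≤1+n (m≤m+n _ _)
      x+[4+y] : ∀ x y → x + (4 + y) ≡ 4 + (x + y)
      x+[4+y] = solve-∀

module _ {A : Set} {i : A → Tree} where

  predᴾ : (k : A → ℕ) → PT i (encodeℕ ∘ k) → PT i (encodeℕ ∘ pred ∘ k)
  predᴾ k pk = castᴾ (λ a → cong encodeℕᵇ (sym (ℕᵇ.fromℕ-pred (k a))))
    (splitᴾ {o = λ a → encodeℕᵇ (ℕᵇ.pred (ℕᵇ.fromℕ (k a)))} (isNodeᴾ pk)
      (splitᴾ {o = λ (a , _) → encodeℕᵇ (ℕᵇ.pred (ℕᵇ.fromℕ (k a)))} (isNodeᴾ (headᴾ pk′))
        (castᴾ (λ ((a , _) , t) → odd (ℕᵇ.fromℕ (k a)) t) (doubleᴾ {b = λ ((a , _) , _) → drop₁ (ℕᵇ.fromℕ (k a))}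
          (castᴾ (λ ((a , _) , _) → dropped (ℕᵇ.fromℕ (k a))) (tailᴾ (reindexᴾ proj₁ pk′)))))
        (castᴾ (λ ((a , s) , t) → even (ℕᵇ.fromℕ (k a)) s t) (constᴾ (nil ∙ nil) ,ᴾ tailᴾ (reindexᴾ proj₁ pk′))))
      (castᴾ (λ (a , t) → empty (ℕᵇ.fromℕ (k a)) t) nilᴾ))
    where
    pk′ : PT {Σ A λ a → T (isNode (encodeℕ (k a)))} (i ∘ proj₁) (λ (a , _) → encodeℕ (k a))
    pk′ = reindexᴾ proj₁ pk
    drop₁ : ℕᵇ.ℕᵇ → ℕᵇ.ℕᵇ
    drop₁ ℕᵇ.zero     = ℕᵇ.zero
    drop₁ ℕᵇ.2[1+ b ] = b
    drop₁ ℕᵇ.1+[2 b ] = b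
    dropped : ∀ b → tail (encodeℕᵇ b) ≡ encodeℕᵇ (drop₁ b)
    dropped ℕᵇ.zero     = refl
    dropped ℕᵇ.2[1+ b ] = refl
    dropped ℕᵇ.1+[2 b ] = refl
    odd : ∀ b → T (isNode (head (encodeℕᵇ b))) → encodeℕᵇ (ℕᵇ.double (drop₁ b)) ≡ encodeℕᵇ (ℕᵇ.pred b)
    odd ℕᵇ.1+[2 b ] _ = refl
    even : ∀ b → T (isNode (encodeℕᵇ b)) → T (not (isNode (head (encodeℕᵇ b)))) →
           (nil ∙ nil) ∙ tail (encodeℕᵇ b) ≡ encodeℕᵇ (ℕᵇ.pred b)
    even ℕᵇ.2[1+ b ] _ _ = refl
    empty : ∀ b → T (not (isNode (encodeℕᵇ b))) → nil ≡ encodeℕᵇ (ℕᵇ.pred b)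
    empty ℕᵇ.zero _ = refl

-- Deletion, search and induced subgraphs

-- Testing both orders keeps the graph symmetric; a predicate that fails only at (a , b) thus
-- removes the undirected edge ab.
restrict : ∀ {n} → Graph n → (Fin n → Fin n → Bool) → Graph n
adj        (restrict G p) i j = adj G i j ∧ (p i j ∧ p j i)
adj-sym    (restrict G p) i j = cong₂ _∧_ (adj-sym G i j) (Bool.∧-comm (p i j) (p j i))
adj-irrefl (restrict G p) i   = cong (_∧ _) (adj-irrefl G i)

prune : ∀ {n m} → Graph n → ℕ → Formula (2 + m) → Vec (Fin n) m → Graph n
prune G k φ ρ = restrict G λ i j → ⟦_⟧ G k φ (i ∷ j ∷ ρ)

module _ {X : Set} {n : ℕ} where

  size-tabulate : (enc : X → Tree) (f g : Fin n → X) → (∀ v → size (enc (f v)) ≤ size (enc (g v))) →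
                  size (encodeList enc (tabulate f)) ≤ size (encodeList enc (tabulate g))
  size-tabulate enc = go n
    where
    go : ∀ n (f g : Fin n → X) → (∀ v → size (enc (f v)) ≤ size (enc (g v))) →
         size (encodeList enc (tabulate f)) ≤ size (encodeList enc (tabulate g))
    go zero    f g le = ≤-refl
    go (suc n) f g le = s≤s (+-mono-≤ (le zero) (go n (f ∘ suc) (g ∘ suc) (le ∘ suc)))

size-restrict : ∀ {n} (G : Graph n) p → size (encodeGraph (restrict G p)) ≤ size (encodeGraph G)
size-restrict {n} G p = size-tabulate (encodeList encodeBool) _ _ λ i →
  size-tabulate encodeBool _ _ λ j → fewer (adj G i j) (p i j ∧ p j i)
  where
  fewer : ∀ x y → size (encodeBool (x ∧ y)) ≤ size (encodeBool x)
  fewer true  y = size-encodeBool y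
  fewer false y = ≤-refl

pruneᴾ : ∀ {m} (φ : Formula (2 + m)) →
         PT {Env m} encodeEnv (λ ((n , G , k) , ρ) → encodeGraph (prune G k φ ρ))
pruneᴾ φ = castᴾ (λ ((n , G , k) , ρ) → cong (encodeList (encodeList encodeBool))
    (trans (List.map-cong (λ v → List.map-tabulate id (adj (prune G k φ ρ) v)) (allFin n)) (List.map-tabulate id _)))
  (mapᴾ (λ _ → encodeFin) (λ ((n , _) , _) → allFin n) (λ _ → encodeList encodeBool) (λ ((n , G , k) , ρ) v → map (adj (prune G k φ ρ) v) (allFin n)) verticesᴾ
    (mapᴾ (λ _ → encodeFin) (λ (((n , _) , _) , _) → allFin n) (λ _ → encodeBool) (λ (((n , G , k) , ρ) , v) w → adj (prune G k φ ρ) v w)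
      (reindexᴾ (λ ((s , ρ) , v) → s , v ∷ ρ) verticesᴾ)
      (andᴾ (swapped ≫ reindexᴾ (λ (((s , ρ) , v) , w) → s , v ∷ w ∷ ρ) (formulaᴾ (0F ∼ 1F)))
        (andᴾ (swapped ≫ reindexᴾ (λ (((s , ρ) , v) , w) → s , v ∷ w ∷ ρ) (formulaᴾ φ))
              (reindexᴾ (λ (((s , ρ) , v) , w) → s , w ∷ v ∷ ρ) (formulaᴾ φ))))))
  where
  swapped = headᴾ (tailᴾ idᴾ) ,ᴾ headᴾ idᴾ ,ᴾ tailᴾ (tailᴾ idᴾ)

T-does⁺ : {P : Set} (P? : Dec P) → P → T (does P?)
T-does⁺ (yes _) p = tt
T-does⁺ (no ¬p) p = ¬p p

T-does⁻ : {P : Set} (P? : Dec P) → T (does P?) → P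
T-does⁻ (yes p) _ = p

search : {X Y : Set} → (X → Bool) → (X → Y) → Y → List X → Y
search p f = foldr (λ x y → ifᵇ p x then f x else y)

search-cases : {X Y : Set} (p : X → Bool) (f : X → Y) (y : Y) (xs : List X) →
  (∃[ x ] T (p x) × search p f y xs ≡ f x) ⊎
  ((∀ x → x ∈ xs → ¬ T (p x)) × search p f y xs ≡ y)
search-cases p f y []       = inj₂ ((λ _ ()) , refl)
search-cases p f y (x ∷ xs) with p x in eq | search-cases p f y xs
... | true  | _                 = inj₁ (x , subst T (sym eq) _ , refl)
... | false | inj₁ found        = inj₁ found
... | false | inj₂ (none , end) = inj₂ ((λ { _ (here refl) → subst T eq ; z (there z∈) → none z z∈ }) , end)

module _ {A : Set} {i : A → Tree} {E B : A → Set} (encE : ∀ a → E a → Tree) (encB : ∀ a → B a → Tree) where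

  searchᴾ : (p : ∀ a → E a → Bool) (f : ∀ a → E a → B a) (z : ∀ a → B a) (l : ∀ a → List (E a)) →
    PT {Σ A E} (λ (a , e) → encE a e ∙ i a) (λ (a , e) → encodeBool (p a e)) →
    PT {Σ A E} (λ (a , e) → encE a e ∙ i a) (λ (a , e) → encB a (f a e)) →
    PT i (λ a → encB a (z a)) →
    PT i (λ a → encodeList (encE a) (l a)) →
    PT i (λ a → encB a (search (p a) (f a) (z a) (l a)))
  searchᴾ p f z l pp pf pz pl = foldr⁺ᴾ encE encB l z (λ a e b → ifᵇ p a e then f a e else b) pl pz
    (ifᴾ (λ (a , _) → encB a) (λ (a , e , _) → f a e) (λ (_ , _ , b) → b)
      (locallyᴾ {encE = encE} {encB} pp) (locallyᴾ {encE = encE} {encB} pf) (accumulatorᴾ {encE = encE} {encB}))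
    (λ (a , e) → size (encB a (f a e))) (size-bounded pf)
    (λ a e b → either (encB a) (p a e) (f a e) b)
    where
    either : ∀ {Y : Set} (enc : Y → Tree) b x y → size (enc (ifᵇ b then x else y)) ≤ size (enc x) + size (enc y)
    either enc true  x y = m≤m+n _ _
    either enc false x y = m≤n+m _ _

induced : ∀ {n} → Graph n → (vs : List (Fin n)) → Graph (length vs)
adj        (induced G vs) i j = adj G (List.lookup vs i) (List.lookup vs j)
adj-sym    (induced G vs) i j = adj-sym G _ _
adj-irrefl (induced G vs) i   = adj-irrefl G _

nonisolated : Formula 1
nonisolated = ∃̇ 1F ∼ 0F

-- With a relation that always holds, `greedy` is a filter, and its program is available already.
alive : ∀ {n} → Graph n → ℕ → List (Fin n)
alive {n} G k = greedy (λ v → ⟦_⟧ G k nonisolated (v ∷ [])) (λ _ _ → true) (allFin n)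

-- In the environment i ∷ j ∷ ρ these keep the pairs (i , j) other than
-- (ρ₀ , ρ₁), respectively those with i ≠ ρ₀.
otherPair : Formula 4
otherPair = ¬̇ (0F ≐ 2F ∧̇ 1F ≐ 3F)

otherVertex : Formula 3
otherVertex = ¬̇ 0F ≐ 2F

-- The algorithm and its running time

module Reduction (forced : Formula 2) (removable : Formula 1) (refuted : Formula 0) where

  module _ {n : ℕ} where

    removeEdge : Graph n × ℕ → Vec (Fin n) 2 → Graph n × ℕ
    removeEdge (G , k) t = prune G k otherPair t , pred k

    isolate : Graph n × ℕ → Vec (Fin n) 1 → Graph n × ℕ
    isolate (G , k) t = prune G k otherVertex t , k

    record Reduced (s : Graph n × ℕ) : Set where
      constructor reduced
      field
        unforced    : ∀ a b → ¬ Sat (proj₁ s) (proj₂ s) forced (a ∷ b ∷ [])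
        irremovable : ∀ v → ¬ Sat (proj₁ s) (proj₂ s) removable (v ∷ [])

    -- The interface between the algorithm and its correctness: what one call of `step` may do,
    -- irrespective of the order in which the search proceeds.
    data Step (s : Graph n × ℕ) : Graph n × ℕ → Set where
      remove : ∀ a b → Sat (proj₁ s) (proj₂ s) forced (a ∷ b ∷ []) → Step s (removeEdge s (a ∷ b ∷ []))
      delete : ∀ v → Sat (proj₁ s) (proj₂ s) removable (v ∷ []) → Step s (isolate s (v ∷ []))
      stop   : Reduced s → Step s s

  opaque

    step : ∀ {n} → Graph n × ℕ → Graph n × ℕ
    step {n} (G , k) =
      search (λ t → ⟦_⟧ G k forced (t Vec.++ [])) (λ t → removeEdge (G , k) (t Vec.++ []))
        (search (λ t → ⟦_⟧ G k removable (t Vec.++ [])) (λ t → isolate (G , k) (t Vec.++ [])) (G , k) (tuples n 1))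
        (tuples n 2)

    -- The parameter plus the number of nonisolated vertices is at most 2n when k ≤ n, and every
    -- rule lowers this sum. A fixed number of 2n rounds therefore suffices, and the loop is a fold.
    exhaust : ∀ {n} → Graph n × ℕ → Graph n × ℕ
    exhaust {n} s = foldr (λ _ → step) s (allFin n ++ allFin n)

    finish : ∀ {n} → Graph n × ℕ → Instance
    finish (G , k) = ifᵇ ⟦_⟧ G k refuted [] then instance[ paw , 0 ] else instance[ induced G (alive G k) , k ]

    -- A parameter exceeding the order may be too large to be written in unary,
    -- but then the instance is already small enough.
    kernel : Instance → Instance
    kernel I = ifᵇ order I <ᵇ parameter I then I else finish (exhaust (graph I , parameter I))

    step-cases : ∀ {n} (s : Graph n × ℕ) → Step s (step s)
    step-cases {n} s@(G , k) with search-cases (λ t → ⟦_⟧ G k forced (t Vec.++ [])) (λ t → removeEdge (G , k) (t Vec.++ []))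
          (search (λ t → ⟦_⟧ G k removable (t Vec.++ [])) (λ t → isolate (G , k) (t Vec.++ [])) (G , k) (tuples n 1)) (tuples n 2)
    ... | inj₁ ((a ∷ b ∷ []) , t , eq) = subst (Step s) (sym eq) (remove a b (T-does⁻ (sat? G k forced (a ∷ b ∷ [])) t))
    ... | inj₂ (none , eq) with search-cases (λ t → ⟦_⟧ G k removable (t Vec.++ [])) (λ t → isolate (G , k) (t Vec.++ [])) (G , k) (tuples n 1)
    ...   | inj₁ ((v ∷ []) , t , eq′) = subst (Step s) (sym (trans eq eq′)) (delete v (T-does⁻ (sat? G k removable (v ∷ [])) t))
    ...   | inj₂ (none′ , eq′) = subst (Step s) (sym (trans eq eq′)) (stop (reduced
              (λ a b → none (a ∷ b ∷ []) (∈-tuples (a ∷ b ∷ [])) ∘ T-does⁺ (sat? G k forced (a ∷ b ∷ [])))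
              (λ v → none′ (v ∷ []) (∈-tuples (v ∷ [])) ∘ T-does⁺ (sat? G k removable (v ∷ [])))))

    exhaust-iterates : ∀ {n} (s : Graph n × ℕ) → exhaust s ≡ foldr (λ _ → step) s (allFin n ++ allFin n)
    exhaust-iterates s = refl

    finish-cases : ∀ {n} (s : Graph n × ℕ) →
      (Sat (proj₁ s) (proj₂ s) refuted [] × finish s ≡ instance[ paw , 0 ]) ⊎
      (¬ Sat (proj₁ s) (proj₂ s) refuted [] × finish s ≡ instance[ induced (proj₁ s) (alive (proj₁ s) (proj₂ s)) , proj₂ s ])
    finish-cases (G , k) with ⟦_⟧ G k refuted [] | reflects G k refuted []
    ... | true  | ofʸ r  = inj₁ (r , refl)
    ... | false | ofⁿ ¬r = inj₂ (¬r , refl)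

    kernel-cases : ∀ I → (order I < parameter I × kernel I ≡ I) ⊎
                         (parameter I ≤ order I × kernel I ≡ finish (exhaust (graph I , parameter I)))
    kernel-cases I with order I <ᵇ parameter I | <ᵇ-reflects-< (order I) (parameter I)
    ... | true  | ofʸ lt  = inj₁ (lt , refl)
    ... | false | ofⁿ ¬lt = inj₂ (≮⇒≥ ¬lt , refl)

    size-step : ∀ {n} {s t : Graph n × ℕ} → Step s t → size (encodeState t) ≤ 4 + size (encodeState s)
    size-step {s = G , k} (remove a b _) =
      ≤-trans (s≤s (+-mono-≤ (size-restrict G (λ i j → ⟦_⟧ G k otherPair (i ∷ j ∷ a ∷ b ∷ []))) (s≤s (+-mono-≤ (unary k) (size-pred k)))))
        (≤-reflexive (rearrange (size (encodeGraph G)) (size (encodeUnary k)) (size (encodeℕ k))))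
      where
      rearrange : ∀ g u b → suc (g + suc (u + (4 + b))) ≡ 4 + suc (g + suc (u + b))
      rearrange = solve-∀
      unary : ∀ k → size (encodeUnary (pred k)) ≤ size (encodeUnary k)
      unary zero    = ≤-refl
      unary (suc k) = m≤n+m _ 2
    size-step {s = G , k} (delete v _) =
      ≤-trans (s≤s (+-monoˡ-≤ _ (size-restrict G (λ i j → ⟦_⟧ G k otherVertex (i ∷ j ∷ v ∷ []))))) (m≤n+m _ 4)
    size-step (stop _) = m≤n+m _ 4

    encode : (s : Config) → Tree
    encode (n , s) = encodeState s

    emptyᴾ : PT encode (λ s → encodeEnv (s , []))
    emptyᴾ = idᴾ

    at : ∀ {r} {o : Env (r + 0) → Tree} → PT encodeEnv o →
         PT {Σ[ s ∈ Config ] Vec (Fin (proj₁ s)) r} (λ (s , t) → encodeTuple t ∙ encode s) (λ (s , t) → o (s , t Vec.++ []))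
    at p = prependᴾ {s = proj₂} {ρ = λ _ → []} {λ (s , _) → encode s} (headᴾ idᴾ) (tailᴾ idᴾ) ≫ reindexᴾ (λ (s , t) → s , t Vec.++ []) p

    tuplesOfᴾ : ∀ r → PT encode (λ (n , _) → encodeList encodeTuple (tuples n r))
    tuplesOfᴾ r = tuplesᴾ r (emptyᴾ ≫ reindexᴾ (λ s → s , []) verticesᴾ)

    binaryᴾ : ∀ {m} → PT {Env m} encodeEnv (λ ((n , G , k) , ρ) → encodeℕ k)
    binaryᴾ = tailᴾ (tailᴾ stateᴾ)

    unaryPredᴾ : ∀ {A : Set} {i : A → Tree} {k : A → ℕ} → PT i (encodeUnary ∘ k) → PT i (encodeUnary ∘ pred ∘ k)
    unaryPredᴾ {k = k} pk = castᴾ (λ a → tail-pred (k a)) (tailᴾ pk)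
      where
      tail-pred : ∀ k → tail (encodeUnary k) ≡ encodeUnary (pred k)
      tail-pred zero    = refl
      tail-pred (suc k) = refl

    stepᴾ : PT encode (λ (n , s) → encodeState (step s))
    stepᴾ = searchᴾ (λ _ → encodeTuple) (λ (n , _) → encodeState {n})
      (λ (n , G , k) t → ⟦_⟧ G k forced (t Vec.++ [])) (λ (n , s) t → removeEdge s (t Vec.++ []))
      (λ (n , G , k) → search (λ t → ⟦_⟧ G k removable (t Vec.++ [])) (λ t → isolate (G , k) (t Vec.++ [])) (G , k) (tuples n 1))
      (λ (n , _) → tuples n 2)
      (at (formulaᴾ forced)) (at (pruneᴾ otherPair ,ᴾ unaryPredᴾ unaryᴾ ,ᴾ predᴾ (λ ((n , G , k) , ρ) → k) binaryᴾ))
      (searchᴾ (λ _ → encodeTuple) (λ (n , _) → encodeState {n})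
        (λ (n , G , k) t → ⟦_⟧ G k removable (t Vec.++ [])) (λ (n , s) t → isolate s (t Vec.++ [])) proj₂ (λ (n , _) → tuples n 1)
        (at (formulaᴾ removable)) (at (pruneᴾ otherVertex ,ᴾ unaryᴾ ,ᴾ binaryᴾ)) idᴾ (tuplesOfᴾ 1))
      (tuplesOfᴾ 2)

    allFinOfᴾ : PT encode (λ (n , _) → encodeList encodeFin (allFin n))
    allFinOfᴾ = emptyᴾ ≫ reindexᴾ (λ s → s , []) verticesᴾ

    exhaustᴾ : PT encode (λ (n , s) → encodeState (exhaust s))
    exhaustᴾ = foldr⁺ᴾ (λ _ → encodeFin) (λ (n , _) → encodeState {n}) (λ (n , _) → allFin n ++ allFin n) proj₂ (λ _ _ → step)
      (++ᴾ (λ _ → encodeFin) (λ (n , _) → allFin n) (λ (n , _) → allFin n) allFinOfᴾ allFinOfᴾ) idᴾ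
      (accumulatorᴾ {encE = λ _ → encodeFin} {λ (n , _) → encodeState {n}} ≫ reindexᴾ (λ ((n , _) , _ , s) → n , s) stepᴾ)
      (λ _ → 4) (bounded-const 4) (λ _ _ s → size-step (step-cases s))

    aliveᴾ : PT encode (λ (n , G , k) → encodeList encodeFin (alive G k))
    aliveᴾ = greedyᴾ (λ _ → encodeFin) (λ (n , _) → allFin n) (λ (n , G , k) v → ⟦_⟧ G k nonisolated (v ∷ [])) (λ _ _ _ → true)
      allFinOfᴾ (reindexᴾ (λ (s , v) → s , v ∷ []) (formulaᴾ nonisolated)) (constᴾ (nil ∙ nil))

    inducedᴾ : PT encode (λ (n , G , k) → encodeGraph (induced G (alive G k)))
    inducedᴾ = castᴾ (λ (n , G , k) → cong (encodeList (encodeList encodeBool)) (trans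
        (List.map-cong (λ v → over (adj G v) (alive G k)) (alive G k)) (over (λ v → tabulate (adj G v ∘ List.lookup (alive G k))) (alive G k))))
      (mapᴾ (λ _ → encodeFin) (λ (n , G , k) → alive G k) (λ _ → encodeList encodeBool) (λ (n , G , k) v → map (adj G v) (alive G k)) aliveᴾ
        (mapᴾ (λ _ → encodeFin) (λ ((n , G , k) , _) → alive G k) (λ _ → encodeBool) (λ ((n , G , k) , v) w → adj G v w)
          (tailᴾ idᴾ ≫ reindexᴾ proj₁ aliveᴾ)
          ((headᴾ (tailᴾ idᴾ) ,ᴾ headᴾ idᴾ ,ᴾ tailᴾ (tailᴾ idᴾ)) ≫ reindexᴾ (λ ((s , v) , w) → s , v ∷ w ∷ []) (formulaᴾ (0F ∼ 1F)))))
      where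
      over : ∀ {X Y : Set} (f : X → Y) xs → map f xs ≡ tabulate (f ∘ List.lookup xs)
      over f xs = trans (cong (map f) (sym (List.tabulate-lookup xs))) (List.map-tabulate (List.lookup xs) f)

    finishᴾ : PT encode (λ (n , s) → encodeInstance (finish s))
    finishᴾ = ifᴾ (λ _ → encodeInstance) (λ _ → instance[ paw , 0 ]) (λ (n , G , k) → instance[ induced G (alive G k) , k ])
      (emptyᴾ ≫ reindexᴾ (λ s → s , []) (formulaᴾ refuted)) (constᴾ (encodeInstance instance[ paw , 0 ]))
      (inducedᴾ ,ᴾ (emptyᴾ ≫ reindexᴾ (λ s → s , []) binaryᴾ))

    -- One pass over the vertices counts k down in binary and at the same time up in unary. A
    -- positive remainder reveals that k exceeds the order; otherwise the counter ends as k in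
    -- unary.
    countStep : ℕ × ℕ → ℕ × ℕ
    countStep (u , b) = ifᵇ 0 <ᵇ b then (suc u , pred b) else (u , b)

    countdown : ∀ {X : Set} k (xs : List X) → foldr (λ _ → countStep) (0 , k) xs ≡ (length xs ⊓ k , k ∸ length xs)
    countdown k []       = refl
    countdown k (x ∷ xs) rewrite countdown k xs = next (length xs) k
      where
      next : ∀ m k → countStep (m ⊓ k , k ∸ m) ≡ (suc m ⊓ k , k ∸ suc m)
      next zero    zero    = refl
      next zero    (suc k) = refl
      next (suc m) zero    = refl
      next (suc m) (suc k) = lift (next m k) (k ∸ m) refl
        where
        lift : countStep (m ⊓ k , k ∸ m) ≡ (suc m ⊓ k , k ∸ suc m) → ∀ b → k ∸ m ≡ b →
               countStep (suc (m ⊓ k) , k ∸ m) ≡ (suc (suc m ⊓ k) , k ∸ suc m)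
        lift eq zero    b≡ rewrite b≡ = cong (λ (u , b) → suc u , b) eq
        lift eq (suc b) b≡ rewrite b≡ = cong (λ (u , b) → suc u , b) eq

    positiveᴾ : ∀ {A : Set} {i : A → Tree} (k : A → ℕ) → PT i (encodeℕ ∘ k) → PT i (λ a → encodeBool (0 <ᵇ k a))
    positiveᴾ k pk = castᴾ (λ a → cong encodeBool (positive? (k a))) (isNodeᴾ pk)
      where
      positive? : ∀ k → isNode (encodeℕ k) ≡ (0 <ᵇ k)
      positive? zero    = refl
      positive? (suc k) with ℕᵇ.fromℕ (suc k) in eq
      ... | ℕᵇ.zero = case trans (sym (ℕᵇ.toℕ-fromℕ (suc k))) (cong ℕᵇ.toℕ eq) of λ ()
      ... | ℕᵇ.2[1+ _ ] = refl
      ... | ℕᵇ.1+[2 _ ] = refl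

    encodeCount : ℕ × ℕ → Tree
    encodeCount (u , b) = encodeUnary u ∙ encodeℕ b

    countᴾ : PT encodeInstance (λ I → encodeCount (foldr (λ _ → countStep) (0 , parameter I) (allFin (order I))))
    countᴾ = foldr⁺ᴾ {E = λ I → Fin (order I)} {λ _ → ℕ × ℕ} (λ _ → encodeFin) (λ _ → encodeCount) (λ I → allFin (order I)) (λ I → 0 , parameter I) (λ _ _ → countStep)
      (allFinᴾ {G = graph} (headᴾ idᴾ)) (nilᴾ ,ᴾ tailᴾ idᴾ)
      (ifᴾ (λ _ → encodeCount) (λ (_ , _ , u , b) → suc u , pred b) (λ (_ , _ , s) → s)
        (positiveᴾ left (tailᴾ accumulator)) ((nilᴾ ,ᴾ headᴾ accumulator) ,ᴾ predᴾ left (tailᴾ accumulator)) accumulator)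
      (λ _ → 6) (bounded-const 6) (λ _ _ (u , b) → grow u b (0 <ᵇ b))
      where
      left : Σ[ I ∈ Instance ] Fin (order I) × (ℕ × ℕ) → ℕ
      left (_ , _ , _ , b) = b
      accumulator : PT {Σ[ I ∈ Instance ] Fin (order I) × (ℕ × ℕ)} (λ (I , v , s) → encodeFin v ∙ encodeCount s ∙ encodeInstance I) (λ (_ , _ , s) → encodeCount s)
      accumulator = accumulatorᴾ {encE = λ I → encodeFin {order I}} {λ _ → encodeCount}
      rearrange : ∀ u b → suc (suc (suc (u + (4 + b)))) ≡ 6 + suc (u + b)
      rearrange = solve-∀
      grow : ∀ u b c → size (encodeCount (ifᵇ c then (suc u , pred b) else (u , b))) ≤ 6 + size (encodeCount (u , b))
      grow u b true  = ≤-trans (s≤s (s≤s (s≤s (+-monoʳ-≤ _ (size-pred b))))) (≤-reflexive (rearrange _ _))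
      grow u b false = m≤n+m _ 6

    kernelᴾ : PT encodeInstance (encodeInstance ∘ kernel)
    kernelᴾ = splitᴾ (castᴾ (λ I → cong encodeBool (trans (cong (λ (u , b) → 0 <ᵇ b) (count I)) (exceeds (order I) (parameter I)))) (positiveᴾ (λ I → proj₂ (foldr (λ _ → countStep) (0 , parameter I) (allFin (order I)))) (tailᴾ countᴾ)))
      (castᴾ (λ (I , t) → cong encodeInstance (yes-case (order I <ᵇ parameter I) t)) (reindexᴾ proj₁ idᴾ))
      (castᴾ (λ (I , t) → cong encodeInstance (no-case (order I <ᵇ parameter I) t))
        -- In this branch k is at most the order n, so the counter min(n, k) is k itself.
        ((headᴾ idᴾ ,ᴾ castᴾ (λ (I , t) → cong encodeUnary (trans (cong proj₁ (count I)) (full (order I) (parameter I) t))) (headᴾ (reindexᴾ proj₁ countᴾ)) ,ᴾ tailᴾ idᴾ)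
          ≫ reindexᴾ (λ (I , _) → order I , graph I , parameter I) (exhaustᴾ ≫ reindexᴾ (λ (n , s) → n , exhaust s) finishᴾ)))
      where
      count : ∀ I → foldr (λ _ → countStep) (0 , parameter I) (allFin (order I)) ≡ (order I ⊓ parameter I , parameter I ∸ order I)
      count I = trans (countdown (parameter I) (allFin (order I)))
        (cong (λ m → m ⊓ parameter I , parameter I ∸ m) (List.length-tabulate {n = order I} id))
      exceeds : ∀ m k → (0 <ᵇ k ∸ m) ≡ (m <ᵇ k)
      exceeds zero    k       = refl
      exceeds (suc m) zero    = refl
      exceeds (suc m) (suc k) = exceeds m k
      full : ∀ m k → T (not (m <ᵇ k)) → m ⊓ k ≡ k
      full zero    zero    _ = refl
      full (suc m) zero    _ = refl
      full (suc m) (suc k) t = cong suc (full m k t)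
      yes-case : ∀ {x y : Instance} b → T b → x ≡ (ifᵇ b then x else y)
      yes-case true _ = refl
      no-case : ∀ {x y : Instance} b → T (not b) → y ≡ (ifᵇ b then x else y)
      no-case false _ = refl

    polyTime : PolyTimeComputable encodeInstance encodeInstance kernel
    polyTime = program body′ , factor total , degree total , λ I →
      let _ , x , x≤ = whole I in _ , (_ , x , refl) , ≤-trans x≤ (bound total I)
      where
      open Bounded
      body′ : Cmd 1
      body′ = 0F ≔ cons (var 0F) nil ⨾ code kernelᴾ ⨾ 0F ≔ hd (var 0F)
      total : Bounded encodeInstance (λ I → 4 + (time kernelᴾ I + 3))
      total = bounded-+ (bounded-const 4) (bounded-+ (time-bounded kernelᴾ) (bounded-const 3))
      whole : ∀ I → body′ ⊢ encodeInstance I ⇒ encodeInstance (kernel I) within 4 + (time kernelᴾ I + 3)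
      whole I = seq-run (assign-run _) (seq-run (run kernelᴾ I nil) (assign-run _))

-- Booleans and duplicate-free lists

T-intro : ∀ {b} → b ≡ true → T b
T-intro refl = tt

T-elim : ∀ {b} → T b → b ≡ true
T-elim {true} _ = refl

T-∧⁺ : ∀ {a b} → T a → T b → T (a ∧ b)
T-∧⁺ {true} _ t = t

T-∧⁻ : ∀ {a b} → T (a ∧ b) → T a × T b
T-∧⁻ {true} t = tt , t

T-not⁺ : ∀ {b} → ¬ T b → T (not b)
T-not⁺ {true}  ¬t = ¬t tt
T-not⁺ {false} _  = tt

T-not⁻ : ∀ {b} → T (not b) → ¬ T b
T-not⁻ {false} _ ()

unique-length : {X : Set} {xs ys : List X} → Unique xs → (∀ {x} → x ∈ xs → x ∈ ys) → length xs ≤ length ys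
unique-length {xs = []}     _        sub = z≤n
unique-length {xs = x ∷ xs} (x∉ ∷ u) sub with ∈-∃++ (sub (here refl))
... | as , bs , refl = begin
  suc (length xs)                ≤⟨ s≤s (unique-length u sub′) ⟩
  suc (length (as ++ bs))        ≡⟨ cong suc (List.length-++ as) ⟩
  suc (length as + length bs)    ≡⟨ +-suc (length as) (length bs) ⟨
  length as + suc (length bs)    ≡⟨ List.length-++ as ⟨
  length (as ++ x ∷ bs)          ∎
  where
  open ≤-Reasoning
  sub′ : ∀ {y} → y ∈ xs → y ∈ as ++ bs
  sub′ y∈ with ∈-++⁻ as (sub (there y∈))
  ... | inj₁ y∈as         = ∈-++⁺ˡ y∈as
  ... | inj₂ (here refl)  = contradiction refl (All.lookup x∉ y∈)
  ... | inj₂ (there y∈bs) = ∈-++⁺ʳ as y∈bs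

length-filter-split : {X : Set} {P : X → Set} (P? : Decidable P) (xs : List X) →
  length xs ≡ length (filter P? xs) + length (filter (¬? ∘ P?) xs)
length-filter-split P? []       = refl
length-filter-split P? (x ∷ xs) with P? x
... | yes _ = cong suc (length-filter-split P? xs)
... | no _  = trans (cong suc (length-filter-split P? xs)) (sym (+-suc _ _))

-- Two entries that fail P would be in conflict, so the filter loses at most one.
length-filter-allPairs : {X : Set} {P : X → Set} {R : X → X → Set} (P? : Decidable P) {xs : List X} →
  AllPairs R xs → (∀ {x y} → R x y → ¬ P x → ¬ P y → ⊥) → length xs ≤ suc (length (filter P? xs))
length-filter-allPairs P? {xs} rs conflict = begin
  length xs ≡⟨ length-filter-split P? xs ⟩
  length (filter P? xs) + length (filter (¬? ∘ P?) xs)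
    ≤⟨ +-monoʳ-≤ (length (filter P? xs)) (short (AllPairs.filter⁺ (¬? ∘ P?) rs) (All.all-filter (¬? ∘ P?) xs)) ⟩
  length (filter P? xs) + 1 ≡⟨ +-comm _ 1 ⟩
  suc (length (filter P? xs)) ∎
  where
  open ≤-Reasoning
  short : ∀ {ys} → AllPairs _ ys → All _ ys → length ys ≤ 1
  short {[]}        _              _               = z≤n
  short {_ ∷ []}    _              _               = ≤-refl
  short {_ ∷ _ ∷ _} ((r ∷ _) ∷ _)  (¬p ∷ ¬q ∷ _)   = ⊥-elim (conflict r ¬p ¬q)

-- Edge counts

module _ {n : ℕ} where

  edge-sym : (G : Graph n) → ∀ {i j} → Edge G i j → Edge G j i
  edge-sym G {i} {j} = subst T (adj-sym G i j)

  edge-irrefl : (G : Graph n) → ∀ {i} → ¬ Edge G i i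
  edge-irrefl G {i} = subst T (adj-irrefl G i)

  edge? : (G : Graph n) → ∀ i j → Dec (Edge G i j)
  edge? G i j = Bool.T? (adj G i j)

  -- Both orientations of every edge are listed, so that comparisons of edge counts need not ask
  -- which end is smaller. The factor 2 is cancelled by `halve-≤`.
  arcs : Graph n → List (Fin n × Fin n)
  arcs A = edges A ++ map swap (edges A)

  length-arcs : ∀ (A : Graph n) → length (arcs A) ≡ ∣E A ∣ + ∣E A ∣
  length-arcs A = trans (List.length-++ (edges A)) (cong (∣E A ∣ +_) (List.length-map swap (edges A)))

  ∈-edges⁺ : ∀ (A : Graph n) {i j} → toℕ i < toℕ j → Edge A i j → (i , j) ∈ edges A
  ∈-edges⁺ A i<j e = ∈-filter⁺ _ (∈-cartesianProduct⁺ (∈-allFin _) (∈-allFin _)) (i<j , e)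

  ∈-edges⁻ : ∀ (A : Graph n) {i j} → (i , j) ∈ edges A → toℕ i < toℕ j × Edge A i j
  ∈-edges⁻ A ij∈ = proj₂ (∈-filter⁻ _ {xs = cartesianProduct (allFin n) (allFin n)} ij∈)

  ∈-arcs⁺ : ∀ (A : Graph n) {i j} → Edge A i j → (i , j) ∈ arcs A
  ∈-arcs⁺ A {i} {j} e with <-cmp (toℕ i) (toℕ j)
  ... | tri< i<j _ _ = ∈-++⁺ˡ (∈-edges⁺ A i<j e)
  ... | tri≈ _ i≡j _ = contradiction (subst (Edge A i) (sym (Fin.toℕ-injective i≡j)) e) (edge-irrefl A)
  ... | tri> _ _ j<i = ∈-++⁺ʳ (edges A) (∈-map⁺ swap (∈-edges⁺ A j<i (edge-sym A e)))

  ∈-arcs⁻ : ∀ (A : Graph n) {i j} → (i , j) ∈ arcs A → Edge A i j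
  ∈-arcs⁻ A ij∈ with ∈-++⁻ (edges A) ij∈
  ... | inj₁ ij∈ = proj₂ (∈-edges⁻ A ij∈)
  ... | inj₂ ij∈ with ∈-map⁻ swap ij∈
  ...   | _ , ji∈ , refl = edge-sym A (proj₂ (∈-edges⁻ A ji∈))

  arcs-unique : ∀ (A : Graph n) → Unique (arcs A)
  arcs-unique A = Unique.++⁺ edges-unique (Unique.map⁺ (cong swap) edges-unique) opposite
    where
    edges-unique : Unique (edges A)
    edges-unique = Unique.filter⁺ _ (Unique.cartesianProduct⁺ (Unique.allFin⁺ n) (Unique.allFin⁺ n))
    opposite : ∀ {p} → ¬ (p ∈ edges A × p ∈ map swap (edges A))
    opposite (p∈ , p∈′) with ∈-map⁻ swap p∈′
    ... | _ , q∈ , refl = <-asym (proj₁ (∈-edges⁻ A p∈)) (proj₁ (∈-edges⁻ A q∈))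

  arcs-bound : ∀ (A : Graph n) {ps} → Unique ps → (∀ {p} → p ∈ ps → Edge A (proj₁ p) (proj₂ p)) →
               length ps ≤ ∣E A ∣ + ∣E A ∣
  arcs-bound A u sound = subst (_ ≤_) (length-arcs A) (unique-length u (∈-arcs⁺ A ∘ sound))

halve-≤ : ∀ {m n} → m + m ≤ n + n → m ≤ n
halve-≤ {m} {n} le with m ≤? n
... | yes m≤n = m≤n
... | no m≰n  = contradiction le (<⇒≱ (+-mono-< (≰⇒> m≰n) (≰⇒> m≰n)))

∣E∣-injection : ∀ {m n} (A : Graph m) (B : Graph n) (f : Fin m → Fin n) →
  (∀ {i j} → Edge A i j → Edge B (f i) (f j)) →
  (∀ {i i′ j j′} → Edge A i i′ → Edge A j j′ → f i ≡ f j → i ≡ j) → ∣E A ∣ ≤ ∣E B ∣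
∣E∣-injection A B f hom inj = halve-≤ (subst (_≤ _) (trans (List.length-map _ (arcs A)) (length-arcs A))
  (arcs-bound B (unique-map (arcs-unique A) (λ p∈ → p∈)) λ q∈ → let _ , p∈ , eq = ∈-map⁻ _ q∈ in
    subst (λ (i , j) → Edge B i j) (sym eq) (hom (∈-arcs⁻ A p∈))))
  where
  g : _ → _
  g (i , j) = f i , f j
  unique-map : ∀ {ps} → Unique ps → (∀ {p} → p ∈ ps → p ∈ arcs A) → Unique (map g ps)
  unique-map []       _   = []
  unique-map (p∉ ∷ u) sub = All.map⁺ (All.tabulate λ {q} q∈ eq →
      All.lookup p∉ q∈ (cong₂ _,_
        (inj (∈-arcs⁻ A (sub (here refl))) (∈-arcs⁻ A (sub (there q∈))) (cong proj₁ eq))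
        (inj (edge-sym A (∈-arcs⁻ A (sub (here refl)))) (edge-sym A (∈-arcs⁻ A (sub (there q∈)))) (cong proj₂ eq))))
    ∷ unique-map u (sub ∘ there)

∣E∣-mono : ∀ {n} (A B : Graph n) → A ⊆ᴱ B → ∣E A ∣ ≤ ∣E B ∣
∣E∣-mono A B A⊆B = ∣E∣-injection A B id (A⊆B _ _) (λ _ _ → id)

-- Greedy selections are maximal

module _ {X : Set} (p : X → Bool) (r : X → X → Bool) where

  private
    compatible⇒All : ∀ x ys → T (foldr (λ y b → r x y ∧ b) true ys) → All (T ∘ r x) ys
    compatible⇒All x []       _ = []
    compatible⇒All x (y ∷ ys) t = let u , us = T-∧⁻ t in u ∷ compatible⇒All x ys us

    incompatible⇒∃ : ∀ x ys → ¬ T (foldr (λ y b → r x y ∧ b) true ys) → ∃[ y ] y ∈ ys × ¬ T (r x y)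
    incompatible⇒∃ x []       ¬t = ⊥-elim (¬t tt)
    incompatible⇒∃ x (y ∷ ys) ¬t with Bool.T? (r x y)
    ... | no ¬u = y , here refl , ¬u
    ... | yes u = let z , z∈ , ¬v = incompatible⇒∃ x ys (¬t ∘ T-∧⁺ u) in z , there z∈ , ¬v

    accept? : ∀ x ys → Bool
    accept? x ys = p x ∧ foldr (λ y b → r x y ∧ b) true ys

  greedy-⊆ : ∀ xs {x} → x ∈ greedy p r xs → x ∈ xs
  greedy-⊆ (x ∷ xs) y∈ with accept? x (greedy p r xs) | y∈
  ... | true  | here refl = here refl
  ... | true  | there y∈  = there (greedy-⊆ xs y∈)
  ... | false | y∈        = there (greedy-⊆ xs y∈)

  greedy-unique : ∀ {xs} → Unique xs → Unique (greedy p r xs)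
  greedy-unique {[]}     _        = []
  greedy-unique {x ∷ xs} (x∉ ∷ u) with accept? x (greedy p r xs)
  ... | true  = All.tabulate (All.lookup x∉ ∘ greedy-⊆ xs) ∷ greedy-unique u
  ... | false = greedy-unique u

  greedy-sound : ∀ xs → All (T ∘ p) (greedy p r xs)
  greedy-sound []       = []
  greedy-sound (x ∷ xs) with accept? x (greedy p r xs) in eq
  ... | true  = proj₁ (T-∧⁻ (T-intro eq)) ∷ greedy-sound xs
  ... | false = greedy-sound xs

  greedy-pairs : ∀ xs → AllPairs (λ x y → T (r x y)) (greedy p r xs)
  greedy-pairs []       = []
  greedy-pairs (x ∷ xs) with accept? x (greedy p r xs) in eq
  ... | true  = compatible⇒All x _ (proj₂ (T-∧⁻ {p x} (T-intro eq))) ∷ greedy-pairs xs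
  ... | false = greedy-pairs xs

  -- An accepted entry is never dropped, so whatever caused a rejection is still there at the end.
  greedy-maximal : ∀ {xs x} → x ∈ xs → T (p x) →
    x ∈ greedy p r xs ⊎ ∃[ y ] y ∈ greedy p r xs × ¬ T (r x y)
  greedy-maximal {x ∷ xs} (here refl) px with accept? x (greedy p r xs) in eq
  ... | true  = inj₁ (here refl)
  ... | false = inj₂ (incompatible⇒∃ x _ λ t → subst T eq (T-∧⁺ px t))
  greedy-maximal {x ∷ xs} (there y∈) py with accept? x (greedy p r xs) | greedy-maximal y∈ py
  ... | true  | inj₁ y∈           = inj₁ (there y∈)
  ... | true  | inj₂ (z , z∈ , c) = inj₂ (z , there z∈ , c)
  ... | false | found             = found

tuples-unique : ∀ n r → Unique (tuples n r)
tuples-unique n zero    = [] ∷ []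
tuples-unique n (suc r) = Unique.cartesianProductWith⁺ _∷_ (λ { refl → refl , refl }) (Unique.allFin⁺ n) (tuples-unique n r)

module _ {n : ℕ} (G : Graph n) (k : ℕ) {m : ℕ} (r : ℕ) (φ : Formula (r + m)) (ψ : Formula (r + (r + m))) (ρ : Vec (Fin n) m) where

  selection-unique : Unique (selection G k r φ ψ ρ)
  selection-unique = greedy-unique _ _ (tuples-unique n r)

  selection-sound : ∀ {t} → t ∈ selection G k r φ ψ ρ → Sat G k φ (t Vec.++ ρ)
  selection-sound {t} t∈ = T-does⁻ (sat? G k φ (t Vec.++ ρ)) (All.lookup (greedy-sound _ _ (tuples n r)) t∈)

  selection-pairs : AllPairs (λ t s → Sat G k ψ (t Vec.++ (s Vec.++ ρ))) (selection G k r φ ψ ρ)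
  selection-pairs = AllPairs.map (λ {t} {s} → T-does⁻ (sat? G k ψ (t Vec.++ (s Vec.++ ρ)))) (greedy-pairs _ _ (tuples n r))

  selection-maximal : ∀ t → Sat G k φ (t Vec.++ ρ) →
    t ∈ selection G k r φ ψ ρ ⊎ ∃[ s ] s ∈ selection G k r φ ψ ρ × ¬ Sat G k ψ (t Vec.++ (s Vec.++ ρ))
  selection-maximal t sat with greedy-maximal _ _ (∈-tuples t) (T-does⁺ (sat? G k φ (t Vec.++ ρ)) sat)
  ... | inj₁ t∈            = inj₁ t∈
  ... | inj₂ (s , s∈ , ¬c) = inj₂ (s , s∈ , ¬c ∘ T-does⁺ (sat? G k ψ (t Vec.++ (s Vec.++ ρ))))

-- Paws, twins and the reduction rules

module _ {n : ℕ} (G : Graph n) where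

  Paw : (a b c d : Fin n) → Set
  Paw a b c d = Edge G a b × Edge G b c × Edge G a c × Edge G c d × ¬ Edge G a d × ¬ Edge G b d

  Triangular : Fin n → Set
  Triangular v = ∃[ b ] ∃[ c ] Edge G v b × Edge G v c × Edge G b c

  Twin : Fin n → Fin n → Set
  Twin u v = ∀ z → (Edge G u z → Edge G v z) × (Edge G v z → Edge G u z)

paw-formula : ∀ {m} (a b c d : Fin m) → Formula m
paw-formula a b c d = a ∼ b ∧̇ b ∼ c ∧̇ a ∼ c ∧̇ c ∼ d ∧̇ ¬̇ a ∼ d ∧̇ ¬̇ b ∼ d

triangular : ∀ {m} → Fin m → Formula m
triangular v = ∃̇ ∃̇ (suc (suc v) ∼ 1F ∧̇ suc (suc v) ∼ 0F ∧̇ 1F ∼ 0F)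

twin : ∀ {m} → Fin m → Fin m → Formula m
twin u v = ∀̇ ((suc u ∼ 0F ⇒̇ suc v ∼ 0F) ∧̇ (suc v ∼ 0F ⇒̇ suc u ∼ 0F))

always : ∀ {m} → Formula (suc m)
always = 0F ≐ 0F

pendant-rule : Formula 1
pendant-rule = ¬̇ triangular 0F ∧̇ (∀̇ (1F ∼ 0F ⇒̇ triangular 0F ⇒̇ many 1 (1F ∼ 0F ∧̇ ¬̇ triangular 0F) always))

twin-rule : Formula 1
twin-rule = many 1 (twin 0F 1F) always

-- u ∼ v and N(u) ∪ twins(u) = N(v) ∪ twins(v)
same-block : Formula 2
same-block = 1F ∼ 0F ∧̇ (∀̇ (1F ∼ 0F ⇒̇ 2F ∼ 0F ∨̇ twin 0F 2F)) ∧̇ (∀̇ (2F ∼ 0F ⇒̇ 1F ∼ 0F ∨̇ twin 0F 1F))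

-- Demanding pairwise adjacency makes this a count of parts: twins are nonadjacent, so no part
-- contributes two vertices.
block-rule : Formula 1
block-rule = many 1 same-block (0F ∼ 1F)

-- N(v) ∪ twins(v) is a complete multipartite component.
component-rule : Formula 1
component-rule =
     (∀̇ ∀̇ (2F ∼ 1F ∧̇ 1F ∼ 0F ⇒̇ 2F ∼ 0F ∨̇ twin 0F 2F))
  ∧̇ (∀̇ ∀̇ ∀̇ (3F ∼ 2F ∧̇ 3F ∼ 1F ∧̇ 3F ∼ 0F ∧̇ 2F ∼ 0F ⇒̇ 2F ∼ 1F ∨̇ 1F ∼ 0F))

-- The vertex has to be nonisolated so that isolating it is progress.
removable : Formula 1
removable = nonisolated ∧̇ (pendant-rule ∨̇ twin-rule ∨̇ block-rule ∨̇ component-rule)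

member : ∀ {m} → (v a b c d : Fin m) → Formula m
member v a b c d = v ≐ a ∨̇ v ≐ b ∨̇ v ≐ c ∨̇ v ≐ d

-- Quadruples (0,1,2,3) forming a paw that contains both 4 and 5, unless 4 = 5.
paw-through : Formula 6
paw-through = paw-formula 0F 1F 2F 3F ∧̇ (4F ≐ 5F ∨̇ member 4F 0F 1F 2F 3F ∧̇ member 5F 0F 1F 2F 3F)

-- The quadruples (0,1,2,3) and (4,5,6,7) share an edge different from {8,9}.
share-edge : Formula 10
share-edge = ∃̇ ∃̇ (1F ∼ 0F
  ∧̇ member 1F 2F 3F 4F 5F ∧̇ member 0F 2F 3F 4F 5F
  ∧̇ member 1F 6F 7F 8F 9F ∧̇ member 0F 6F 7F 8F 9F
  ∧̇ ¬̇ (1F ≐ suc 9F ∧̇ 0F ≐ suc (suc 9F)) ∧̇ ¬̇ (1F ≐ suc (suc 9F) ∧̇ 0F ≐ suc 9F))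

-- On the diagonal the pair imposes no condition on the paws and exempts no edge, so there the
-- formula speaks of edge-disjoint paws.
overfull : Formula 2
overfull = many 4 paw-through (¬̇ share-edge)

-- Removing an edge is paid for by the parameter, which must be positive. An overfull pair at k = 0
-- is left to `refuted`.
forced : Formula 2
forced = positive ∧̇ 0F ∼ 1F ∧̇ overfull

refuted : Formula 0
refuted = ∃̇ ∃̇ overfull

-- Paws as six adjacency conditions

module _ {n : ℕ} (H : Graph n) where

  paw-free⁺ : (∀ {a b c d} → ¬ Paw H a b c d) → PawFree H
  paw-free⁺ none (f , _ , iso) = none
    ( present 0F 1F refl , present 1F 2F refl , present 0F 2F refl , present 2F 3F refl
    , absent 0F 3F refl , absent 1F 3F refl)
    where
    present : ∀ i j → pawAdj i j ≡ true → Edge H (f i) (f j)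
    present i j eq = T-intro (trans (iso i j) eq)
    absent : ∀ i j → pawAdj i j ≡ false → ¬ Edge H (f i) (f j)
    absent i j eq = subst T (trans (iso i j) eq)

  -- The six conditions make the four vertices distinct: adjacent ones differ, d is not a because b
  -- is adjacent to a only, and d is not b because a is adjacent to b only.
  paw-free⁻ : PawFree H → ∀ {a b c d} → ¬ Paw H a b c d
  paw-free⁻ free {a} {b} {c} {d} (ab , bc , ac , cd , ¬ad , ¬bd) = free (f , injective , iso)
    where
    f : Fin 4 → Fin n
    f = lookup (a ∷ b ∷ c ∷ d ∷ [])
    nonadjacent : ∀ {i j} → ¬ Edge H i j → adj H i j ≡ false
    nonadjacent {i} {j} ¬e with adj H i j
    ... | true  = ⊥-elim (¬e tt)
    ... | false = refl
    distinct : ∀ {i j} → Edge H i j → i ≡ j → ⊥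
    distinct e refl = edge-irrefl H e
    a≢d : a ≡ d → ⊥
    a≢d refl = ¬bd (edge-sym H ab)
    b≢d : b ≡ d → ⊥
    b≢d refl = ¬ad ab
    injective : ∀ {i j} → f i ≡ f j → i ≡ j
    injective {0F} {0F} _  = refl
    injective {0F} {1F} eq = ⊥-elim (distinct ab eq)
    injective {0F} {2F} eq = ⊥-elim (distinct ac eq)
    injective {0F} {3F} eq = ⊥-elim (a≢d eq)
    injective {1F} {0F} eq = ⊥-elim (distinct ab (sym eq))
    injective {1F} {1F} _  = refl
    injective {1F} {2F} eq = ⊥-elim (distinct bc eq)
    injective {1F} {3F} eq = ⊥-elim (b≢d eq)
    injective {2F} {0F} eq = ⊥-elim (distinct ac (sym eq))
    injective {2F} {1F} eq = ⊥-elim (distinct bc (sym eq))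
    injective {2F} {2F} _  = refl
    injective {2F} {3F} eq = ⊥-elim (distinct cd eq)
    injective {3F} {0F} eq = ⊥-elim (a≢d (sym eq))
    injective {3F} {1F} eq = ⊥-elim (b≢d (sym eq))
    injective {3F} {2F} eq = ⊥-elim (distinct cd (sym eq))
    injective {3F} {3F} _  = refl
    flip-adj : ∀ {i j x} → adj H i j ≡ x → adj H j i ≡ x
    flip-adj {i} {j} = trans (adj-sym H j i)
    iso : ∀ i j → adj H (f i) (f j) ≡ pawAdj i j
    iso 0F 0F = adj-irrefl H a
    iso 0F 1F = T-elim ab
    iso 0F 2F = T-elim ac
    iso 0F 3F = nonadjacent ¬ad
    iso 1F 0F = flip-adj (T-elim ab)
    iso 1F 1F = adj-irrefl H b
    iso 1F 2F = T-elim bc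
    iso 1F 3F = nonadjacent ¬bd
    iso 2F 0F = flip-adj (T-elim ac)
    iso 2F 1F = flip-adj (T-elim bc)
    iso 2F 2F = adj-irrefl H c
    iso 2F 3F = T-elim cd
    iso 3F 0F = flip-adj (nonadjacent ¬ad)
    iso 3F 1F = flip-adj (nonadjacent ¬bd)
    iso 3F 2F = flip-adj (T-elim cd)
    iso 3F 3F = adj-irrefl H d

module _ {m n : ℕ} (H : Graph m) (H′ : Graph n) (r : Fin m → Fin n) (P : Fin m → Set)
         (to : ∀ {x y} → P x → P y → Edge H x y → Edge H′ (r x) (r y))
         (from : ∀ {x y} → P x → P y → Edge H′ (r x) (r y) → Edge H x y) where

  -- A paw is described by adjacencies alone, so a map that preserves and reflects them carries paws
  -- to paws even when it is not injective, as in the replacement of v by a twin.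
  paw-map : ∀ {a b c d} → P a → P b → P c → P d → Paw H a b c d → Paw H′ (r a) (r b) (r c) (r d)
  paw-map pa pb pc pd (ab , bc , ac , cd , ¬ad , ¬bd) =
    to pa pb ab , to pb pc bc , to pa pc ac , to pc pd cd , ¬ad ∘ from pa pd , ¬bd ∘ from pb pd

module _ {n : ℕ} (G : Graph n) where

  keep : {P : Fin n → Fin n → Set} → (∀ i j → Dec (P i j)) → Graph n
  keep P? = restrict G λ i j → does (P? i j)

  module _ {P : Fin n → Fin n → Set} (P? : ∀ i j → Dec (P i j)) {i j : Fin n} where

    keep⁺ : Edge G i j → P i j → P j i → Edge (keep P?) i j
    keep⁺ e p q = T-∧⁺ e (T-∧⁺ (T-does⁺ (P? i j) p) (T-does⁺ (P? j i) q))

    keep⁻ : Edge (keep P?) i j → Edge G i j × P i j × P j i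
    keep⁻ e = let e , pq = T-∧⁻ e in let p , q = T-∧⁻ pq in e , T-does⁻ (P? i j) p , T-does⁻ (P? j i) q

  module _ (A : Graph n) {i j : Fin n} where

    ─⁺ : Edge G i j → ¬ Edge A i j → Edge (G ─ A) i j
    ─⁺ e ¬a = T-∧⁺ e (T-not⁺ ¬a)

    ─⁻ : Edge (G ─ A) i j → Edge G i j × ¬ Edge A i j
    ─⁻ e = let e , ¬a = T-∧⁻ e in e , T-not⁻ ¬a

-- Vertices untouched by a solution

Solvable : ∀ {n} → Graph n → ℕ → Set
Solvable G k = YesInstance instance[ G , k ]

module _ {n : ℕ} (A : Graph n) where

  untouched? : ∀ u → Dec (∀ w → ¬ Edge A u w)
  untouched? u = Fin.all? λ w → ¬? (edge? A u w)

  -- At most k edges have at most 2k ends, so at least four out of 2k + 4 vertices are avoided.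
  length-untouched : ∀ {k us} → ∣E A ∣ ≤ k → Unique us → threshold k < length us →
                     4 ≤ length (filter untouched? us)
  length-untouched {k} {us} A≤k uniq large = +-cancelˡ-≤ (k + k) 4 _ (begin
    k + k + 4                ≡⟨ move k ⟩
    suc (threshold k)        ≤⟨ large ⟩
    length us                ≡⟨ length-filter-split untouched? us ⟩
    length (filter untouched? us) + length (filter (¬? ∘ untouched?) us)
      ≤⟨ +-monoʳ-≤ (length (filter untouched? us)) (≤-trans (unique-length (Unique.filter⁺ _ uniq) touched) ends) ⟩
    length (filter untouched? us) + (k + k) ≡⟨ +-comm (length (filter untouched? us)) (k + k) ⟩
    k + k + length (filter untouched? us) ∎)
    where
    open ≤-Reasoning
    move : ∀ k → k + k + 4 ≡ suc (k + (k + 3))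
    move = solve-∀
    ends : length (map proj₁ (arcs A)) ≤ k + k
    ends = ≤-trans (≤-reflexive (trans (List.length-map proj₁ (arcs A)) (length-arcs A))) (+-mono-≤ A≤k A≤k)
    touched : ∀ {u} → u ∈ filter (¬? ∘ untouched?) us → u ∈ map proj₁ (arcs A)
    touched {u} u∈ with Fin.any? (edge? A u)
    ... | yes (w , e) = ∈-map⁺ proj₁ (∈-arcs⁺ A e)
    ... | no ¬e       = contradiction (λ w e → ¬e (w , e)) (proj₂ (∈-filter⁻ (¬? ∘ untouched?) {xs = us} u∈))

  -- Among two untouched vertices at most one is v.
  untouched-other : ∀ {k us} → ∣E A ∣ ≤ k → Unique us → threshold k < length us →
                    ∀ v → ∃[ u ] u ∈ us × u ≢ v × (∀ w → ¬ Edge A u w)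
  untouched-other {k} {us} A≤k uniq large v
    with filter untouched? us in eq | length-untouched A≤k uniq large | Unique.filter⁺ untouched? uniq
  ... | u ∷ w ∷ _ | _ | (u≢w ∷ _) ∷ _ = choose (u Fin.≟ v)
    where
    found : ∀ {x} → x ∈ filter untouched? us → x ∈ us × (∀ w → ¬ Edge A x w)
    found = ∈-filter⁻ untouched? {xs = us}
    choose : Dec (u ≡ v) → ∃[ u ] u ∈ us × u ≢ v × (∀ w → ¬ Edge A u w)
    choose (no u≢v)   = let u∈ , free = found (subst (u ∈_) (sym eq) (here refl)) in u , u∈ , u≢v , free
    choose (yes refl) = let w∈ , free = found (subst (w ∈_) (sym eq) (there (here refl))) in w , w∈ , u≢w ∘ sym , free
  ... | u ∷ [] | s≤s () | _
  ... | [] | () | _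

module _ {n : ℕ} (G : Graph n) (k : ℕ) {m : ℕ} (φ : Formula (suc m)) (ψ : Formula (suc (suc m))) (ρ : Vec (Fin n) m) where

  picks : List (Fin n)
  picks = map Vec.head (selection G k 1 φ ψ ρ)

  private
    head-injective : ∀ {t s : Vec (Fin n) 1} → Vec.head t ≡ Vec.head s → t ≡ s
    head-injective {_ ∷ []} {_ ∷ []} refl = refl

  length-picks : length picks ≡ length (selection G k 1 φ ψ ρ)
  length-picks = List.length-map Vec.head (selection G k 1 φ ψ ρ)

  picks-unique : Unique picks
  picks-unique = Unique.map⁺ head-injective (selection-unique G k 1 φ ψ ρ)

  picks-sound : ∀ {u} → u ∈ picks → Sat G k φ (u ∷ ρ)
  picks-sound u∈ with ∈-map⁻ Vec.head u∈
  ... | (_ ∷ []) , t∈ , refl = selection-sound G k 1 φ ψ ρ t∈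

  picks-pairs : AllPairs (λ u w → Sat G k ψ (u ∷ w ∷ ρ)) picks
  picks-pairs = AllPairs.map⁺ (AllPairs.map (λ { {_ ∷ []} {_ ∷ []} → id }) (selection-pairs G k 1 φ ψ ρ))

  picks-maximal : ∀ u → Sat G k φ (u ∷ ρ) → u ∈ picks ⊎ ∃[ w ] w ∈ picks × ¬ Sat G k ψ (u ∷ w ∷ ρ)
  picks-maximal u sat with selection-maximal G k 1 φ ψ ρ (u ∷ []) sat
  ... | inj₁ u∈                   = inj₁ (∈-map⁺ Vec.head u∈)
  ... | inj₂ ((w ∷ []) , w∈ , ¬r) = inj₂ (w , ∈-map⁺ Vec.head w∈ , ¬r)

-- Soundness of the reduction rules

allPairs-with : {X : Set} {P : X → Set} {R : X → X → Set} {xs : List X} →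
                All P xs → AllPairs R xs → AllPairs (λ x y → P x × P y × R x y) xs
allPairs-with []       []       = []
allPairs-with (p ∷ ps) (r ∷ rs) = All.zipWith (λ (q , r) → p , q , r) (ps , r) ∷ allPairs-with ps rs

module _ {n : ℕ} (G : Graph n) (k : ℕ) (v : Fin n) where

  infixl 25 _∖v

  _∖v : Graph n → Graph n
  A ∖v = prune A k otherVertex (v ∷ [])

  module _ (A : Graph n) {i j : Fin n} where

    ∖v⁺ : Edge A i j → i ≢ v → j ≢ v → Edge (A ∖v) i j
    ∖v⁺ = keep⁺ A (λ i j → sat? A k otherVertex (i ∷ j ∷ v ∷ []))

    ∖v⁻ : Edge (A ∖v) i j → Edge A i j × i ≢ v × j ≢ v
    ∖v⁻ = keep⁻ A (λ i j → sat? A k otherVertex (i ∷ j ∷ v ∷ []))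

  -- Every vertex of a paw has a neighbour, so a paw left after isolating v avoids v and is already
  -- a paw of G - A.
  delete-solvable : Solvable G k → Solvable (G ∖v) k
  delete-solvable (A , A⊆G , A≤k , free) =
    A ∖v ,
    (λ i j e → let e , i≢v , j≢v = ∖v⁻ A e in ∖v⁺ G (A⊆G i j e) i≢v j≢v) ,
    ≤-trans (∣E∣-mono (A ∖v) A λ i j e → proj₁ (∖v⁻ A e)) A≤k ,
    paw-free⁺ (G ∖v ─ A ∖v) λ p@(ab , bc , ac , cd , _) →
      let ≢v = λ {x} {y} e → proj₂ (∖v⁻ G {x} {y} (proj₁ (─⁻ (G ∖v) (A ∖v) e))) in
      paw-free⁻ (G ─ A) free (paw-map (G ∖v ─ A ∖v) (G ─ A) id (_≢ v) to from (proj₁ (≢v ab)) (proj₁ (≢v bc)) (proj₁ (≢v cd)) (proj₂ (≢v cd)) p)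
    where
    to : ∀ {x y} → x ≢ v → y ≢ v → Edge (G ∖v ─ A ∖v) x y → Edge (G ─ A) x y
    to x≢v y≢v e = let e , ¬a = ─⁻ (G ∖v) (A ∖v) e in ─⁺ G A (proj₁ (∖v⁻ G e)) λ a → ¬a (∖v⁺ A a x≢v y≢v)
    from : ∀ {x y} → x ≢ v → y ≢ v → Edge (G ─ A) x y → Edge (G ∖v ─ A ∖v) x y
    from x≢v y≢v e = let e , ¬a = ─⁻ G A e in ─⁺ (G ∖v) (A ∖v) (∖v⁺ G e x≢v y≢v) (¬a ∘ proj₁ ∘ ∖v⁻ A)

  module Restore (A : Graph n) (A⊆G∖v : A ⊆ᴱ (G ∖v)) (A≤k : ∣E A ∣ ≤ k) (free : PawFree (G ∖v ─ A)) where

    H′ : Graph n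
    H′ = G ∖v ─ A

    A⊆G : A ⊆ᴱ G
    A⊆G i j a = proj₁ (∖v⁻ G (A⊆G∖v i j a))

    v-untouched : ∀ {w} → ¬ Edge A v w
    v-untouched a = proj₁ (proj₂ (∖v⁻ G (A⊆G∖v _ _ a))) refl

    H′⁺ : ∀ {x y} → Edge G x y → x ≢ v → y ≢ v → ¬ Edge A x y → Edge H′ x y
    H′⁺ e x≢v y≢v ¬a = ─⁺ (G ∖v) A (∖v⁺ G e x≢v y≢v) ¬a

    H′⁻ : ∀ {x y} → Edge H′ x y → Edge G x y × x ≢ v × y ≢ v × ¬ Edge A x y
    H′⁻ e = let e , ¬a = ─⁻ (G ∖v) A e in let e , x≢v , y≢v = ∖v⁻ G e in e , x≢v , y≢v , ¬a

    restored : PawFree (G ─ A) → Solvable G k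
    restored free = A , A⊆G , A≤k , free

    away-from-v : ∀ {a b c d} → a ≢ v → b ≢ v → c ≢ v → d ≢ v → ¬ Paw (G ─ A) a b c d
    away-from-v a≢v b≢v c≢v d≢v p = paw-free⁻ H′ free (paw-map (G ─ A) H′ id (_≢ v)
      (λ x≢v y≢v e → let e , ¬a = ─⁻ G A e in H′⁺ e x≢v y≢v ¬a)
      (λ _ _ e → let e , _ , _ , ¬a = H′⁻ e in ─⁺ G A e ¬a) a≢v b≢v c≢v d≢v p)

    -- v could only be the pendant vertex of a new paw, but a further
    -- triangle-free neighbour of the centre would already be pendant in H′.
    pendant : Sat G k pendant-rule (v ∷ []) → PawFree (G ─ A)
    pendant (¬triangular , crowded) = paw-free⁺ (G ─ A) impossible
      where
      E : ∀ {x y} → Edge (G ─ A) x y → Edge G x y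
      E = proj₁ ∘ ─⁻ G A
      impossible : ∀ {a b c d} → ¬ Paw (G ─ A) a b c d
      impossible {a} {b} {c} {d} p@(ab , bc , ac , cd , _) with d Fin.≟ v
      ... | no d≢v = away-from-v
              (λ { refl → ¬triangular (b , c , E ab , E ac , E bc) })
              (λ { refl → ¬triangular (a , c , edge-sym G (E ab) , E bc , E ac) })
              (λ { refl → ¬triangular (a , b , edge-sym G (E ac) , edge-sym G (E bc) , E ab) }) d≢v p
      ... | yes refl = paw-free⁻ H′ free
              ( H′⁺ (E ab) a≢v b≢v (proj₂ (─⁻ G A ab)) , H′⁺ (E bc) b≢v c≢v (proj₂ (─⁻ G A bc))
              , H′⁺ (E ac) a≢v c≢v (proj₂ (─⁻ G A ac))
              , H′⁺ cu c≢v u≢v (λ a → u-free _ (edge-sym A a))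
              , (λ au → ¬triangular-u (a , c , edge-sym G (proj₁ (H′⁻ au)) , edge-sym G cu , E ac))
              , (λ bu → ¬triangular-u (b , c , edge-sym G (proj₁ (H′⁻ bu)) , edge-sym G cu , E bc)) )
        where
        a≢v : a ≢ v
        a≢v refl = ¬triangular (b , c , E ab , E ac , E bc)
        b≢v : b ≢ v
        b≢v refl = ¬triangular (a , c , edge-sym G (E ab) , E bc , E ac)
        c≢v : c ≢ v
        c≢v refl = edge-irrefl G (E cd)
        outer : Formula 3
        outer = 1F ∼ 0F ∧̇ ¬̇ triangular 0F
        us : List (Fin n)
        us = picks G k outer always (c ∷ v ∷ [])
        many-outer : threshold k < length us
        many-outer = subst (threshold k <_) (sym (length-picks G k outer always (c ∷ v ∷ [])))
          (crowded c (edge-sym G (E cd)) (a , b , edge-sym G (E ac) , edge-sym G (E bc) , E ab))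
        other : ∃[ u ] u ∈ us × u ≢ v × (∀ w → ¬ Edge A u w)
        other = untouched-other A A≤k (picks-unique G k outer always (c ∷ v ∷ [])) many-outer v
        u = proj₁ other
        u≢v = proj₁ (proj₂ (proj₂ other))
        u-free = proj₂ (proj₂ (proj₂ other))
        cu : Edge G c u
        cu = proj₁ (picks-sound G k outer always (c ∷ v ∷ []) (proj₁ (proj₂ other)))
        ¬triangular-u : ¬ Triangular G u
        ¬triangular-u = proj₂ (picks-sound G k outer always (c ∷ v ∷ []) (proj₁ (proj₂ other)))

    -- Replacing v by an untouched twin turns a paw through v into one of H′;
    -- the two cannot both lie on a paw since the replacement preserves adjacency.
    twins : Sat G k twin-rule (v ∷ []) → PawFree (G ─ A)
    twins large = paw-free⁺ (G ─ A) λ {a} {b} {c} {d} p → paw-free⁻ H′ free {r a} {r b} {r c} {r d}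
      (paw-map (G ─ A) H′ r (λ _ → ⊤) (λ _ _ → to) (λ _ _ → from) tt tt tt tt p)
      where
      other : ∃[ u ] u ∈ picks G k (twin 0F 1F) always (v ∷ []) × u ≢ v × (∀ w → ¬ Edge A u w)
      other = untouched-other A A≤k (picks-unique G k (twin 0F 1F) always (v ∷ []))
        (subst (threshold k <_) (sym (length-picks G k (twin 0F 1F) always (v ∷ []))) large) v
      u = proj₁ other
      u≢v = proj₁ (proj₂ (proj₂ other))
      u-free = proj₂ (proj₂ (proj₂ other))
      u-twin : Twin G u v
      u-twin = picks-sound G k (twin 0F 1F) always (v ∷ []) (proj₁ (proj₂ other))
      r : Fin n → Fin n
      r x with x Fin.≟ v
      ... | yes _ = u
      ... | no _  = x
      to : ∀ {x y} → Edge (G ─ A) x y → Edge H′ (r x) (r y)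
      to {x} {y} e with x Fin.≟ v | y Fin.≟ v | ─⁻ G A e
      ... | yes refl | yes refl | e , _  = ⊥-elim (edge-irrefl G e)
      ... | yes refl | no y≢v   | e , _  = H′⁺ (proj₂ (u-twin y) e) u≢v y≢v (u-free y)
      ... | no x≢v   | yes refl | e , _  = H′⁺ (edge-sym G (proj₂ (u-twin x) (edge-sym G e))) x≢v u≢v (u-free x ∘ edge-sym A)
      ... | no x≢v   | no y≢v   | e , ¬a = H′⁺ e x≢v y≢v ¬a
      from : ∀ {x y} → Edge H′ (r x) (r y) → Edge (G ─ A) x y
      from {x} {y} e with x Fin.≟ v | y Fin.≟ v | H′⁻ e
      ... | yes refl | yes refl | e , _ = ⊥-elim (edge-irrefl G e)
      ... | yes refl | no y≢v   | e , _ = ─⁺ G A (proj₁ (u-twin y) e) v-untouched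
      ... | no x≢v   | yes refl | e , _ = ─⁺ G A (edge-sym G (proj₁ (u-twin x) (edge-sym G e))) (v-untouched ∘ edge-sym A)
      ... | no x≢v   | no y≢v   | e , _ , _ , ¬a = ─⁺ G A e ¬a

    -- In the repaired graph these vertices form a complete multipartite component.
    Block : Fin n → Set
    Block x = Edge G v x ⊎ Twin G x v

    twin? : ∀ x → Dec (Twin G x v)
    twin? x = sat? G k (twin 0F 1F) (x ∷ v ∷ [])

    block? : ∀ x → Dec (Block x)
    block? x = edge? G v x ⊎-dec twin? x

    v-block : Block v
    v-block = inj₂ λ _ → id , id

    neighbour-not-twin : ∀ {x} → Edge G v x → ¬ Twin G x v
    neighbour-not-twin {x} vx tw = edge-irrefl G (proj₂ (tw x) vx)

    neighbour≢v : ∀ {x} → Edge G v x → x ≢ v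
    neighbour≢v vx refl = edge-irrefl G vx

    module _ (B : Graph n) (B⊆A : B ⊆ᴱ A)
      (B-outside : ∀ {x y} → ¬ Block x → ¬ Block y → Edge A x y → Edge B x y)
      (B-twins : ∀ {x y} → Twin G x v → ¬ Edge B x y)
      (closed : ∀ {x y} → Edge G v x → Edge (G ─ B) x y → Block y)
      (multipartite : ∀ {x y z} → Edge G v x → Edge G v y → Edge G v z →
        Edge (G ─ B) x z → Edge (G ─ B) x y ⊎ Edge (G ─ B) y z) where

      private
        H : Graph n
        H = G ─ B

        H⊆G : ∀ {x y} → Edge H x y → Edge G x y
        H⊆G = proj₁ ∘ ─⁻ G B

        twin-edge : ∀ {x y} → Twin G x v → Edge G x y → Edge H x y
        twin-edge tw e = ─⁺ G B e (B-twins tw)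

        block-closed : ∀ {x y} → Block x → Edge H x y → Block y
        block-closed (inj₁ vx) e = closed vx e
        block-closed (inj₂ tw) e = inj₁ (proj₁ (tw _) (H⊆G e))

        block-multipartite : ∀ {x y z} → Block x → Block y → Block z → Edge H x z → Edge H x y ⊎ Edge H y z
        block-multipartite (inj₁ vx) (inj₁ vy) (inj₁ vz) e = multipartite vx vy vz e
        block-multipartite (inj₁ vx) (inj₁ vy) (inj₂ tz) e = inj₂ (edge-sym H (twin-edge tz (proj₂ (tz _) vy)))
        block-multipartite (inj₁ vx) (inj₂ ty) _         e = inj₁ (edge-sym H (twin-edge ty (proj₂ (ty _) vx)))
        block-multipartite (inj₂ tx) (inj₁ vy) _         e = inj₁ (twin-edge tx (proj₂ (tx _) vy))
        block-multipartite (inj₂ tx) (inj₂ ty) _         e = inj₂ (twin-edge ty (proj₂ (ty _) (proj₁ (tx _) (H⊆G e))))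

        -- If the centre lay in the block, closedness would put the whole paw there. But d is
        -- adjacent to neither end of the edge ab, which is impossible in a complete multipartite
        -- graph.
        centre-outside : ∀ {a b c d} → Paw H a b c d → ¬ Block c
        centre-outside (ab , bc , ac , cd , ¬ad , ¬bd) cB =
          let aB = block-closed cB (edge-sym H ac)
              bB = block-closed cB (edge-sym H bc)
          in [ ¬ad , ¬bd ∘ edge-sym H ]′ (block-multipartite aB (block-closed cB cd) bB ab)

        outside : ∀ {a b c d} → ¬ Paw H a b c d
        outside {a} {b} {c} {d} p@(ab , bc , ac , cd , _) = paw-free⁻ H′ free (paw-map H H′ id (¬_ ∘ Block) to from
          (λ aB → cO (block-closed aB ac)) (λ bB → cO (block-closed bB bc)) cO (λ dB → cO (block-closed dB (edge-sym H cd))) p)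
          where
          cO = centre-outside p
          to : ∀ {x y} → ¬ Block x → ¬ Block y → Edge H x y → Edge H′ x y
          to ¬x ¬y e = let e , ¬b = ─⁻ G B e in
            H′⁺ e (λ { refl → ¬x v-block }) (λ { refl → ¬y v-block }) (¬b ∘ B-outside ¬x ¬y)
          from : ∀ {x y} → ¬ Block x → ¬ Block y → Edge H′ x y → Edge H x y
          from _ _ e = let e , _ , _ , ¬a = H′⁻ e in ─⁺ G B e (¬a ∘ B⊆A _ _)

      -- A paw of G - B has its centre outside the block and, by closedness, its other vertices as
      -- well. Outside the block B agrees with A, and v lies in the block, so the paw would survive
      -- in `H′`.
      block-restored : Solvable G k
      block-restored = B , (λ i j → A⊆G i j ∘ B⊆A i j) , ≤-trans (∣E∣-mono B A B⊆A) A≤k , paw-free⁺ (G ─ B) outside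

    -- The solution gives up all its edges with an end in the block. The component then looks as in
    -- G, where the rule guarantees that it is closed and complete multipartite.
    component : Sat G k component-rule (v ∷ []) → Solvable G k
    component (closed , multipartite) = block-restored (keep A O?)
      (λ _ _ → proj₁ ∘ keep⁻ A O?) (λ ¬x ¬y a → keep⁺ A O? a ¬x ¬y)
      (λ tw b → proj₁ (proj₂ (keep⁻ A O? b)) (inj₂ tw))
      (λ vx e → closed _ _ (vx , proj₁ (─⁻ G (keep A O?) e)))
      (λ vx vy vz e → [ inj₁ ∘ whole vx , inj₂ ∘ whole vy ]′ (multipartite _ _ _ (vx , vy , vz , proj₁ (─⁻ G (keep A O?) e))))
      where
      O? : ∀ i (j : Fin n) → Dec (¬ Block i)
      O? i _ = ¬? (block? i)
      whole : ∀ {x y} → Edge G v x → Edge G x y → Edge (G ─ keep A O?) x y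
      whole vx e = ─⁺ G (keep A O?) e λ b → proj₁ (proj₂ (keep⁻ A O? b)) (inj₁ vx)

    -- With at least four untouched parts, any three neighbours of v have a
    -- common neighbour among them, which completes a violation of closedness
    -- or multipartiteness to a paw of H′.
    block : Sat G k block-rule (v ∷ []) → Solvable G k
    block large = block-restored (keep A O?)
      (λ _ _ → proj₁ ∘ keep⁻ A O?) (λ ¬x ¬y a → keep⁺ A O? a (¬x ∘ inj₂) (¬y ∘ inj₂))
      (λ tw b → proj₁ (proj₂ (keep⁻ A O? b)) tw)
      closed multipartite
      where
      O? : ∀ i (j : Fin n) → Dec (¬ Twin G i v)
      O? i _ = ¬? (twin? i)
      H = G ─ keep A O?
      Good : Fin n → Set
      Good w = Sat G k same-block (w ∷ v ∷ []) × (∀ x → ¬ Edge A w x)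
      us ws : List (Fin n)
      us = picks G k same-block (0F ∼ 1F) (v ∷ [])
      ws = filter (untouched? A) us
      R : Fin n → Fin n → Set
      R w w′ = Good w × Good w′ × Edge G w w′
      ws-length : 4 ≤ length ws
      ws-length = length-untouched A A≤k (picks-unique G k same-block (0F ∼ 1F) (v ∷ []))
        (subst (threshold k <_) (sym (length-picks G k same-block (0F ∼ 1F) (v ∷ []))) large)
      ws-pairs : AllPairs R ws
      ws-pairs = allPairs-with (All.tabulate λ w∈ → let w∈us , w-free = ∈-filter⁻ (untouched? A) {xs = us} w∈ in
          picks-sound G k same-block (0F ∼ 1F) (v ∷ []) w∈us , w-free)
        (AllPairs.filter⁺ (untouched? A) (picks-pairs G k same-block (0F ∼ 1F) (v ∷ [])))
      -- A neighbour x of v that is not adjacent to w is a twin of w and hence adjacent to every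
      -- other chosen w′; so x misses at most one of them.
      thin : ∀ {x} → Edge G v x → ∀ {l} → AllPairs R l → length l ≤ suc (length (filter (edge? G x) l))
      thin {x} vx rs = length-filter-allPairs (edge? G x) rs λ {w} {w′} ((( _ , _ , β) , _) , _ , ww′) ¬xw ¬xw′ →
        [ ¬xw ∘ edge-sym G , (λ tw → ¬xw′ (proj₂ (tw w′) ww′)) ]′ (β x vx)
      good-edge : ∀ {w x} → Good w → Edge G x w → x ≢ v → Edge H′ x w
      good-edge {w} {x} ((vw , _) , w-free) e x≢v = H′⁺ e x≢v (neighbour≢v vw) (w-free x ∘ edge-sym A)
      H→H′ : ∀ {x y} → ¬ Twin G x v → ¬ Twin G y v → Edge H x y → Edge H′ x y
      H→H′ ¬x ¬y e = let e , ¬b = ─⁻ G (keep A O?) e in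
        H′⁺ e (λ { refl → ¬x λ _ → id , id }) (λ { refl → ¬y λ _ → id , id }) (λ a → ¬b (keep⁺ A O? a ¬x ¬y))
      H′→H : ∀ {x y} → Edge H′ x y → Edge H x y
      H′→H e = let e , _ , _ , ¬a = H′⁻ e in ─⁺ G (keep A O?) e (¬a ∘ proj₁ ∘ keep⁻ A O?)
      closed : ∀ {x y} → Edge G v x → Edge H x y → Block y
      closed {x} {y} vx xy with block? y
      ... | yes yB = yB
      ... | no ¬yB with filter (edge? G x) ws | ≤-trans ws-length (thin vx ws-pairs) | AllPairs.filter⁺ (edge? G x) ws-pairs | All.all-filter (edge? G x) ws
      -- At least three representatives are adjacent to x. Two of them form a triangle with x, and y
      -- is pendant at x, since all G-neighbours of a representative lie in the block.
      ...   | w ∷ w′ ∷ _ | _ | ((gw , gw′ , ww′) ∷ _) ∷ _ | xw ∷ xw′ ∷ _ = ⊥-elim (paw-free⁻ H′ free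
                ( good-edge gw′ ww′ (neighbour≢v (proj₁ (proj₁ gw))) , edge-sym H′ (good-edge gw′ xw′ x≢v)
                , edge-sym H′ (good-edge gw xw x≢v) , H→H′ (neighbour-not-twin vx) (¬yB ∘ inj₂) xy
                , far gw , far gw′ ))
        where
        x≢v = neighbour≢v vx
        far : ∀ {w} → Good w → ¬ Edge H′ w y
        far ((_ , α , _) , _) e = ¬yB (α y (proj₁ (H′⁻ e)))
      ...   | _ ∷ [] | s≤s (s≤s ()) | _ | _
      ...   | []     | s≤s ()       | _ | _
      multipartite : ∀ {x y z} → Edge G v x → Edge G v y → Edge G v z → Edge H x z → Edge H x y ⊎ Edge H y z
      multipartite {x} {y} {z} vx vy vz xz with edge? H x y | edge? H y z
      ... | yes xy | _      = inj₁ xy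
      ... | no _   | yes yz = inj₂ yz
      ... | no ¬xy | no ¬yz = ⊥-elim (common (filter (edge? G z) (filter (edge? G y) (filter (edge? G x) ws))) four
              (λ w∈ → let w∈yx , zw = ∈-filter⁻ (edge? G z) {xs = filter (edge? G y) (filter (edge? G x) ws)} w∈
                          w∈x , yw = ∈-filter⁻ (edge? G y) {xs = filter (edge? G x) ws} w∈yx
                          w∈ws , xw = ∈-filter⁻ (edge? G x) {xs = ws} w∈x
                          w∈us , w-free = ∈-filter⁻ (untouched? A) {xs = us} w∈ws
                      in (picks-sound G k same-block (0F ∼ 1F) (v ∷ []) w∈us , w-free) , xw , yw , zw))
        where
        four : 4 ≤ 3 + length (filter (edge? G z) (filter (edge? G y) (filter (edge? G x) ws)))
        four = ≤-trans ws-length (≤-trans (thin vx ws-pairs)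
          (s≤s (≤-trans (thin vy (AllPairs.filter⁺ (edge? G x) ws-pairs))
            (s≤s (thin vz (AllPairs.filter⁺ (edge? G y) (AllPairs.filter⁺ (edge? G x) ws-pairs)))))))
        common : ∀ l → 4 ≤ 3 + length l → (∀ {w} → w ∈ l → Good w × Edge G x w × Edge G y w × Edge G z w) → ⊥
        common []      (s≤s (s≤s (s≤s ()))) _
        common (w ∷ _) _                    f =
          -- The paw has triangle x, z, w, centre w and pendant vertex y.
          let gw , xw , yw , zw = f (here refl) in paw-free⁻ H′ free
            ( H→H′ (neighbour-not-twin vx) (neighbour-not-twin vz) xz
            , good-edge gw zw (neighbour≢v vz) , good-edge gw xw (neighbour≢v vx) , edge-sym H′ (good-edge gw yw (neighbour≢v vy))
            , ¬xy ∘ H′→H , ¬yz ∘ edge-sym H ∘ H′→H )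

  delete-sound : Sat G k removable (v ∷ []) → Solvable (G ∖v) k → Solvable G k
  delete-sound (_ , rule) (A , A⊆ , A≤k , free) = cases rule
    where
    open Restore A A⊆ A≤k free
    cases : Sat G k (pendant-rule ∨̇ twin-rule ∨̇ block-rule ∨̇ component-rule) (v ∷ []) → Solvable G k
    cases (inj₁ r)               = restored (pendant r)
    cases (inj₂ (inj₁ r))        = restored (twins r)
    cases (inj₂ (inj₂ (inj₁ r))) = block r
    cases (inj₂ (inj₂ (inj₂ r))) = component r

-- Forced edges and unsolvable instances

InQuad : ∀ {n} → Fin n → Vec (Fin n) 4 → Set
InQuad v (a ∷ b ∷ c ∷ d ∷ []) = v ≡ a ⊎ v ≡ b ⊎ v ≡ c ⊎ v ≡ d

PawOn : ∀ {n} → Graph n → Vec (Fin n) 4 → Set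
PawOn G (a ∷ b ∷ c ∷ d ∷ []) = Paw G a b c d

module _ {n : ℕ} (G : Graph n) (k : ℕ) (a b : Fin n) where

  packing : List (Vec (Fin n) 4)
  packing = selection G k 4 paw-through (¬̇ share-edge) (a ∷ b ∷ [])

  SharedEdge : Vec (Fin n) 4 → Vec (Fin n) 4 → Set
  SharedEdge t s = ∃[ u ] ∃[ w ] Edge G u w × InQuad u t × InQuad w t × InQuad u s × InQuad w s
    × ¬ (u ≡ a × w ≡ b) × ¬ (u ≡ b × w ≡ a)

  packing-sound : ∀ {t} → t ∈ packing → PawOn G t
  packing-sound {_ ∷ _ ∷ _ ∷ _ ∷ []} t∈ = proj₁ (selection-sound G k 4 paw-through (¬̇ share-edge) (a ∷ b ∷ []) t∈)

  packing-pairs : AllPairs (λ t s → ¬ SharedEdge t s) packing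
  packing-pairs = AllPairs.map (λ { {_ ∷ _ ∷ _ ∷ _ ∷ []} {_ ∷ _ ∷ _ ∷ _ ∷ []} → id })
    (selection-pairs G k 4 paw-through (¬̇ share-edge) (a ∷ b ∷ []))

  packing-maximal : ∀ t → PawOn G t → a ≡ b ⊎ InQuad a t × InQuad b t →
    t ∈ packing ⊎ ∃[ s ] s ∈ packing × SharedEdge t s
  packing-maximal t@(_ ∷ _ ∷ _ ∷ _ ∷ []) p ab
    with selection-maximal G k 4 paw-through (¬̇ share-edge) (a ∷ b ∷ []) t (p , ab)
  ... | inj₁ t∈ = inj₁ t∈
  ... | inj₂ (s@(_ ∷ _ ∷ _ ∷ _ ∷ []) , s∈ , ¬¬shared) =
    inj₂ (s , s∈ , decidable-stable (sat? G k share-edge (t Vec.++ (s Vec.++ a ∷ b ∷ []))) ¬¬shared)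

  -- Otherwise the solution contains an edge of every paw of the packing, and
  -- these are all different.
  overfull-hit : Sat G k overfull (a ∷ b ∷ []) → ∀ A → ∣E A ∣ ≤ k → A ⊆ᴱ G → PawFree (G ─ A) → Edge A a b
  overfull-hit large A A≤k A⊆G free with edge? A a b
  ... | yes ab = ab
  ... | no ¬ab =
    -- The chosen edges are counted as ordered pairs. A has at most 2k of these, fewer than the
    -- packing has paws.
    let ps , uniq , sound , len = hits packing packing-sound packing-pairs
    in contradiction (≤-trans (arcs-bound A uniq (proj₁ ∘ sound)) (+-mono-≤ A≤k A≤k))
         (<⇒≱ (≤-trans (s≤s (+-monoʳ-≤ k (m≤m+n k 3))) (subst (threshold k <_) (sym len) large)))
    where
    Hit : Vec (Fin n) 4 → Fin n × Fin n → Set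
    Hit t (u , w) = Edge A u w × InQuad u t × InQuad w t
    hit : ∀ t → PawOn G t → ∃ (Hit t)
    hit (a ∷ b ∷ c ∷ d ∷ []) (ab , bc , ac , cd , ¬ad , ¬bd)
      with edge? A a b | edge? A b c | edge? A a c | edge? A c d
    ... | yes e | _     | _     | _     = (a , b) , e , inj₁ refl , inj₂ (inj₁ refl)
    ... | no _  | yes e | _     | _     = (b , c) , e , inj₂ (inj₁ refl) , inj₂ (inj₂ (inj₁ refl))
    ... | no _  | no _  | yes e | _     = (a , c) , e , inj₁ refl , inj₂ (inj₂ (inj₁ refl))
    ... | no _  | no _  | no _  | yes e = (c , d) , e , inj₂ (inj₂ (inj₁ refl)) , inj₂ (inj₂ (inj₂ refl))
    ... | no x  | no y  | no z  | no w  = ⊥-elim (paw-free⁻ (G ─ A) free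
      (─⁺ G A ab x , ─⁺ G A bc y , ─⁺ G A ac z , ─⁺ G A cd w , ¬ad ∘ proj₁ ∘ ─⁻ G A , ¬bd ∘ proj₁ ∘ ─⁻ G A))
    hits : ∀ ts → (∀ {t} → t ∈ ts → PawOn G t) → AllPairs (λ t s → ¬ SharedEdge t s) ts →
           ∃[ ps ] Unique ps × (∀ {p} → p ∈ ps → Edge A (proj₁ p) (proj₂ p) × ∃[ t ] t ∈ ts × Hit t p) × length ps ≡ length ts
    hits []       _  _        = [] , [] , (λ ()) , refl
    hits (t ∷ ts) ps (d ∷ ds) =
      let (u , w) , e , u∈ , w∈ = hit t (ps (here refl))
          qs , uniq , sound , len = hits ts (ps ∘ there) ds
          fresh : ∀ {q} → q ∈ qs → (u , w) ≢ q
          -- A pair chosen for two paws is an edge shared by them, and it is not ab because ab is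
          -- assumed to be outside A.
          fresh q∈ eq = let _ , s , s∈ , _ , u∈′ , w∈′ = sound q∈ in All.lookup d s∈
            ( u , w , A⊆G _ _ e , u∈ , w∈ , subst (λ q → InQuad (proj₁ q) s) (sym eq) u∈′ , subst (λ q → InQuad (proj₂ q) s) (sym eq) w∈′
            , (λ (p , q) → ¬ab (subst₂ (Edge A) p q e)) , (λ (p , q) → ¬ab (edge-sym A (subst₂ (Edge A) p q e))) )
      in (u , w) ∷ qs , All.tabulate fresh ∷ uniq
       , (λ { (here refl) → e , t , here refl , e , u∈ , w∈ ; (there q∈) → let e , s , s∈ , h = sound q∈ in e , s , there s∈ , h })
       , cong suc len

  G∖ab : Graph n
  G∖ab = prune G k otherPair (a ∷ b ∷ [])

  private
    other? : ∀ i j → Dec (¬ (i ≡ a × j ≡ b))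
    other? i j = sat? G k otherPair (i ∷ j ∷ a ∷ b ∷ [])

  -- Every solution A contains ab, so G - A stays the same when ab is taken out of both G and A. For
  -- the count, (a , b) and (b , a) are two arcs of A that A′ lacks.
  remove-forced : Edge G a b → Sat G k overfull (a ∷ b ∷ []) → Solvable G k → Solvable G∖ab (pred k)
  remove-forced ab large (A , A⊆G , A≤k , free) = A′ ,
    (λ i j e → let e , p , q = keep⁻ A other? e in keep⁺ G other? (A⊆G i j e) p q) ,
    pred-mono-≤ (≤-trans (halve-≤ {suc ∣E A′ ∣} shrink) A≤k) ,
    paw-free⁺ (G∖ab ─ A′) λ p → paw-free⁻ (G ─ A) free (paw-map (G∖ab ─ A′) (G ─ A) id (λ _ → ⊤) (λ _ _ → to) (λ _ _ → from) tt tt tt tt p)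
    where
    A′ : Graph n
    A′ = prune A k otherPair (a ∷ b ∷ [])
    A-ab : Edge A a b
    A-ab = overfull-hit large A A≤k A⊆G free
    a≢b : a ≢ b
    a≢b refl = edge-irrefl G ab
    shrink : suc ∣E A′ ∣ + suc ∣E A′ ∣ ≤ ∣E A ∣ + ∣E A ∣
    shrink = subst (_≤ ∣E A ∣ + ∣E A ∣) (cong suc (trans (cong suc (length-arcs A′)) (sym (+-suc ∣E A′ ∣ ∣E A′ ∣)))) (arcs-bound A uniq sound)
      where
      uniq : Unique ((a , b) ∷ (b , a) ∷ arcs A′)
      uniq = ((a≢b ∘ cong proj₁) ∷ All.tabulate (λ { p∈ refl → proj₁ (proj₂ (keep⁻ A other? (∈-arcs⁻ A′ p∈))) (refl , refl) }))
           ∷ All.tabulate (λ { p∈ refl → proj₂ (proj₂ (keep⁻ A other? (∈-arcs⁻ A′ p∈))) (refl , refl) }) ∷ arcs-unique A′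
      sound : ∀ {p} → p ∈ (a , b) ∷ (b , a) ∷ arcs A′ → Edge A (proj₁ p) (proj₂ p)
      sound (here refl)         = A-ab
      sound (there (here refl)) = edge-sym A A-ab
      sound (there (there p∈))  = proj₁ (keep⁻ A other? (∈-arcs⁻ A′ p∈))
    to : ∀ {x y} → Edge (G∖ab ─ A′) x y → Edge (G ─ A) x y
    to e = let e , ¬a = ─⁻ G∖ab A′ e in let e , p , q = keep⁻ G other? e in ─⁺ G A e λ a → ¬a (keep⁺ A other? a p q)
    from : ∀ {x y} → Edge (G ─ A) x y → Edge (G∖ab ─ A′) x y
    from e = let e , ¬a = ─⁻ G A e in
      ─⁺ G∖ab A′ (keep⁺ G other? e (λ { (refl , refl) → ¬a A-ab }) (λ { (refl , refl) → ¬a (edge-sym A A-ab) }))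
        (¬a ∘ proj₁ ∘ keep⁻ A other?)

  restore-forced : 0 < k → Edge G a b → Solvable G∖ab (pred k) → Solvable G k
  restore-forced 0<k ab (A′ , A′⊆ , A′≤ , free) = B , (λ i j → proj₁ ∘ keep⁻ G in?) ,
    ≤-trans (halve-≤ grow) (≤-trans (s≤s A′≤) (≤-reflexive (suc-pred k {{>-nonZero 0<k}}))) ,
    paw-free⁺ (G ─ B) λ p → paw-free⁻ (G∖ab ─ A′) free (paw-map (G ─ B) (G∖ab ─ A′) id (λ _ → ⊤) (λ _ _ → to) (λ _ _ → from) tt tt tt tt p)
    where
    In : Fin n → Fin n → Set
    In i j = Edge A′ i j ⊎ (i ≡ a × j ≡ b) ⊎ (j ≡ a × i ≡ b)
    in? : ∀ i j → Dec (In i j)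
    in? i j = edge? A′ i j ⊎-dec ((i Fin.≟ a ×-dec j Fin.≟ b) ⊎-dec (j Fin.≟ a ×-dec i Fin.≟ b))
    in-sym : ∀ {i j} → In i j → In j i
    in-sym (inj₁ e)        = inj₁ (edge-sym A′ e)
    in-sym (inj₂ (inj₁ p)) = inj₂ (inj₂ p)
    in-sym (inj₂ (inj₂ p)) = inj₂ (inj₁ p)
    B : Graph n
    B = keep G in?
    grow : ∣E B ∣ + ∣E B ∣ ≤ suc ∣E A′ ∣ + suc ∣E A′ ∣
    grow = subst₂ _≤_ (length-arcs B) (cong suc (trans (cong suc (length-arcs A′)) (sym (+-suc ∣E A′ ∣ ∣E A′ ∣))))
      (unique-length (arcs-unique B) λ p∈ → listed (proj₁ (proj₂ (keep⁻ G in? (∈-arcs⁻ B p∈)))))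
      where
      listed : ∀ {i j} → In i j → (i , j) ∈ (a , b) ∷ (b , a) ∷ arcs A′
      listed (inj₁ e)                    = there (there (∈-arcs⁺ A′ e))
      listed (inj₂ (inj₁ (refl , refl))) = here refl
      listed (inj₂ (inj₂ (refl , refl))) = there (here refl)
    to : ∀ {x y} → Edge (G ─ B) x y → Edge (G∖ab ─ A′) x y
    to e = let e , ¬b = ─⁻ G B e
               ¬in = λ i → ¬b (keep⁺ G in? e i (in-sym i))
           in ─⁺ G∖ab A′ (keep⁺ G other? e (¬in ∘ inj₂ ∘ inj₁) (¬in ∘ inj₂ ∘ inj₂)) (¬in ∘ inj₁)
    from : ∀ {x y} → Edge (G∖ab ─ A′) x y → Edge (G ─ B) x y
    from e = let e , ¬a = ─⁻ G∖ab A′ e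
                 e , p , q = keep⁻ G other? e
             in ─⁺ G B e λ b → [ ¬a , [ p , q ]′ ]′ (proj₁ (proj₂ (keep⁻ G in? b)))

∣E∣≡0 : ∀ {n} (A : Graph n) → ∣E A ∣ ≤ 0 → ∀ {i j} → ¬ Edge A i j
∣E∣≡0 A A≤0 {i} {j} e with arcs-bound A {(i , j) ∷ []} ([] ∷ []) (λ { (here refl) → e })
... | le = contradiction (≤-trans le (+-mono-≤ A≤0 A≤0)) λ ()

paw-unsolvable : ¬ Solvable paw 0
paw-unsolvable (A , _ , A≤0 , free) = paw-free⁻ (paw ─ A) free {0F} {1F} {2F} {3F}
  (edge 0F 1F tt , edge 1F 2F tt , edge 0F 2F tt , edge 2F 3F tt , id ∘ proj₁ ∘ ─⁻ paw A {0F} {3F} , id ∘ proj₁ ∘ ─⁻ paw A {1F} {3F})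
  where
  edge : ∀ i j → Edge paw i j → Edge (paw ─ A) i j
  edge i j e = ─⁺ paw A {i} {j} e (∣E∣≡0 A A≤0)

-- A solution would contain the overfull pair as an edge. For k = 0 it has no edges, and for k > 0
-- that edge would be forced.
refuted-unsolvable : ∀ {n} (G : Graph n) k → (∀ a b → ¬ Sat G k forced (a ∷ b ∷ [])) → Sat G k refuted [] → ¬ Solvable G k
refuted-unsolvable G zero ¬forced (a , b , large) (A , A⊆G , A≤k , free) =
  ∣E∣≡0 A A≤k (overfull-hit G zero b a large A A≤k A⊆G free)
refuted-unsolvable G k@(suc _) ¬forced (a , b , large) (A , A⊆G , A≤k , free) =
  ¬forced b a (s≤s z≤n , A⊆G _ _ (overfull-hit G k b a large A A≤k A⊆G free) , large)

-- Passing to the nonisolated vertices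

module _ {n : ℕ} (G : Graph n) (k : ℕ) where

  private
    vs = alive G k

  alive-unique : Unique vs
  alive-unique = greedy-unique _ _ (Unique.allFin⁺ n)

  alive-sound : ∀ {v} → v ∈ vs → ∃ (Edge G v)
  alive-sound {v} v∈ = T-does⁻ (sat? G k nonisolated (v ∷ [])) (All.lookup (greedy-sound _ _ (allFin n)) v∈)

  alive-complete : ∀ {v w} → Edge G v w → v ∈ vs
  alive-complete {v} e with greedy-maximal _ (λ _ _ → true) (∈-allFin v) (T-does⁺ (sat? G k nonisolated (v ∷ [])) (-, e))
  ... | inj₁ v∈          = v∈
  ... | inj₂ (_ , _ , f) = ⊥-elim (f tt)

  private
    at : Fin (length vs) → Fin n
    at = List.lookup vs

    at-injective : ∀ {p q} → at p ≡ at q → p ≡ q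
    at-injective = lookup-injective alive-unique
      where
      lookup-injective : ∀ {X : Set} {xs : List X} → Unique xs → ∀ {p q} → List.lookup xs p ≡ List.lookup xs q → p ≡ q
      lookup-injective (x∉ ∷ u) {zero}  {zero}  _  = refl
      lookup-injective (x∉ ∷ u) {zero}  {suc q} eq = contradiction eq (All.lookup x∉ (∈-lookup q))
      lookup-injective (x∉ ∷ u) {suc p} {zero}  eq = contradiction (sym eq) (All.lookup x∉ (∈-lookup p))
      lookup-injective (x∉ ∷ u) {suc p} {suc q} eq = cong suc (lookup-injective u eq)

    position : ∀ {v w} → Edge G v w → ∃[ p ] at p ≡ v
    position e = let v∈ = alive-complete e in index v∈ , sym (lookup-index v∈)

  compress⁺ : Solvable G k → Solvable (induced G vs) k
  compress⁺ (A , A⊆G , A≤k , free) = induced A vs , (λ i j → A⊆G (at i) (at j)) ,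
    ≤-trans (∣E∣-injection (induced A vs) A at id (λ _ _ → at-injective)) A≤k ,
    paw-free⁺ (induced G vs ─ induced A vs) λ {a} {b} {c} {d} p → paw-free⁻ (G ─ A) free {at a} {at b} {at c} {at d} p

  -- No vertex of a paw is isolated, so each has a position in the list and the whole paw can be
  -- pulled back to the induced graph.
  compress⁻ : Solvable (induced G vs) k → Solvable G k
  compress⁻ (A′ , A′⊆ , A′≤k , free) = A , (λ i j → proj₁ ∘ keep⁻ G in?) , ≤-trans (halve-≤ count) A′≤k ,
    paw-free⁺ (G ─ A) λ p@(ab , bc , ac , cd , _) → back (position (proj₁ (─⁻ G A ab))) (position (proj₁ (─⁻ G A bc)))
      (position (proj₁ (─⁻ G A cd))) (position (edge-sym G (proj₁ (─⁻ G A cd)))) p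
    where
    In : Fin n → Fin n → Set
    In i j = ∃[ p ] ∃[ q ] at p ≡ i × at q ≡ j × Edge A′ p q
    in? : ∀ i j → Dec (In i j)
    in? i j = Fin.any? λ p → Fin.any? λ q → at p Fin.≟ i ×-dec (at q Fin.≟ j ×-dec edge? A′ p q)
    A : Graph n
    A = keep G in?
    count : ∣E A ∣ + ∣E A ∣ ≤ ∣E A′ ∣ + ∣E A′ ∣
    count = subst₂ _≤_ (length-arcs A) (trans (List.length-map _ (arcs A′)) (length-arcs A′))
      (unique-length {ys = map (λ (p , q) → at p , at q) (arcs A′)} (arcs-unique A) λ ij∈ →
        let _ , (p , q , eq , eq′ , e) , _ = keep⁻ G in? (∈-arcs⁻ A ij∈)
        in subst (_∈ map (λ (p , q) → at p , at q) (arcs A′)) (cong₂ _,_ eq eq′) (∈-map⁺ _ (∈-arcs⁺ A′ e)))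
    G′ = induced G vs
    to : ∀ {p q} → Edge (G ─ A) (at p) (at q) → Edge (G′ ─ A′) p q
    to {p} {q} e = let e , ¬a = ─⁻ G A {at p} {at q} e in
      ─⁺ G′ A′ {p} {q} e λ a → ¬a (keep⁺ G in? e (p , q , refl , refl , a) (q , p , refl , refl , edge-sym A′ a))
    from : ∀ {p q} → Edge (G′ ─ A′) p q → Edge (G ─ A) (at p) (at q)
    from {p} {q} e = let e , ¬a = ─⁻ G′ A′ {p} {q} e in ─⁺ G A {at p} {at q} e λ a →
      let _ , (p′ , q′ , eq , eq′ , a′) , _ = keep⁻ G in? {at p} {at q} a
      in ¬a (subst₂ (Edge A′) (at-injective eq) (at-injective eq′) a′)
    back : ∀ {a b c d} → ∃[ p ] at p ≡ a → ∃[ p ] at p ≡ b → ∃[ p ] at p ≡ c → ∃[ p ] at p ≡ d → ¬ Paw (G ─ A) a b c d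
    back (a , refl) (b , refl) (c , refl) (d , refl) (ab , bc , ac , cd , ¬ad , ¬bd) = paw-free⁻ (G′ ─ A′) free {a} {b} {c} {d}
      (to ab , to bc , to ac , to cd , ¬ad ∘ from {a} {d} , ¬bd ∘ from {b} {d})

-- The size of irreducible instances

Cover : ∀ {n} → (Fin n → Set) → ℕ → Set
Cover P m = ∃[ l ] length l ≤ m × (∀ {v} → P v → v ∈ l)

-- Truncated lists obey their length bound for every index, as unions of covers require, and lose
-- nothing where the full list is known to be short.
∈-take : {X : Set} {x : X} (m : ℕ) {xs : List X} → length xs ≤ m → x ∈ xs → x ∈ take m xs
∈-take m {xs} le x∈ = subst (_ ∈_) (sym (List.take-all m xs le)) x∈

length-take : {X : Set} (m : ℕ) (xs : List X) → length (take m xs) ≤ m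
length-take m xs = ≤-trans (≤-reflexive (List.length-take m xs)) (m⊓n≤m m _)

length-concatMap : {X Y : Set} (f : X → List Y) {m : ℕ} → (∀ x → length (f x) ≤ m) →
                   ∀ xs → length (concatMap f xs) ≤ length xs * m
length-concatMap f le []       = z≤n
length-concatMap f le (x ∷ xs) =
  ≤-trans (≤-reflexive (List.length-++ (f x))) (+-mono-≤ (le x) (length-concatMap f le xs))

∈-concatMap : {X Y : Set} (f : X → List Y) (xs : List X) {x : X} {y : Y} → x ∈ xs → y ∈ f x → y ∈ concatMap f xs
∈-concatMap f (_ ∷ _) (here refl) y∈ = ∈-++⁺ˡ y∈
∈-concatMap f (x ∷ xs) (there x∈) y∈ = ∈-++⁺ʳ (f x) (∈-concatMap f xs x∈ y∈)

module _ {n : ℕ} where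

  cover-⊎ : {P Q : Fin n → Set} {l m : ℕ} → Cover P l → Cover Q m → Cover (λ v → P v ⊎ Q v) (l + m)
  cover-⊎ (as , a≤ , a∈) (bs , b≤ , b∈) =
    as ++ bs , ≤-trans (≤-reflexive (List.length-++ as)) (+-mono-≤ a≤ b≤) , [ ∈-++⁺ˡ ∘ a∈ , ∈-++⁺ʳ as ∘ b∈ ]′

  cover-⋃ : {X : Set} {P : X → Fin n → Set} {m : ℕ} (xs : List X) → (∀ x → Cover (P x) m) →
            Cover (λ v → ∃[ x ] x ∈ xs × P x v) (length xs * m)
  cover-⋃ xs c = concatMap (proj₁ ∘ c) xs , length-concatMap (proj₁ ∘ c) (proj₁ ∘ proj₂ ∘ c) xs ,
                 λ (x , x∈ , p) → ∈-concatMap (proj₁ ∘ c) xs x∈ (proj₂ (proj₂ (c x)) p)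

  -- Allows a cover to be built around a representative, such as one member of a twin class; where
  -- there is none, the empty list serves.
  cover-choice : {P : Fin n → Set} → (∀ v → Dec (P v)) → ∀ {m} → (∀ v → P v → Cover P m) → Cover P m
  cover-choice P? c with Fin.any? P?
  ... | yes (v , p) = c v p
  ... | no ¬p       = [] , z≤n , λ p → contradiction (-, p) ¬p

corners : ∀ {n} → Vec (Fin n) 4 → List (Fin n)
corners = Vec.toList

∈-corners : ∀ {n} {v : Fin n} t → InQuad v t → v ∈ corners t
∈-corners (a ∷ b ∷ c ∷ d ∷ []) (inj₁ refl)               = here refl
∈-corners (a ∷ b ∷ c ∷ d ∷ []) (inj₂ (inj₁ refl))        = there (here refl)
∈-corners (a ∷ b ∷ c ∷ d ∷ []) (inj₂ (inj₂ (inj₁ refl))) = there (there (here refl))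
∈-corners (a ∷ b ∷ c ∷ d ∷ []) (inj₂ (inj₂ (inj₂ refl))) = there (there (there (here refl)))

length-corners : ∀ {n} (t : Vec (Fin n) 4) → length (corners t) ≤ 4
length-corners (a ∷ b ∷ c ∷ d ∷ []) = ≤-refl

Same : ∀ {n} → (u w a b : Fin n) → Set
Same u w a b = (u ≡ a × w ≡ b) ⊎ (u ≡ b × w ≡ a)

module _ {n : ℕ} (G : Graph n) {a b c d : Fin n} where

  paw-edge : Paw G a b c d → ∀ {u w} → InQuad u (a ∷ b ∷ c ∷ d ∷ []) → InQuad w (a ∷ b ∷ c ∷ d ∷ []) → Edge G u w →
             Same u w a b ⊎ Same u w b c ⊎ Same u w a c ⊎ Same u w c d
  paw-edge (_ , _ , _ , _ , ¬ad , ¬bd) = find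
    where
    find : ∀ {u w} → InQuad u (a ∷ b ∷ c ∷ d ∷ []) → InQuad w (a ∷ b ∷ c ∷ d ∷ []) → Edge G u w →
           Same u w a b ⊎ Same u w b c ⊎ Same u w a c ⊎ Same u w c d
    find (inj₁ refl) (inj₁ refl) e = ⊥-elim (edge-irrefl G e)
    find (inj₁ refl) (inj₂ (inj₁ refl)) e = inj₁ (inj₁ (refl , refl))
    find (inj₁ refl) (inj₂ (inj₂ (inj₁ refl))) e = inj₂ (inj₂ (inj₁ (inj₁ (refl , refl))))
    find (inj₁ refl) (inj₂ (inj₂ (inj₂ refl))) e = ⊥-elim (¬ad e)
    find (inj₂ (inj₁ refl)) (inj₁ refl) e = inj₁ (inj₂ (refl , refl))
    find (inj₂ (inj₁ refl)) (inj₂ (inj₁ refl)) e = ⊥-elim (edge-irrefl G e)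
    find (inj₂ (inj₁ refl)) (inj₂ (inj₂ (inj₁ refl))) e = inj₂ (inj₁ (inj₁ (refl , refl)))
    find (inj₂ (inj₁ refl)) (inj₂ (inj₂ (inj₂ refl))) e = ⊥-elim (¬bd e)
    find (inj₂ (inj₂ (inj₁ refl))) (inj₁ refl) e = inj₂ (inj₂ (inj₁ (inj₂ (refl , refl))))
    find (inj₂ (inj₂ (inj₁ refl))) (inj₂ (inj₁ refl)) e = inj₂ (inj₁ (inj₂ (refl , refl)))
    find (inj₂ (inj₂ (inj₁ refl))) (inj₂ (inj₂ (inj₁ refl))) e = ⊥-elim (edge-irrefl G e)
    find (inj₂ (inj₂ (inj₁ refl))) (inj₂ (inj₂ (inj₂ refl))) e = inj₂ (inj₂ (inj₂ (inj₁ (refl , refl))))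
    find (inj₂ (inj₂ (inj₂ refl))) (inj₁ refl) e = ⊥-elim (¬ad (edge-sym G e))
    find (inj₂ (inj₂ (inj₂ refl))) (inj₂ (inj₁ refl)) e = ⊥-elim (¬bd (edge-sym G e))
    find (inj₂ (inj₂ (inj₂ refl))) (inj₂ (inj₂ (inj₁ refl))) e = inj₂ (inj₂ (inj₂ (inj₂ (refl , refl))))
    find (inj₂ (inj₂ (inj₂ refl))) (inj₂ (inj₂ (inj₂ refl))) e = ⊥-elim (edge-irrefl G e)

∈-picks : ∀ {n m} (G : Graph n) k (φ : Formula (suc m)) (ρ : Vec (Fin n) m) {u} →
          Sat G k φ (u ∷ ρ) → u ∈ picks G k φ always ρ
∈-picks G k φ ρ {u} sat with picks-maximal G k φ always ρ u sat
... | inj₁ u∈          = u∈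
... | inj₂ (_ , _ , ≢) = contradiction refl ≢

module Irreducible {n : ℕ} (G : Graph n) (k : ℕ)
  (irremovable : ∀ v → ¬ Sat G k removable (v ∷ []))
  (unrefuted : ¬ Sat G k refuted [])
  -- Any vertex will do: on the pair (o , o) the packing consists of edge-disjoint paws.
  (o : Fin n) where

  θ : ℕ
  θ = threshold k

  packing-≤ : ∀ a b → length (packing G k a b) ≤ θ
  packing-≤ a b = ≮⇒≥ λ large → unrefuted (b , a , large)

  pairs : Vec (Fin n) 4 → List (Fin n × Fin n)
  pairs t = cartesianProduct (corners t) (corners t)

  -- X consists of the vertices of a maximal packing of edge-disjoint paws.  For
  -- each pair on a common paw of it, Y takes in a maximal packing of paws
  -- through that pair.  Every paw then has an edge inside X and two inside Y.
  opaque

    P₀ : List (Vec (Fin n) 4)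
    P₀ = packing G k o o

    through : Fin n × Fin n → List (Fin n)
    through (a , b) = concatMap corners (packing G k a b)

    X Y : List (Fin n)
    F : List (Fin n × Fin n)
    X = concatMap corners P₀
    F = concatMap pairs P₀
    Y = X ++ concatMap through F

    length-X : length X ≤ θ * 4
    length-X = ≤-trans (length-concatMap corners length-corners P₀) (*-monoˡ-≤ 4 (packing-≤ o o))

    length-Y : length Y ≤ θ * 4 + θ * 16 * (θ * 4)
    length-Y = ≤-trans (≤-reflexive (List.length-++ X)) (+-mono-≤ length-X (≤-trans
      (length-concatMap through (λ (a , b) → ≤-trans (length-concatMap corners length-corners (packing G k a b)) (*-monoˡ-≤ 4 (packing-≤ a b))) F)
      (*-monoˡ-≤ (θ * 4) (≤-trans (length-concatMap pairs length-pairs P₀) (*-monoˡ-≤ 16 (packing-≤ o o))))))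
      where
      length-pairs : ∀ t → length (pairs t) ≤ 16
      length-pairs (_ ∷ _ ∷ _ ∷ _ ∷ []) = ≤-refl

    X⊆Y : ∀ {v} → v ∈ X → v ∈ Y
    X⊆Y = ∈-++⁺ˡ

    edge-in-X : ∀ {a b c d} → Paw G a b c d → let t = a ∷ b ∷ c ∷ d ∷ [] in
      ∃[ u ] ∃[ w ] Edge G u w × InQuad u t × InQuad w t × u ∈ X × w ∈ X × (u , w) ∈ F
    edge-in-X {a} {b} {c} {d} p with packing-maximal G k o o (a ∷ b ∷ c ∷ d ∷ []) p (inj₁ refl)
    ... | inj₁ t∈ = a , b , proj₁ p , inj₁ refl , inj₂ (inj₁ refl) ,
          ∈-concatMap corners P₀ t∈ (here refl) , ∈-concatMap corners P₀ t∈ (there (here refl)) ,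
          ∈-concatMap pairs P₀ t∈ (∈-cartesianProduct⁺ {xs = a ∷ b ∷ c ∷ d ∷ []} {ys = a ∷ b ∷ c ∷ d ∷ []} (here refl) (there (here refl)))
    ... | inj₂ (s , s∈ , u , w , e , u∈t , w∈t , u∈s , w∈s , _) = u , w , e , u∈t , w∈t ,
          ∈-concatMap corners P₀ s∈ (∈-corners s u∈s) , ∈-concatMap corners P₀ s∈ (∈-corners s w∈s) ,
          ∈-concatMap pairs P₀ s∈ (∈-cartesianProduct⁺ (∈-corners s u∈s) (∈-corners s w∈s))

    -- Let uw be an edge of the paw inside X. The paw passes through this pair, so it either belongs
    -- to the packing for uw, with all corners in Y, or shares with a member of it an edge other
    -- than uw.
    edges-in-Y : ∀ {a b c d} → Paw G a b c d → let t = a ∷ b ∷ c ∷ d ∷ [] in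
      (∀ {v} → InQuad v t → v ∈ Y) ⊎
      (∃[ u ] ∃[ w ] ∃[ x ] ∃[ y ] Edge G u w × InQuad u t × InQuad w t × u ∈ Y × w ∈ Y ×
        Edge G x y × InQuad x t × InQuad y t × x ∈ Y × y ∈ Y × ¬ Same x y u w)
    edges-in-Y {a} {b} {c} {d} p with edge-in-X p
    ... | u , w , e , u∈t , w∈t , u∈X , w∈X , uw∈F with packing-maximal G k u w (a ∷ b ∷ c ∷ d ∷ []) p (inj₂ (u∈t , w∈t))
    ...   | inj₁ t∈ = inj₁ λ v∈ → ∈-++⁺ʳ X (∈-concatMap through F uw∈F (∈-concatMap corners (packing G k u w) t∈ (∈-corners (a ∷ b ∷ c ∷ d ∷ []) v∈)))
    ...   | inj₂ (s , s∈ , x , y , e′ , x∈t , y∈t , x∈s , y∈s , ≢₁ , ≢₂) =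
            inj₂ (u , w , x , y , e , u∈t , w∈t , X⊆Y u∈X , X⊆Y w∈X , e′ , x∈t , y∈t , inY x∈s , inY y∈s , [ ≢₁ , ≢₂ ]′)
      where
      inY : ∀ {v} → InQuad v s → v ∈ Y
      inY v∈ = ∈-++⁺ʳ X (∈-concatMap through F uw∈F (∈-concatMap corners (packing G k u w) s∈ (∈-corners s v∈)))

  _∈Y? : ∀ v → Dec (v ∈ Y)
  v ∈Y? = v ∈? Y
    where open import Data.List.Membership.DecPropositional (Fin._≟_ {n}) using (_∈?_)

  module _ {a b c d : Fin n} (p : Paw G a b c d) where

    private
      t : Vec (Fin n) 4
      t = a ∷ b ∷ c ∷ d ∷ []

      same-≡ : ∀ {u w x y e f : Fin n} → Same u w e f → Same x y e f → Same x y u w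
      same-≡ (inj₁ (refl , refl)) s                    = s
      same-≡ (inj₂ (refl , refl)) (inj₁ (refl , refl)) = inj₂ (refl , refl)
      same-≡ (inj₂ (refl , refl)) (inj₂ (refl , refl)) = inj₁ (refl , refl)

      -- If only one of the four edges can lie in Y, the two edges coincide.
      collision : ∀ {e f : Fin n} → (∀ {u w} → u ∈ Y → w ∈ Y →
          Same u w a b ⊎ Same u w b c ⊎ Same u w a c ⊎ Same u w c d → Same u w e f) →
        ¬ (∀ {v} → InQuad v t → v ∈ Y) → ⊥
      collision only ¬all with edges-in-Y p
      ... | inj₁ all = ¬all all
      ... | inj₂ (u , w , x , y , e , u∈t , w∈t , u∈Y , w∈Y , e′ , x∈t , y∈t , x∈Y , y∈Y , ≢) =
        ≢ (same-≡ (only u∈Y w∈Y (paw-edge G p u∈t w∈t e)) (only x∈Y y∈Y (paw-edge G p x∈t y∈t e′)))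

    centre∈Y : c ∈ Y
    centre∈Y = decidable-stable (c ∈Y?) λ c∉ → collision (only c∉) (λ all → c∉ (all (inj₂ (inj₂ (inj₁ refl)))))
      where
      only : c ∉ Y → ∀ {u w} → u ∈ Y → w ∈ Y → Same u w a b ⊎ Same u w b c ⊎ Same u w a c ⊎ Same u w c d → Same u w a b
      only c∉ u∈ w∈ (inj₁ s)                                  = s
      only c∉ u∈ w∈ (inj₂ (inj₁ (inj₁ (_ , refl))))           = contradiction w∈ c∉
      only c∉ u∈ w∈ (inj₂ (inj₁ (inj₂ (refl , _))))           = contradiction u∈ c∉
      only c∉ u∈ w∈ (inj₂ (inj₂ (inj₁ (inj₁ (_ , refl)))))    = contradiction w∈ c∉
      only c∉ u∈ w∈ (inj₂ (inj₂ (inj₁ (inj₂ (refl , _)))))    = contradiction u∈ c∉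
      only c∉ u∈ w∈ (inj₂ (inj₂ (inj₂ (inj₁ (refl , _)))))    = contradiction u∈ c∉
      only c∉ u∈ w∈ (inj₂ (inj₂ (inj₂ (inj₂ (_ , refl)))))    = contradiction w∈ c∉

    ends∈Y : a ∉ Y → d ∉ Y → ⊥
    ends∈Y a∉ d∉ = collision only (λ all → a∉ (all (inj₁ refl)))
      where
      only : ∀ {u w} → u ∈ Y → w ∈ Y → Same u w a b ⊎ Same u w b c ⊎ Same u w a c ⊎ Same u w c d → Same u w b c
      only u∈ w∈ (inj₁ (inj₁ (refl , _)))                  = contradiction u∈ a∉
      only u∈ w∈ (inj₁ (inj₂ (_ , refl)))                  = contradiction w∈ a∉
      only u∈ w∈ (inj₂ (inj₁ s))                           = s
      only u∈ w∈ (inj₂ (inj₂ (inj₁ (inj₁ (refl , _)))))    = contradiction u∈ a∉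
      only u∈ w∈ (inj₂ (inj₂ (inj₁ (inj₂ (_ , refl)))))    = contradiction w∈ a∉
      only u∈ w∈ (inj₂ (inj₂ (inj₂ (inj₁ (_ , refl)))))    = contradiction w∈ d∉
      only u∈ w∈ (inj₂ (inj₂ (inj₂ (inj₂ (refl , _)))))    = contradiction u∈ d∉

    -- The edge of the paw inside X is not ab, and each of the other three contains c.
    centre∈X : a ∉ X → c ∈ X
    centre∈X a∉ with edge-in-X p
    ... | u , w , e , u∈t , w∈t , u∈ , w∈ , _ with paw-edge G p u∈t w∈t e
    ...   | inj₁ (inj₁ (refl , _))                = contradiction u∈ a∉
    ...   | inj₁ (inj₂ (_ , refl))                = contradiction w∈ a∉
    ...   | inj₂ (inj₁ (inj₁ (_ , refl)))         = w∈
    ...   | inj₂ (inj₁ (inj₂ (refl , _)))         = u∈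
    ...   | inj₂ (inj₂ (inj₁ (inj₁ (_ , refl))))  = w∈
    ...   | inj₂ (inj₂ (inj₁ (inj₂ (refl , _))))  = u∈
    ...   | inj₂ (inj₂ (inj₂ (inj₁ (refl , _))))  = u∈
    ...   | inj₂ (inj₂ (inj₂ (inj₂ (_ , refl))))  = w∈

  private
    _~_ : Fin n → Fin n → Set
    _~_ = Edge G

    _~?_ : ∀ u v → Dec (u ~ v)
    _~?_ = edge? G

    flip : ∀ {u v} → u ~ v → v ~ u
    flip = edge-sym G

    triangular? : ∀ v → Dec (Triangular G v)
    triangular? v = sat? G k (triangular 0F) (v ∷ [])

  -- Otherwise v would be the centre of the paw on b, c, v, d.
  not-centre : ∀ {v b c d} → v ∉ Y → v ~ b → v ~ c → b ~ c → v ~ d → d ~ b ⊎ d ~ c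
  not-centre {v} {b} {c} {d} v∉ vb vc bc vd with d ~? b | d ~? c
  ... | yes db | _      = inj₁ db
  ... | no _   | yes dc = inj₂ dc
  ... | no ¬db | no ¬dc = contradiction (centre∈Y (bc , flip vc , flip vb , vd , ¬db ∘ flip , ¬dc ∘ flip)) v∉

  triangular-neighbour : ∀ {v d} → v ∉ Y → Triangular G v → v ~ d → Triangular G d
  triangular-neighbour v∉ (b , c , vb , vc , bc) vd with not-centre v∉ vb vc bc vd
  ... | inj₁ db = -, -, flip vd , db , vb
  ... | inj₂ dc = -, -, flip vd , dc , vc

  triangle-through : ∀ {v y} → v ∉ Y → Triangular G v → v ~ y → ∃[ x ] v ~ x × x ~ y
  triangle-through v∉ (b , c , vb , vc , bc) vy with not-centre v∉ vb vc bc vy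
  ... | inj₁ yb = b , vb , flip yb
  ... | inj₂ yc = c , vc , flip yc

  -- Let z be a neighbour of v. If z is adjacent to y, it is adjacent to v′ as well, or v, z, y, v′
  -- would be a paw whose triangle end v and pendant vertex v′ are outside Y. Otherwise complete vy
  -- to a triangle with x: then z is adjacent to x, v′ is adjacent to x by the same argument, and x
  -- takes the place of y.
  nonadjacent-twins : ∀ {v v′ y} → v ∉ Y → v′ ∉ Y → Triangular G v → Triangular G v′ →
                      ¬ v ~ v′ → v ~ y → v′ ~ y → Twin G v v′
  nonadjacent-twins {v} {v′} v∉ v′∉ tri tri′ ¬vv′ vy v′y z = half v∉ v′∉ tri ¬vv′ vy v′y , half v′∉ v∉ tri′ (¬vv′ ∘ flip) v′y vy
    where
    close : ∀ {v v′ y z} → v ∉ Y → v′ ∉ Y → ¬ v ~ v′ → v ~ y → v′ ~ y → v ~ z → z ~ y → v′ ~ z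
    close {v} {v′} {y} {z} v∉ v′∉ ¬vv′ vy v′y vz zy = decidable-stable (v′ ~? z) λ ¬v′z →
      ends∈Y (vz , zy , vy , flip v′y , ¬vv′ , ¬v′z ∘ flip) v∉ v′∉
    half : ∀ {v v′ y z} → v ∉ Y → v′ ∉ Y → Triangular G v → ¬ v ~ v′ → v ~ y → v′ ~ y → v ~ z → v′ ~ z
    half v∉ v′∉ tri ¬vv′ vy v′y vz with triangle-through v∉ tri vy
    ... | x , vx , xy with not-centre v∉ vy vx (flip xy) vz
    ...   | inj₁ zy = close v∉ v′∉ ¬vv′ vy v′y vz zy
    ...   | inj₂ zx = close v∉ v′∉ ¬vv′ vx (close v∉ v′∉ ¬vv′ vy v′y vx xy) vz zx

  private
    twins-of : Fin n → List (Fin n)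
    twins-of v = picks G k (twin 0F 1F) always (v ∷ [])

    ∈-twins-of : ∀ {u v w} → v ~ w → Twin G u v → u ∈ take θ (twins-of v)
    ∈-twins-of {u} {v} {w} vw tw = ∈-take θ small (∈-picks G k (twin 0F 1F) (v ∷ []) tw)
      where
      small : length (twins-of v) ≤ θ
      small = ≮⇒≥ λ large → irremovable v ((w , vw) , inj₂ (inj₁ (subst (θ <_) (length-picks G k (twin 0F 1F) always (v ∷ [])) large)))

    cover-twins : {P : Fin n → Set} → (∀ v → Dec (P v)) → (∀ {v} → P v → ∃ (v ~_)) →
                  (∀ {u v} → P u → P v → Twin G u v) → Cover P θ
    cover-twins P? nonisolated twins = cover-choice P? λ v p →
      take θ (twins-of v) , length-take θ (twins-of v) , λ q → ∈-twins-of (proj₂ (nonisolated p)) (twins q p)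

  private
    outer : Formula 3
    outer = 1F ∼ 0F ∧̇ ¬̇ triangular 0F

    -- In the rule this list is formed in an environment that also holds v. Here w fills that place,
    -- so that the list depends on w alone.
    outer-neighbours : Fin n → List (Fin n)
    outer-neighbours w = picks G k outer always (w ∷ w ∷ [])

  Outer : Fin n → Fin n → Set
  Outer w v = ¬ Triangular G v × w ~ v × length (outer-neighbours w) ≤ θ

  cover-outer : ∀ w → Cover (Outer w) θ
  cover-outer w = take θ (outer-neighbours w) , length-take θ (outer-neighbours w) ,
    λ (¬tri , wv , le) → ∈-take θ le (∈-picks G k outer (w ∷ w ∷ []) (wv , ¬tri))

  -- As the pendant rule does not apply, some triangular neighbour w of v has few neighbours in no
  -- triangle. It lies in Y, for outside Y its neighbour v would be triangular too.
  outer-case : ∀ {v x} → v ~ x → ¬ Triangular G v → ∃[ w ] w ∈ Y × Outer w v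
  outer-case {v} {x} vx ¬tri with Fin.any? (λ w → (v ~? w) ×-dec (triangular? w ×-dec (length (outer-neighbours w) ≤? θ)))
  ... | yes (w , vw , tri-w , le) = w , w∈Y , ¬tri , flip vw , le
    where
    w∈Y : w ∈ Y
    w∈Y = decidable-stable (w ∈Y?) λ w∉ → ¬tri (triangular-neighbour w∉ tri-w (flip vw))
  ... | no none = contradiction ((x , vx) , inj₁ (¬tri , crowded)) (irremovable v)
    where
    crowded : ∀ w → v ~ w → Triangular G w → Sat G k (many 1 outer always) (w ∷ v ∷ [])
    crowded w vw tri = subst (θ <_) (length-picks G k outer always (w ∷ v ∷ []))
      (≤-trans (≰⇒> λ le → none (w , vw , tri , le))
        (unique-length (picks-unique G k outer always (w ∷ w ∷ []))
          (∈-picks G k outer (w ∷ v ∷ []) ∘ picks-sound G k outer always (w ∷ w ∷ []))))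

  U : Fin n → Set
  U v = v ∉ Y × Triangular G v

  U? : ∀ v → Dec (U v)
  U? v = ¬? (v ∈Y?) ×-dec triangular? v

  Inner : Fin n → Fin n → Set
  Inner y v = U v × (∀ w → v ~ w → w ∈ Y) × v ~ y

  -- Two such vertices are nonadjacent, since all neighbours of one lie in Y and the other does not.
  -- With y as common neighbour they are twins.
  cover-inner : ∀ y → Cover (Inner y) θ
  cover-inner y = cover-twins (λ v → U? v ×-dec (Fin.all? (λ w → (v ~? w) →-dec (w ∈Y?)) ×-dec (v ~? y)))
    (λ (_ , _ , vy) → y , vy)
    λ {u} {v} ((u∉ , tri-u) , u⊆Y , uy) ((v∉ , tri-v) , _ , vy) →
      nonadjacent-twins u∉ v∉ tri-u tri-v (λ uv → v∉ (u⊆Y v uv)) uy vy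

  Missed : Fin n → Fin n → Set
  Missed z v = U v × ¬ v ~ z × ∃[ u ] u ∉ Y × v ~ u × z ~ u

  missed? : ∀ z v → Dec (Missed z v)
  missed? z v = U? v ×-dec (¬? (v ~? z) ×-dec Fin.any? λ u → ¬? (u ∈Y?) ×-dec ((v ~? u) ×-dec (z ~? u)))

  -- All v missed by z are twins. If two of them share an outside neighbour u with z, they are
  -- nonadjacent, for else u would be the centre of a paw with pendant vertex z. Let v have u, let
  -- v′ have u′, and let v not be adjacent to u′. If u and u′ are adjacent, v and u′ are twins and v
  -- is adjacent to z; if not, u and u′ are twins and v is adjacent to u′. Both are absurd.
  cover-missed : ∀ z → Cover (Missed z) θ
  cover-missed z = cover-twins (missed? z) (λ (_ , _ , u , _ , vu , _) → u , vu) twins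
    where
    common : ∀ {v v′ u} → U v → U v′ → ¬ v ~ z → ¬ v′ ~ z → u ∉ Y → v ~ u → v′ ~ u → z ~ u → Twin G v v′
    common {v} {v′} (v∉ , tri) (v′∉ , tri′) ¬vz ¬v′z u∉ vu v′u zu = nonadjacent-twins v∉ v′∉ tri tri′
      (λ vv′ → u∉ (centre∈Y (vv′ , v′u , vu , flip zu , ¬vz , ¬v′z))) vu v′u
    twins : ∀ {v v′} → Missed z v → Missed z v′ → Twin G v v′
    twins {v} {v′} (Uv@(v∉ , tri) , ¬vz , u , u∉ , vu , zu) (Uv′@(v′∉ , tri′) , ¬v′z , u′ , u′∉ , v′u′ , zu′)
      with v ~? u′ | u ~? u′
    ... | yes vu′ | _       = common Uv Uv′ ¬vz ¬v′z u′∉ vu′ v′u′ zu′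
    ... | no ¬vu′ | yes uu′ = contradiction
            (proj₂ (nonadjacent-twins v∉ u′∉ tri (triangular-neighbour v′∉ tri′ v′u′) ¬vu′ vu (flip uu′) z) (flip zu′)) ¬vz
    ... | no ¬vu′ | no ¬uu′ = contradiction
            (flip (proj₁ (nonadjacent-twins u∉ u′∉ (triangular-neighbour v∉ tri vu) (triangular-neighbour v′∉ tri′ v′u′) ¬uu′ (flip zu) (flip zu′) v) (flip vu))) ¬vu′

  -- What the other charges leave over: a vertex of Y sharing an outside neighbour with v must be
  -- adjacent to v.
  Universal : Fin n → Set
  Universal v = U v × (∃[ u ] v ~ u × u ∉ Y) × (∀ z → z ∈ Y → ¬ Missed z v)

  universal? : ∀ v → Dec (Universal v)
  universal? v = U? v ×-dec (Fin.any? (λ u → (v ~? u) ×-dec ¬? (u ∈Y?)) ×-dec Fin.all? (λ z → (z ∈Y?) →-dec ¬? (missed? z v)))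

  second-neighbour : ∀ {v u z} → Universal v → v ~ u → u ∉ Y → u ~ z → v ~ z ⊎ Twin G z v
  second-neighbour {v} {u} {z} (Uv@(v∉ , tri) , _ , unmissed) vu u∉ uz with v ~? z | z ∈Y?
  ... | yes vz | _      = inj₁ vz
  ... | no ¬vz | yes z∈ = contradiction (Uv , ¬vz , u , u∉ , vu , flip uz) (unmissed z z∈)
  ... | no ¬vz | no z∉  = inj₂ (nonadjacent-twins z∉ v∉
            (triangular-neighbour u∉ (triangular-neighbour v∉ tri vu) uz) tri (¬vz ∘ flip) (flip uz) vu)

  -- The component rule fails at v. Its multipartite half holds for every v outside Y by
  -- `not-centre`, so it is closedness that fails.
  open-component : ∀ {v x} → v ∉ Y → v ~ x → ∃[ x ] ∃[ z ] v ~ x × x ~ z × ¬ v ~ z × ¬ Twin G z v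
  open-component {v} {x} v∉ vx with Fin.any? (λ x → Fin.any? (λ z → (v ~? x) ×-dec ((x ~? z) ×-dec (¬? (v ~? z) ×-dec ¬? (sat? G k (twin 0F 1F) (z ∷ v ∷ []))))))
  ... | yes found = found
  ... | no none   = contradiction ((x , vx) , inj₂ (inj₂ (inj₂ (closed , multipartite)))) (irremovable v)
    where
    closed : ∀ x z → v ~ x × x ~ z → v ~ z ⊎ Twin G z v
    closed x z (vx , xz) with v ~? z | sat? G k (twin 0F 1F) (z ∷ v ∷ [])
    ... | yes vz | _      = inj₁ vz
    ... | no _   | yes tw = inj₂ tw
    ... | no ¬vz | no ¬tw = contradiction (x , z , vx , xz , ¬vz , ¬tw) none
    multipartite : ∀ x y z → v ~ x × v ~ y × v ~ z × x ~ z → x ~ y ⊎ y ~ z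
    multipartite x y z (vx , vy , vz , xz) = [ inj₁ ∘ flip , inj₂ ]′ (not-centre v∉ vx vz xz vy)

  -- The vertex z shows that the component of v is not just its block, and u is not adjacent to z by
  -- `second-neighbour`. In each case there is a paw with v as an end of its triangle and z as
  -- pendant vertex; v being outside X, its centre lies in X.
  neighbour-in-X : ∀ {v} → Universal v → ∃[ x ] x ∈ X × v ~ x
  neighbour-in-X {v} univ@((v∉ , tri) , (u , vu , u∉) , _) with open-component v∉ vu
  ... | x , z , vx , xz , ¬vz , ¬tw = choose (u ~? x)
    where
    ¬uz : ¬ u ~ z
    ¬uz uz = [ ¬vz , ¬tw ]′ (second-neighbour univ vu u∉ uz)
    v∉X : v ∉ X
    v∉X = v∉ ∘ X⊆Y
    choose : Dec (u ~ x) → ∃[ x ] x ∈ X × v ~ x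
    choose (yes ux) = x , centre∈X (vu , ux , vx , xz , ¬vz , ¬uz) v∉X , vx
    choose (no ¬ux) with triangle-through v∉ tri vx
    ... | w , vw , wx with not-centre v∉ vx vw (flip wx) vu | w ~? z
    ...   | inj₁ ux | _       = contradiction ux ¬ux
    ...   | inj₂ uw | yes wz  = w , centre∈X (vu , uw , vw , wz , ¬vz , ¬uz) v∉X , vw
    ...   | inj₂ uw | no ¬wz  = x , centre∈X (vw , wx , vx , xz , ¬vz , ¬wz) v∉X , vx

  -- Fix one such v. Another one is a twin of v if they are nonadjacent, by way of x; otherwise it
  -- is in the same block and equals or is a twin of one of at most θ chosen representatives. The
  -- class of v, never represented among these, accounts for the successor.
  cover-universal : ∀ x → Cover (λ v → Universal v × v ~ x) (suc θ * θ)
  cover-universal x = cover-choice (λ v → universal? v ×-dec (v ~? x)) cover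
    where
    cover : ∀ v → Universal v × v ~ x → Cover (λ v → Universal v × v ~ x) (suc θ * θ)
    cover v (univ@((v∉ , tri) , _) , vx) =
      concatMap twin-list (v ∷ take θ parts) ,
      ≤-trans (length-concatMap twin-list (λ w → length-take θ (twins-of w)) (v ∷ take θ parts)) (*-monoˡ-≤ θ (s≤s (length-take θ parts))) ,
      listed
      where
      twin-list : Fin n → List (Fin n)
      twin-list w = take θ (twins-of w)
      parts : List (Fin n)
      parts = picks G k same-block (0F ∼ 1F) (v ∷ [])
      parts-≤ : length parts ≤ θ
      parts-≤ = ≮⇒≥ λ large → irremovable v ((x , vx) , inj₂ (inj₂ (inj₁ (subst (θ <_) (length-picks G k same-block (0F ∼ 1F) (v ∷ [])) large))))
      listed : ∀ {u} → Universal u × u ~ x → u ∈ concatMap twin-list (v ∷ take θ parts)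
      listed {u} (univ-u@((u∉ , tri-u) , _) , ux) with v ~? u
      ... | no ¬vu = ∈-concatMap twin-list (v ∷ take θ parts) (here refl)
              (∈-twins-of vx (nonadjacent-twins u∉ v∉ tri-u tri (¬vu ∘ flip) ux vx))
      ... | yes vu = in-part (picks-maximal G k same-block (0F ∼ 1F) (v ∷ []) u
              (vu , (λ z uz → second-neighbour univ vu u∉ uz) , (λ z vz → second-neighbour univ-u (flip vu) v∉ vz)))
        where
        in-part : u ∈ parts ⊎ ∃[ p ] p ∈ parts × ¬ u ~ p → u ∈ concatMap twin-list (v ∷ take θ parts)
        in-part (inj₁ u∈) = ∈-concatMap twin-list (v ∷ take θ parts) (there (∈-take θ parts-≤ u∈)) (∈-twins-of ux λ _ → id , id)
        in-part (inj₂ (p , p∈ , ¬up)) with picks-sound G k same-block (0F ∼ 1F) (v ∷ []) p∈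
        ... | vp , _ , β = ∈-concatMap twin-list (v ∷ take θ parts) (there (∈-take θ parts-≤ p∈))
                (∈-twins-of (flip vp) ([ (λ pu → contradiction (flip pu) ¬up) , id ]′ (β u vu)))

  size-bound : ℕ
  size-bound = length Y + (length Y * θ + (length Y * θ + (length Y * θ + length X * (suc θ * θ))))

  cover-alive : Cover (λ v → ∃ (v ~_)) size-bound
  cover-alive =
    let l , le , ∈l = cover-⊎ (Y , ≤-refl , id) (cover-⊎ (cover-⋃ Y cover-outer) (cover-⊎ (cover-⋃ Y cover-inner)
                        (cover-⊎ (cover-⋃ Y cover-missed) (cover-⋃ X cover-universal))))
    in l , le , λ (w , vw) → ∈l (classify vw)
    where
    classify : ∀ {v w} → v ~ w → v ∈ Y ⊎ (∃[ w ] w ∈ Y × Outer w v) ⊎ (∃[ y ] y ∈ Y × Inner y v)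
      ⊎ (∃[ z ] z ∈ Y × Missed z v) ⊎ (∃[ x ] x ∈ X × Universal v × v ~ x)
    classify {v} vw with v ∈Y? | triangular? v
    ... | yes v∈ | _       = inj₁ v∈
    ... | no v∉  | no ¬tri = inj₂ (inj₁ (outer-case vw ¬tri))
    ... | no v∉  | yes tri with Fin.any? (λ u → (v ~? u) ×-dec ¬? (u ∈Y?))
    ...   | no all-in-Y = inj₂ (inj₂ (inj₁ (-, inside (proj₁ (proj₂ (proj₂ tri))) , (v∉ , tri) , (λ _ → inside) , proj₁ (proj₂ (proj₂ tri)))))
      where
      inside : ∀ {w} → v ~ w → w ∈ Y
      inside {w} vw = decidable-stable (w ∈Y?) λ w∉ → all-in-Y (w , vw , w∉)
    ...   | yes outside with Fin.any? (λ z → (z ∈Y?) ×-dec missed? z v)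
    ...     | yes missed = inj₂ (inj₂ (inj₂ (inj₁ missed)))
    ...     | no ¬missed =
              let univ = (v∉ , tri) , outside , λ z z∈ m → ¬missed (z , z∈ , m)
                  x , x∈ , vx = neighbour-in-X univ
              in inj₂ (inj₂ (inj₂ (inj₂ (x , x∈ , univ , vx))))

  alive-bound : length (alive G k) ≤ 280 * θ ^ 3
  alive-bound = let l , le , ∈l = cover-alive in begin
    length (alive G k)                     ≤⟨ unique-length (alive-unique G k) (∈l ∘ alive-sound G k) ⟩
    length l                               ≤⟨ le ⟩
    size-bound                             ≤⟨ +-mono-≤ length-Y (+-mono-≤ Yθ (+-mono-≤ Yθ (+-mono-≤ Yθ (*-monoˡ-≤ (suc θ * θ) length-X)))) ⟩
    y θ + (y θ * θ + (y θ * θ + (y θ * θ + θ * 4 * (suc θ * θ))))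
                                           ≤⟨ cubic θ (≤-trans (≤-trans (s≤s z≤n) (m≤n+m 3 k)) (m≤n+m (k + 3) k)) ⟩
    280 * θ ^ 3                            ∎
    where
    open ≤-Reasoning
    y : ℕ → ℕ
    y t = t * 4 + t * 16 * (t * 4)
    Yθ : length Y * θ ≤ y θ * θ
    Yθ = *-monoˡ-≤ θ length-Y
    -- The sum of the covers is 196t³ + 80t² + 4t, and 280 is the sum of these coefficients.
    remainder : ∀ s → let t = 1 + s in
      280 * (t * (t * (t * 1))) ≡
      ((t * 4 + t * 16 * (t * 4)) + ((t * 4 + t * 16 * (t * 4)) * t + ((t * 4 + t * 16 * (t * 4)) * t
        + ((t * 4 + t * 16 * (t * 4)) * t + t * 4 * ((1 + t) * t))))) + (88 * s + 172 * (s * s) + 84 * (s * (s * s)))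
    remainder = solve-∀
    cubic : ∀ t → 1 ≤ t → y t + (y t * t + (y t * t + (y t * t + t * 4 * (suc t * t)))) ≤ 280 * t ^ 3
    cubic (suc s) _ = ≤-trans (m≤m+n _ (88 * s + 172 * (s * s) + 84 * (s * (s * s)))) (≤-reflexive (sym (remainder s)))

-- Termination and the final bounds

open Reduction forced removable refuted
open Reduced

module _ {n : ℕ} where

  -- Removing a forced edge lowers the first summand, deleting a vertex lowers the second, and
  -- neither raises the other.
  potential : Graph n × ℕ → ℕ
  potential (G , k) = k + length (alive G k)

  step-solvable : ∀ {s t : Graph n × ℕ} → Step s t → uncurry Solvable s ⇔ uncurry Solvable t
  step-solvable {G , k} (remove a b (0<k , ab , large)) = mk⇔ (remove-forced G k a b ab large) (restore-forced G k a b 0<k ab)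
  step-solvable {G , k} (delete v rule)                 = mk⇔ (delete-solvable G k v) (delete-sound G k v rule)
  step-solvable         (stop _)                        = ⇔-id _

  step-parameter : ∀ {s t : Graph n × ℕ} → Step s t → proj₂ t ≤ proj₂ s
  step-parameter (remove _ _ _) = pred[n]≤n
  step-parameter (delete _ _)   = ≤-refl
  step-parameter (stop _)       = ≤-refl

  step-progress : ∀ {s t : Graph n × ℕ} → Step s t → (Reduced s × t ≡ s) ⊎ potential t < potential s
  step-progress (stop done) = inj₁ (done , refl)
  step-progress {G , k} (remove a b (0<k , _)) = inj₂ (+-mono-<-≤ (pred-< 0<k)
    (unique-length (alive-unique G′ (pred k)) λ v∈ → let _ , e = alive-sound G′ (pred k) v∈ in
      alive-complete G k (proj₁ (keep⁻ G (λ i j → sat? G k otherPair (i ∷ j ∷ a ∷ b ∷ [])) e))))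
    where
    G′ = prune G k otherPair (a ∷ b ∷ [])
    pred-< : ∀ {k} → 0 < k → pred k < k
    pred-< {suc k} _ = ≤-refl
  step-progress {G , k} (delete v ((w , vw) , _)) = inj₂ (+-monoʳ-< k
    (unique-length {xs = v ∷ alive G′ k} (All.tabulate v∉ ∷ alive-unique G′ k)
      λ { (here refl) → alive-complete G k vw
        ; (there u∈)  → let _ , e = alive-sound G′ k u∈ in alive-complete G k (proj₁ (∖v⁻ G k v G e)) }))
    where
    G′ = prune G k otherVertex (v ∷ [])
    v∉ : ∀ {u} → u ∈ alive G′ k → v ≢ u
    v∉ u∈ refl = let _ , e = alive-sound G′ k u∈ in proj₁ (proj₂ (∖v⁻ G k v G e)) refl

  module _ {X : Set} (s : Graph n × ℕ) where

    private
      iterate : List X → Graph n × ℕ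
      iterate = foldr (λ _ → step) s

    iterate-solvable : ∀ xs → uncurry Solvable s ⇔ uncurry Solvable (iterate xs)
    iterate-solvable []       = ⇔-id _
    iterate-solvable (_ ∷ xs) = step-solvable (step-cases (iterate xs)) ⇔-∘ iterate-solvable xs

    iterate-parameter : ∀ xs → proj₂ (iterate xs) ≤ proj₂ s
    iterate-parameter []       = ≤-refl
    iterate-parameter (_ ∷ xs) = ≤-trans (step-parameter (step-cases (iterate xs))) (iterate-parameter xs)

    iterate-progress : ∀ xs → Reduced (iterate xs) ⊎ potential (iterate xs) + length xs ≤ potential s
    iterate-progress []       = inj₂ (≤-reflexive (+-identityʳ _))
    iterate-progress (_ ∷ xs) with step-progress (step-cases (iterate xs)) | iterate-progress xs
    ... | inj₁ (done , eq) | _         = inj₁ (subst Reduced (sym eq) done)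
    ... | inj₂ less        | inj₂ le   = inj₂ (≤-trans (≤-reflexive (+-suc _ (length xs))) (≤-trans (+-monoˡ-≤ (length xs) less) le))
    ... | inj₂ less        | inj₁ done = inj₁ (⊥-elim (stuck (step-cases (iterate xs)) less))
      where
      stuck : ∀ {t} → Step (iterate xs) t → potential t < potential (iterate xs) → ⊥
      stuck (remove a b f) _  = unforced done a b f
      stuck (delete v r)   _  = irremovable done v r
      stuck (stop _)       lt = <-irrefl refl lt

  -- If all 2n steps made progress, the potential has fallen from at most 2n to 0. A further step
  -- could not lower it, so the state is reduced.
  exhaust-reduced : ∀ (G : Graph n) {k} → k ≤ n → Reduced (exhaust (G , k))
  exhaust-reduced G {k} k≤n with iterate-progress (G , k) (allFin n ++ allFin n)
  ... | inj₁ done = subst Reduced (sym (exhaust-iterates (G , k))) done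
  ... | inj₂ le   = subst Reduced (sym (exhaust-iterates (G , k))) $ at-zero (n≤0⇒n≡0 (+-cancelʳ-≤ (n + n) _ 0 (begin
          potential s + (n + n)                               ≡⟨ cong (potential s +_) fuel ⟨
          potential s + length (allFin n ++ allFin n)         ≤⟨ le ⟩
          k + length (alive G k)                              ≤⟨ +-mono-≤ k≤n alive≤n ⟩
          n + n ∎)))
    where
    open ≤-Reasoning
    s : Graph n × ℕ
    s = foldr (λ _ → step) (G , k) (allFin n ++ allFin n)
    length-allFin : length (allFin n) ≡ n
    length-allFin = List.length-tabulate id
    fuel : length (allFin n ++ allFin n) ≡ n + n
    fuel = trans (List.length-++ (allFin n)) (cong₂ _+_ length-allFin length-allFin)
    alive≤n : length (alive G k) ≤ n
    alive≤n = subst (length (alive G k) ≤_) length-allFin (unique-length (alive-unique G k) λ _ → ∈-allFin _)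
    at-zero : potential s ≡ 0 → Reduced s
    at-zero zero-potential = irreducible (step-progress (step-cases s))
      where
      irreducible : (Reduced s × step s ≡ s) ⊎ potential (step s) < potential s → Reduced s
      irreducible (inj₁ (done , _)) = done
      irreducible (inj₂ less)       = contradiction (subst (potential (step s) <_) zero-potential less) λ ()

alive-cubic : ∀ {n} (G : Graph n) k → Reduced (G , k) → ¬ Sat G k refuted [] → length (alive G k) ≤ 280 * threshold k ^ 3
alive-cubic {zero}  G k _        _  = z≤n
alive-cubic {suc n} G k red ur = Irreducible.alive-bound G k (irremovable red) ur zero

finish-solvable : ∀ {n} (s : Graph n × ℕ) → Reduced s → uncurry Solvable s ⇔ YesInstance (finish s)
finish-solvable (G , k) red =
  [ (λ (r , eq) → subst (λ J → Solvable G k ⇔ YesInstance J) (sym eq)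
      (mk⇔ (⊥-elim ∘ refuted-unsolvable G k (unforced red) r) (⊥-elim ∘ paw-unsolvable)))
  , (λ (_ , eq) → subst (λ J → Solvable G k ⇔ YesInstance J) (sym eq) (mk⇔ (compress⁺ G k) (compress⁻ G k))) ]′
  (finish-cases (G , k))

finish-parameter : ∀ {n} (s : Graph n × ℕ) → parameter (finish s) ≤ proj₂ s
finish-parameter s =
  [ (λ (_ , eq) → ≤-trans (≤-reflexive (cong parameter eq)) z≤n)
  , (λ (_ , eq) → ≤-reflexive (cong parameter eq)) ]′ (finish-cases s)

1≤threshold : ∀ k → 1 ≤ threshold k
1≤threshold k = ≤-trans (≤-trans (s≤s z≤n) (m≤n+m 3 k)) (m≤n+m (k + 3) k)

finish-order : ∀ {n} (s : Graph n × ℕ) → Reduced s → order (finish s) ≤ 280 * threshold (proj₂ s) ^ 3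
finish-order (G , k) red =
  [ (λ (_ , eq) → ≤-trans (≤-reflexive (cong order eq))
      (≤-trans (m≤m+n 4 276) (m≤m*n 280 (threshold k ^ 3) {{>-nonZero (1≤^ 3 (1≤threshold k))}})))
  , (λ (¬r , eq) → ≤-trans (≤-reflexive (cong order eq)) (alive-cubic G k red ¬r)) ]′ (finish-cases (G , k))

order-bound : ℕ → ℕ
order-bound k = 280 * threshold k ^ 3

order-bound-mono : ∀ {j k} → j ≤ k → order-bound j ≤ order-bound k
order-bound-mono j≤k = *-monoʳ-≤ 280 (^-monoˡ-≤ 3 (+-mono-≤ j≤k (+-monoˡ-≤ 3 j≤k)))

cubic-∈O : ∀ a b (f : ℕ → ℕ) → (∀ k → 1 ≤ k → f k ≤ b * k) → (λ k → a * f k ^ 3) ∈O (λ k → k ^ 3)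
cubic-∈O a b f linear = a * b ^ 3 , 1 , λ k 1≤k → begin
  a * f k ^ 3          ≤⟨ *-monoʳ-≤ a (^-monoˡ-≤ 3 (linear k 1≤k)) ⟩
  a * (b * k) ^ 3      ≡⟨ cong (a *_) (cube b k) ⟩
  a * (b ^ 3 * k ^ 3)  ≡⟨ *-assoc a (b ^ 3) (k ^ 3) ⟨
  a * b ^ 3 * k ^ 3    ∎
  where
  open ≤-Reasoning
  cube : ∀ b k → (b * k) * ((b * k) * ((b * k) * 1)) ≡ (b * (b * (b * 1))) * (k * (k * (k * 1)))
  cube = solve-∀

order-bound-cubic : order-bound ∈O (λ k → k ^ 3)
-- The factor 5 comes from 2k + 3 ≤ 5k for k ≥ 1.
order-bound-cubic = cubic-∈O 280 5 threshold λ k 1≤k →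
  ≤-trans (+-monoʳ-≤ k (+-monoʳ-≤ k (*-monoʳ-≤ 3 1≤k))) (≤-reflexive (five k))
  where
  five : ∀ k → k + (k + 3 * k) ≡ 5 * k
  five = solve-∀

exhaust-solvable : ∀ {n} (s : Graph n × ℕ) → uncurry Solvable s ⇔ uncurry Solvable (exhaust s)
exhaust-solvable {n} s = subst (λ t → uncurry Solvable s ⇔ uncurry Solvable t) (sym (exhaust-iterates s)) $
  iterate-solvable s (allFin n ++ allFin n)

kernel-solvable : ∀ I → YesInstance I ⇔ YesInstance (kernel I)
kernel-solvable I =
  [ (λ (_ , eq) → subst (λ J → YesInstance I ⇔ YesInstance J) (sym eq) (⇔-id _))
  , (λ (k≤n , eq) → subst (λ J → YesInstance I ⇔ YesInstance J) (sym eq)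
      (finish-solvable (exhaust s) (exhaust-reduced (graph I) k≤n) ⇔-∘ exhaust-solvable s)) ]′ (kernel-cases I)
  where s = graph I , parameter I

exhaust-parameter : ∀ {n} (s : Graph n × ℕ) → proj₂ (exhaust s) ≤ proj₂ s
exhaust-parameter {n} s = subst (λ t → proj₂ t ≤ proj₂ s) (sym (exhaust-iterates s)) $
  iterate-parameter s (allFin n ++ allFin n)

kernel-parameter : ∀ I → parameter (kernel I) ≤ parameter I
kernel-parameter I =
  [ (λ (_ , eq) → ≤-reflexive (cong parameter eq))
  , (λ (_ , eq) → ≤-trans (≤-reflexive (cong parameter eq))
      (≤-trans (finish-parameter (exhaust s)) (exhaust-parameter s))) ]′ (kernel-cases I)
  where s = graph I , parameter I

kernel-order : ∀ I → order (kernel I) ≤ order-bound (parameter I)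
kernel-order I =
  [ (λ (n<k , eq) → ≤-trans (≤-reflexive (cong order eq)) (≤-trans (<⇒≤ n<k) (k≤order-bound (parameter I))))
  , (λ (k≤n , eq) → ≤-trans (≤-reflexive (cong order eq)) (≤-trans
      (finish-order (exhaust s) (exhaust-reduced (graph I) k≤n)) (order-bound-mono (exhaust-parameter s)))) ]′ (kernel-cases I)
  where
  s = graph I , parameter I
  k≤order-bound : ∀ k → k ≤ order-bound k
  k≤order-bound k = begin
    k                      ≤⟨ m≤m+n k (k + 3) ⟩
    threshold k            ≡⟨ *-identityʳ (threshold k) ⟨
    threshold k ^ 1        ≤⟨ ^-monoʳ-≤ (threshold k) {{>-nonZero (1≤threshold k)}} {1} {3} (s≤s z≤n) ⟩
    threshold k ^ 3        ≤⟨ m≤m+n _ _ ⟩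
    280 * threshold k ^ 3  ∎
    where open ≤-Reasoning

theorem3 : Σ[ kernel ∈ (Instance → Instance) ]
    PolyTimeComputable encodeInstance encodeInstance kernel
    × (∀ I → YesInstance I ⇔ YesInstance (kernel I))
    × (∀ I → parameter (kernel I) ≤ parameter I)
    × Σ[ bound ∈ (ℕ → ℕ) ]
    (bound ∈O (λ k → k ^ 3))
    × (∀ I → order (kernel I) ≤ bound (parameter I))
theorem3 = kernel , polyTime , kernel-solvable , kernel-parameter , order-bound , order-bound-cubic , kernel-order
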